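{- There is an algorithm that, given a graph $G$ with cluster deletion number $k$, computes ${\rm I}_v(G)$ in time $f(k)\cdot |V(G)|^{\mathcal{O}(1)}$ for some computable function $f$ (i.e., the problem is FPT parameterised by cluster deletion number).
   Context: The cluster deletion number of $G=(V,E)$ is the minimum size of a set $S\subseteq V$ such that every connected component of $G[V\setminus S]$ is a clique. A graph is locally irregular if no two adjacent vertices have the same degree. A vertex-irregulator of $G$ is a set $S\subseteq V$ such that $G[V\setminus S]$ is locally irregular; ${\rm I}_v(G)$ denotes the minimum cardinality of a vertex-irregulator. -}

module Defs where

open import Data.Bool using (Bool; true; false; T)
open import Data.Fin using (Fin)
open import Data.Fin.Subset using (Subset; _∈_; _∩_; ∁; ∣_∣)
open import Data.List using (List; []; _∷_; map; allFin; replicate)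
open import Data.Nat using (ℕ; suc; _+_; _≤_)
open import Data.Product using (_×_; ∃-syntax)
open import Data.Vec using (Vec; []; _∷_; lookup; tabulate)
open import Level using (0ℓ)
open import Relation.Binary using (Rel)
open import Relation.Binary.Construct.Closure.ReflexiveTransitive using (Star)
open import Relation.Binary.PropositionalEquality using (_≡_; _≢_)
open import Relation.Unary using (Pred)

private
  variable
    a b n : ℕ

------------------------------------------------------------------------
-- Finite simple graphs.  The induced subgraph G[U] is represented by the
-- pair of G and U; its degrees and paths only involve vertices of U.

record Graph (n : ℕ) : Set where
  field
    adjacent : Fin n → Fin n → Bool
    symmetric : ∀ i j → adjacent i j ≡ adjacent j i
    loopless : ∀ i → adjacent i i ≡ false

  Edge : Rel (Fin n) 0ℓ
  Edge i j = T (adjacent i j)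

  neighbours : Fin n → Subset n
  neighbours i = tabulate (adjacent i)

open Graph public

degree : Graph n → Subset n → Fin n → ℕ
degree G U i = ∣ neighbours G i ∩ U ∣

LocallyIrregular : Graph n → Subset n → Set
LocallyIrregular G U =
  ∀ i j → i ∈ U → j ∈ U → Edge G i j → degree G U i ≢ degree G U j

InducedEdge : Graph n → Subset n → Rel (Fin n) 0ℓ
InducedEdge G U i j = i ∈ U × j ∈ U × Edge G i j

component : Graph n → Subset n → Fin n → Pred (Fin n) 0ℓ
component G U i j = Star (InducedEdge G U) i j

IsClique : Graph n → Pred (Fin n) 0ℓ → Set
IsClique G C = ∀ i j → C i → C j → i ≢ j → Edge G i j

ComponentsAreCliques : Graph n → Subset n → Set
ComponentsAreCliques G U = ∀ i → i ∈ U → IsClique G (component G U i)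

IsMinimumSize : (Subset n → Set) → ℕ → Set
IsMinimumSize P k =
  (∃[ S ] (P S × ∣ S ∣ ≡ k)) × (∀ S → P S → k ≤ ∣ S ∣)

IsClusterDeletionSet : Graph n → Subset n → Set
IsClusterDeletionSet G S = ComponentsAreCliques G (∁ S)

IsClusterDeletionNumber : Graph n → ℕ → Set
IsClusterDeletionNumber G = IsMinimumSize (IsClusterDeletionSet G)

IsVertexIrregulator : Graph n → Subset n → Set
IsVertexIrregulator G S = LocallyIrregular G (∁ S)

-- IsIᵥ G m states that Iᵥ(G) = m.
IsIᵥ : Graph n → ℕ → Set
IsIᵥ G = IsMinimumSize (IsVertexIrregulator G)

------------------------------------------------------------------------
-- Model of computation: a first-order, call-by-value functional language
-- whose data are binary trees (pure Lisp with nil as the only atom; compare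
-- the languages WHILE and F of N. D. Jones, "Computability and Complexity
-- from a Programming Perspective").  Every evaluated syntax node costs one
-- unit.  No primitive copies or compares whole trees, so with trees
-- represented by shared pointers each unit is a constant number of
-- pointer operations for a fixed program.  The model is thus polynomially
-- equivalent to Turing machines and RAMs, and a bound of the form
-- f(k) · |V|^O(1) with f computable means the same in all of them.

data Tree : Set where
  nil  : Tree
  cons : Tree → Tree → Tree

-- Expr a n: expressions with n variables (de Bruijn indices), in the body
-- of a function of arity a.  A function may call itself (self) and other
-- functions whose definitions are closed (call).
mutual
  data Expr (a : ℕ) : ℕ → Set where
    var  : Fin n → Expr a n
    nil  : Expr a n
    cons : Expr a n → Expr a n → Expr a n
    -- case e e₀ e₁: e₀ if e is nil, else e₁ with the head of e bound to
    -- variable 0 and its tail to variable 1.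
    case : Expr a n → Expr a n → Expr a (2 + n) → Expr a n
    bind : Expr a n → Expr a (1 + n) → Expr a n
    self : Vec (Expr a n) a → Expr a n
    call : Function b → Vec (Expr a n) b → Expr a n

  data Function (a : ℕ) : Set where
    fun : Expr a a → Function a

-- F , ρ ⊢ e ⇓ v ⟨ t ⟩: inside the function F and with variables valued by
-- ρ, evaluation of e ends with value v after t units of time.
infix 4 _,_⊢_⇓_⟨_⟩ _,_⊢_⇓*_⟨_⟩ _·_⇓_⟨_⟩

mutual
  data _,_⊢_⇓_⟨_⟩ (F : Function a) (ρ : Vec Tree n) :
                  Expr a n → Tree → ℕ → Set where
    var : ∀ x → F , ρ ⊢ var x ⇓ lookup ρ x ⟨ 1 ⟩

    nil : F , ρ ⊢ nil ⇓ nil ⟨ 1 ⟩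

    cons : ∀ {e₁ e₂ v₁ v₂ t₁ t₂} →
           F , ρ ⊢ e₁ ⇓ v₁ ⟨ t₁ ⟩ →
           F , ρ ⊢ e₂ ⇓ v₂ ⟨ t₂ ⟩ →
           F , ρ ⊢ cons e₁ e₂ ⇓ cons v₁ v₂ ⟨ 1 + t₁ + t₂ ⟩

    case-nil : ∀ {e e₀ e₁ v t₁ t₂} →
               F , ρ ⊢ e ⇓ nil ⟨ t₁ ⟩ →
               F , ρ ⊢ e₀ ⇓ v ⟨ t₂ ⟩ →
               F , ρ ⊢ case e e₀ e₁ ⇓ v ⟨ 1 + t₁ + t₂ ⟩

    case-cons : ∀ {e e₀ e₁ h l v t₁ t₂} →
                F , ρ ⊢ e ⇓ cons h l ⟨ t₁ ⟩ →
                F , h ∷ l ∷ ρ ⊢ e₁ ⇓ v ⟨ t₂ ⟩ →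
                F , ρ ⊢ case e e₀ e₁ ⇓ v ⟨ 1 + t₁ + t₂ ⟩

    bind : ∀ {e e′ u v t₁ t₂} →
           F , ρ ⊢ e ⇓ u ⟨ t₁ ⟩ →
           F , u ∷ ρ ⊢ e′ ⇓ v ⟨ t₂ ⟩ →
           F , ρ ⊢ bind e e′ ⇓ v ⟨ 1 + t₁ + t₂ ⟩

    self : ∀ {es vs v t₁ t₂} →
           F , ρ ⊢ es ⇓* vs ⟨ t₁ ⟩ →
           F · vs ⇓ v ⟨ t₂ ⟩ →
           F , ρ ⊢ self es ⇓ v ⟨ 1 + t₁ + t₂ ⟩

    call : ∀ {b} {F′ : Function b} {es vs v t₁ t₂} →
           F , ρ ⊢ es ⇓* vs ⟨ t₁ ⟩ →
           F′ · vs ⇓ v ⟨ t₂ ⟩ →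
           F , ρ ⊢ call F′ es ⇓ v ⟨ 1 + t₁ + t₂ ⟩

  data _,_⊢_⇓*_⟨_⟩ (F : Function a) (ρ : Vec Tree n) :
                   Vec (Expr a n) b → Vec Tree b → ℕ → Set where
    []  : F , ρ ⊢ [] ⇓* [] ⟨ 0 ⟩

    _∷_ : ∀ {b e v t₁ t₂} {es : Vec (Expr a n) b} {vs} →
          F , ρ ⊢ e ⇓ v ⟨ t₁ ⟩ →
          F , ρ ⊢ es ⇓* vs ⟨ t₂ ⟩ →
          F , ρ ⊢ e ∷ es ⇓* v ∷ vs ⟨ t₁ + t₂ ⟩

  data _·_⇓_⟨_⟩ : Function a → Vec Tree a → Tree → ℕ → Set where
    apply : ∀ {e : Expr a a} {vs v t} →
            fun e , vs ⊢ e ⇓ v ⟨ t ⟩ →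
            fun e · vs ⇓ v ⟨ t ⟩

Program : Set
Program = Function 1

-- The language is deterministic, so at most one output and one running
-- time exist for each input.
ComputesWithin : Program → (input output : Tree) (bound : ℕ) → Set
ComputesWithin p x y bound = ∃[ t ] (p · x ∷ [] ⇓ y ⟨ t ⟩ × t ≤ bound)

encodeList : List Tree → Tree
encodeList []       = nil
encodeList (x ∷ xs) = cons x (encodeList xs)

encodeBool : Bool → Tree
encodeBool false = nil
encodeBool true  = cons nil nil

-- Unary notation.
encodeℕ : ℕ → Tree
encodeℕ m = encodeList (replicate m nil)

-- The adjacency matrix, as the list of its rows.
encodeGraph : Graph n → Tree
encodeGraph {n} G =
  encodeList (map (λ i → encodeList (map (λ j → encodeBool (adjacent G i j)) (allFin n))) (allFin n))

Computable : (ℕ → ℕ) → Set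
Computable f = ∃[ p ] (∀ k → ∃[ t ] (p · encodeℕ k ∷ [] ⇓ encodeℕ (f k) ⟨ t ⟩))

{-# OPTIONS --safe #-}
module Submission where

-- Let S be a cluster deletion set of size k.  Two vertices of a clique of
-- G − S with the same neighbours in S (in the same class) are closed twins, so
-- at most one of them survives in a locally irregular induced subgraph.  The
-- survivors of a clique thus form an option, a set of classes, and they have
-- degree at most B = k + 2 ^ k.  The type of a clique is the set of classes of
-- all its vertices.  Suppose that within one type two options both occur more
-- than B + 1 + k ^ 2 times.  Then occurrences of the one with fewer survivors
-- can be replaced by the other until it is infrequent: vertices of S with
-- degree at most B have no neighbours in frequent options and keep their
-- degrees, other vertices of S can keep a degree above B, and each pair of
-- vertices of S rules out at most one number of replacements.  Hence in some
-- optimal solution all but g(k) cliques of each type, which may be taken to be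
-- the first ones, use the same option, and the solution is determined by the
-- set of surviving (class, type, position cut off at g(k)).
--
-- The program finds S by branching on induced paths with three vertices,
-- chooses one vertex for each such triple, and tries all sets of chosen
-- vertices.  It is written in a total language whose only loops are folds
-- over lists, so that the running time is polynomial in the length of the
-- longest list that it folds over, and this is at most n plus a function of k.

open import Defs
open import Data.Nat using (ℕ; _*_; _^_; _⊔_)
open import Data.Product using (_×_; ∃-syntax; Σ-syntax)
open import Data.Bool using (Bool; true; false; T; if_then_else_)
open import Data.Bool.Properties using (T?)
open import Data.Empty using (⊥)
open import Data.Fin using (Fin; zero; suc; toℕ; fromℕ<; combine; quotient; remainder; funToFin; finToFun; splitAt; _↑ˡ_; _↑ʳ_)
import Data.Fin as Fin
open import Data.Fin.Patterns
import Data.Fin.Properties as Finₚ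
open import Data.Fin.Subset using (Subset; _∈_; _∉_; _∩_; ∣_∣; ∁; ⊤; inside; outside)
open import Data.Fin.Subset.Properties
  using (_∈?_; ∈⊤; x∈p∩q⁺; x∈p∩q⁻; x∈∁p⇒x∉p; x∉p⇒x∈∁p; ∣∁p∣≡n∸∣p∣; ∣⊤∣≡n; ∣p∣≤n)
open import Data.List using (List; []; _∷_; _++_; map; foldr; length; lookup; replicate; filter; allFin)
import Data.List as List
open import Data.List.Membership.Propositional renaming (_∈_ to _∈ˡ_) hiding (_∉_; find)
open import Data.List.Membership.Propositional.Properties
  using (∈-allFin; ∈-lookup; ∈-insert; ∈-++⁻; ∈-map⁻; ∈-filter⁻)
open import Data.List.Properties using (length-++; length-replicate; length-tabulate; map-tabulate)
open import Data.List.Relation.Unary.All using (All; []; _∷_)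
open import Data.List.Relation.Unary.Any using (here; there)
import Data.List.Relation.Unary.Any as Any
import Data.List.Relation.Unary.Any.Properties as Anyₚ
open import Data.Nat using (zero; suc; _+_; _∸_; _⊓_; _≤_; _<_; _<ᵇ_; z≤n; s≤s; z<s)
open import Data.Nat.Properties
open import Data.Nat.Solver using (module +-*-Solver)
open import Data.Product using (_,_; proj₁; proj₂)
open import Data.Sum using (_⊎_; inj₁; inj₂; [_,_]′)
open import Data.Unit using (tt) renaming (⊤ to Unit)
open import Data.Vec using (Vec; []; _∷_; here; there)
import Data.Vec as Vec
open import Data.Vec.Properties using (lookup∘tabulate; lookup⇒[]=; []=⇒lookup)
open import Function using (_∘_; id; mk⇔)
open import Level using (0ℓ)
open import Relation.Binary.Construct.Closure.ReflexiveTransitive using (Star; _◅_) renaming (ε to done)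
open import Relation.Binary.Definitions using (tri<; tri≈; tri>)
open import Relation.Binary.PropositionalEquality hiding ([_])
open import Relation.Nullary using (¬_; Dec; yes; no; does; contradiction; Reflects; ofʸ; ofⁿ)
open import Relation.Nullary.Decidable using (_×-dec_; _⊎-dec_; ¬?; does-⇔)
open import Relation.Unary using (Pred; Decidable)
open import Algebra.Properties.Semiring.Sum +-*-semiring
  using (sum; sum-cong-≗; ∑-distrib-+; ∑-comm; *-distribˡ-sum; *-distribʳ-sum)

-- Finite sums

-- The obstacle is that vertices of `S` have unbounded degrees, and every change in the numbers of
-- uses of options moves them. What saves the argument is how little about these degrees matters. A
-- conflict with a survivor outside `S` can occur only at a degree up to `B`; above that, only
-- coincidences between two vertices of `S` are harmful. Their degrees are affine in the number of
-- replacements, so two degrees that differ at present coincide for at most one other number. All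
-- pairs with distinct degrees are kept apart, adjacent or not, which turns the exchange into a
-- statement about lists of numbers, without a graph. Exchanges stay within one type because an
-- option needs its classes to be present in the clique. Irregularity at vertices outside `S` is
-- then pulled back: each of them has a counterpart in the old solution, of the same class and
-- degree, in the clique from which its option is borrowed. The program is not given k. It learns k
-- as the length of the deletion set that it finds, which therefore has to be a minimum one.

private
  variable
    n : ℕ
    P Q : Set

≡-≤-trans : {a b c : ℕ} → a ≡ b → b ≤ c → a ≤ c
≡-≤-trans refl b≤c = b≤c

𝟙 : Dec P → ℕ
𝟙 d = if does d then 1 else 0

𝟙-yes : (d : Dec P) → P → 𝟙 d ≡ 1
𝟙-yes (yes _) p = refl
𝟙-yes (no ¬p) p = contradiction p ¬p

𝟙-no : (d : Dec P) → ¬ P → 𝟙 d ≡ 0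
𝟙-no (yes p) ¬p = contradiction p ¬p
𝟙-no (no _)  ¬p = refl

𝟙-mono : (d : Dec P) (e : Dec Q) → (P → Q) → 𝟙 d ≤ 𝟙 e
𝟙-mono (yes p) e f = ≤-reflexive (sym (𝟙-yes e (f p)))
𝟙-mono (no _)  e f = z≤n

𝟙-cong : (d : Dec P) (e : Dec Q) → (P → Q) → (Q → P) → 𝟙 d ≡ 𝟙 e
𝟙-cong d e f g = ≤-antisym (𝟙-mono d e f) (𝟙-mono e d g)

𝟙≤1 : (d : Dec P) → 𝟙 d ≤ 1
𝟙≤1 (yes _) = ≤-refl
𝟙≤1 (no _)  = z≤n

𝟙-× : (d : Dec P) (e : Dec Q) → 𝟙 (d ×-dec e) ≡ 𝟙 d * 𝟙 e
𝟙-× (yes _) e = sym (+-identityʳ _)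
𝟙-× (no _)  e = refl

-- Sums over cliques run over all vertices with an indicator in front; this allows rewriting with
-- facts that hold only for representatives.
𝟙-guard : (d : Dec P) {a b : ℕ} → (P → a ≡ b) → 𝟙 d * a ≡ 𝟙 d * b
𝟙-guard (yes p) eq = cong (_+ 0) (eq p)
𝟙-guard (no _)  eq = refl

sum-mono : {f g : Fin n → ℕ} → (∀ i → f i ≤ g i) → sum f ≤ sum g
sum-mono {zero}  p = z≤n
sum-mono {suc n} p = +-mono-≤ (p zero) (sum-mono (p ∘ suc))

sum-const : ∀ n c → sum {n} (λ _ → c) ≡ n * c
sum-const zero    c = refl
sum-const (suc n) c = cong (c +_) (sum-const n c)

sum-zero : {f : Fin n → ℕ} → (∀ i → f i ≡ 0) → sum f ≡ 0
sum-zero {n} p = trans (sum-cong-≗ p) (trans (sum-const n 0) (*-zeroʳ n))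

term≤sum : (f : Fin n → ℕ) (i : Fin n) → f i ≤ sum f
term≤sum f zero    = m≤m+n _ _
term≤sum f (suc i) = ≤-trans (term≤sum (f ∘ suc) i) (m≤n+m _ _)

-- This turns counting into a test for existence. A trace records only whether a class occurs, and
-- it determines cardinalities because at most one survivor of a clique belongs to each class.
sum-unique : {P : Pred (Fin n) 0ℓ} (P? : Decidable P) (d : Dec (∃[ i ] P i)) →
             (∀ i j → P i → P j → i ≡ j) → sum (λ i → 𝟙 (P? i)) ≡ 𝟙 d
sum-unique {zero} P? d u = sym (𝟙-no d λ ())
sum-unique {suc n} {P} P? d u with P? zero
... | yes p = trans (cong suc (sum-zero (λ i → 𝟙-no (P? (suc i)) (λ q → Finₚ.0≢1+n (u zero (suc i) p q)))))
                    (sym (𝟙-yes d (zero , p)))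
... | no ¬p = trans (sum-unique (P? ∘ suc) (Finₚ.any? (P? ∘ suc)) (λ i j p q → Finₚ.suc-injective (u _ _ p q)))
                    (𝟙-cong (Finₚ.any? (P? ∘ suc)) d (λ (i , p) → suc i , p)
                      λ { (zero , p) → contradiction p ¬p ; (suc i , p) → i , p })

sum-pick : ∀ (a : Fin n) (f : Fin n → ℕ) → sum (λ i → 𝟙 (a Finₚ.≟ i) * f i) ≡ f a
sum-pick a f = begin
  sum (λ i → 𝟙 (a Finₚ.≟ i) * f i)   ≡⟨ sum-cong-≗ term ⟩
  sum (λ i → 𝟙 (a Finₚ.≟ i) * f a)   ≡⟨ *-distribʳ-sum (f a) (λ i → 𝟙 (a Finₚ.≟ i)) ⟨
  sum (λ i → 𝟙 (a Finₚ.≟ i)) * f a   ≡⟨ cong (_* f a) (sum-unique (a Finₚ.≟_) (yes (a , refl)) (λ i j p q → trans (sym p) q)) ⟩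
  1 * f a                            ≡⟨ *-identityˡ (f a) ⟩
  f a                                ∎
  where
  open ≡-Reasoning
  term : ∀ i → 𝟙 (a Finₚ.≟ i) * f i ≡ 𝟙 (a Finₚ.≟ i) * f a
  term i with a Finₚ.≟ i
  ... | yes refl = refl
  ... | no _     = refl

sum-fibres : ∀ {m} (t : Fin n → Fin m) (f : Fin n → ℕ) →
             sum (λ j → sum (λ i → 𝟙 (t i Finₚ.≟ j) * f i)) ≡ sum f
sum-fibres t f = trans (∑-comm (λ j i → 𝟙 (t i Finₚ.≟ j) * f i)) (sum-cong-≗ (λ i → sum-pick (t i) (λ _ → f i)))

-- Grouping by code gives `c` fibres, each with at most one element of `P`.
sum-injective : ∀ {c} {P : Pred (Fin n) 0ℓ} (P? : Decidable P) (code : Fin n → Fin c) →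
                (∀ i j → P i → P j → code i ≡ code j → i ≡ j) → sum (λ i → 𝟙 (P? i)) ≤ c
sum-injective {c = c} P? code inj = begin
  sum (λ i → 𝟙 (P? i))
    ≡⟨ sum-fibres code _ ⟨
  sum (λ j → sum (λ i → 𝟙 (code i Finₚ.≟ j) * 𝟙 (P? i)))
    ≡⟨ sum-cong-≗ (λ j → trans (sum-cong-≗ (λ i → sym (𝟙-× (code i Finₚ.≟ j) (P? i))))
         (sum-unique (λ i → (code i Finₚ.≟ j) ×-dec P? i) (Finₚ.any? _)
           (λ i i′ (p , q) (p′ , q′) → inj i i′ q q′ (trans p (sym p′))))) ⟩
  sum (λ j → 𝟙 (Finₚ.any? (λ i → (code i Finₚ.≟ j) ×-dec P? i)))
    ≤⟨ sum-mono (λ j → 𝟙≤1 (Finₚ.any? (λ i → (code i Finₚ.≟ j) ×-dec P? i))) ⟩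
  sum {c} (λ _ → 1)
    ≡⟨ trans (sum-const c 1) (*-identityʳ c) ⟩
  c ∎
  where open ≤-Reasoning

sum-onto : ∀ {m} {P : Pred (Fin n) 0ℓ} (P? : Decidable P) (f : Fin m → Fin n) →
           (∀ {i} → P i → ∃[ j ] f j ≡ i) → sum (λ i → 𝟙 (P? i)) ≤ m
sum-onto {m = m} {P} P? f onto = begin
  sum (λ i → 𝟙 (P? i))                             ≤⟨ sum-mono (λ i → bound i (P? i)) ⟩
  sum (λ i → sum (λ j → 𝟙 (f j Finₚ.≟ i) * 1))     ≡⟨ ∑-comm (λ i j → 𝟙 (f j Finₚ.≟ i) * 1) ⟩
  sum (λ j → sum (λ i → 𝟙 (f j Finₚ.≟ i) * 1))     ≡⟨ sum-cong-≗ (λ j → sum-pick (f j) (λ _ → 1)) ⟩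
  sum {m} (λ _ → 1)                                ≡⟨ trans (sum-const m 1) (*-identityʳ m) ⟩
  m ∎
  where
  open ≤-Reasoning
  bound : ∀ i (d : Dec (P i)) → 𝟙 d ≤ sum (λ j → 𝟙 (f j Finₚ.≟ i) * 1)
  bound i (no _)  = z≤n
  bound i (yes p) with j , refl ← onto p =
    ≡-≤-trans (sym (cong (_* 1) (𝟙-yes (f j Finₚ.≟ f j) refl))) (term≤sum (λ j → 𝟙 (f j Finₚ.≟ i) * 1) j)

card : (p : Subset n) → ∣ p ∣ ≡ sum (λ i → 𝟙 (i ∈? p))
card []            = refl
card (outside ∷ p) = trans (card p) (sum-cong-≗ (λ i → 𝟙-cong (i ∈? p) (suc i ∈? (outside ∷ p)) there λ { (there q) → q }))
card (inside ∷ p)  = cong suc (trans (card p) (sum-cong-≗ (λ i → 𝟙-cong (i ∈? p) (suc i ∈? (inside ∷ p)) there λ { (there q) → q })))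

module _ {P : Pred (Fin n) 0ℓ} (P? : Decidable P) where

  rank : Fin n → ℕ
  rank r = sum (λ i → 𝟙 (P? i ×-dec (i Fin.<? r)))

  rank<count : ∀ r → P r → rank r < sum (λ i → 𝟙 (P? i))
  rank<count r p = begin-strict
    rank r
      <⟨ m<m+n (rank r) {1} z<s ⟩
    rank r + 1
      ≡⟨ cong (rank r +_) (sum-unique (r Finₚ.≟_) (yes (r , refl)) (λ i j p q → trans (sym p) q)) ⟨
    rank r + sum (λ i → 𝟙 (r Finₚ.≟ i))
      ≡⟨ ∑-distrib-+ (λ i → 𝟙 (P? i ×-dec (i Fin.<? r))) (λ i → 𝟙 (r Finₚ.≟ i)) ⟨
    sum (λ i → 𝟙 (P? i ×-dec (i Fin.<? r)) + 𝟙 (r Finₚ.≟ i))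
      ≤⟨ sum-mono term ⟩
    sum (λ i → 𝟙 (P? i)) ∎
    where
    open ≤-Reasoning
    term : ∀ i → 𝟙 (P? i ×-dec (i Fin.<? r)) + 𝟙 (r Finₚ.≟ i) ≤ 𝟙 (P? i)
    term i with r Finₚ.≟ i
    ... | yes refl = ≡-≤-trans (cong (_+ 1) (𝟙-no (P? i ×-dec (i Fin.<? i)) (<-irrefl refl ∘ proj₂))) (≤-reflexive (sym (𝟙-yes (P? i) p)))
    ... | no _     = ≡-≤-trans (+-identityʳ _) (𝟙-mono (P? i ×-dec (i Fin.<? r)) (P? i) proj₁)

-- The ranks of the elements of P are 0, 1, 2, ....
sum-rank : ∀ {n} {P : Pred (Fin n) 0ℓ} (P? : Decidable P) (h : ℕ → ℕ) →
           sum (λ r → 𝟙 (P? r) * h (rank P? r)) ≡ sum {sum (λ i → 𝟙 (P? i))} (h ∘ toℕ)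
sum-rank {zero} P? h = refl
sum-rank {suc n} {P} P? h = begin
  𝟙 (P? zero) * h (rank P? zero) + sum (λ r → 𝟙 (P? (suc r)) * h (rank P? (suc r)))
    ≡⟨ cong₂ _+_ (cong (λ x → 𝟙 (P? zero) * h x) (sum-zero (λ i → 𝟙-no (P? i ×-dec (i Fin.<? zero {n})) λ ())))
                 (sum-cong-≗ (λ r → cong (λ x → 𝟙 (P? (suc r)) * h x) (rank-suc r))) ⟩
  𝟙 (P? zero) * h 0 + sum (λ r → 𝟙 (P? (suc r)) * h (𝟙 (P? zero) + rank (P? ∘ suc) r))
    ≡⟨ cong (𝟙 (P? zero) * h 0 +_) (sum-rank (P? ∘ suc) (λ j → h (𝟙 (P? zero) + j))) ⟩
  𝟙 (P? zero) * h 0 + sum {c} (λ j → h (𝟙 (P? zero) + toℕ j))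
    ≡⟨ split (P? zero) ⟩
  sum {𝟙 (P? zero) + c} (h ∘ toℕ) ∎
  where
  open ≡-Reasoning
  c = sum (λ i → 𝟙 (P? (suc i)))
  split : (d : Dec (P zero)) → 𝟙 d * h 0 + sum {c} (λ j → h (𝟙 d + toℕ j)) ≡ sum {𝟙 d + c} (h ∘ toℕ)
  split (yes _) = cong (_+ sum {c} (λ j → h (suc (toℕ j)))) (+-identityʳ (h 0))
  split (no _)  = refl
  rank-suc : ∀ r → rank P? (suc r) ≡ 𝟙 (P? zero) + rank (P? ∘ suc) r
  rank-suc r = cong₂ _+_
    (𝟙-cong (P? zero ×-dec (zero {n} Fin.<? suc r)) (P? zero) proj₁ (λ p → p , z<s))
    (sum-cong-≗ (λ i → 𝟙-cong (P? (suc i) ×-dec (suc i Fin.<? suc r)) (P? (suc i) ×-dec (i Fin.<? r))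
      (λ { (p , s≤s q) → p , q }) (λ (p , q) → p , s≤s q)))

-- Exchanging options

-- There is one candidate more than there are obstacles. If every candidate were bad, the pigeonhole
-- principle would give one obstacle that spoils two candidates, which `once` excludes.
avoid : ∀ m {Bad : Fin (suc m) → Fin m → Set} → (∀ i j → Dec (Bad i j)) →
        (∀ i i′ j → i Fin.< i′ → Bad i j → Bad i′ j → ⊥) → ∃[ i ] ∀ j → ¬ Bad i j
avoid m {Bad} Bad? once with Finₚ.any? (λ i → Finₚ.all? (λ j → ¬? (Bad? i j)))
... | yes (i , p) = i , p
... | no ¬p =
  let i , i′ , i<i′ , eq = Finₚ.pigeonhole (n<1+n m) (proj₁ ∘ bad) in
  contradiction (subst (Bad i′) (sym eq) (proj₂ (bad i′))) (once i i′ (proj₁ (bad i)) i<i′ (proj₂ (bad i)))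
  where
  bad : ∀ i → ∃[ j ] Bad i j
  bad i with Finₚ.any? (Bad? i)
  ... | yes p = p
  ... | no ¬q = contradiction (i , λ j b → ¬q (j , b)) ¬p

Φ : ∀ {A : Set} → (A → ℕ) → List A → ℕ
Φ w []       = 0
Φ w (x ∷ xs) = w x + Φ w xs

module _ {A : Set} where

  Φ-++ : ∀ (w : A → ℕ) xs ys → Φ w (xs ++ ys) ≡ Φ w xs + Φ w ys
  Φ-++ w []       ys = refl
  Φ-++ w (x ∷ xs) ys = trans (cong (w x +_) (Φ-++ w xs ys)) (sym (+-assoc (w x) _ _))

  Φ-replicate : ∀ (w : A → ℕ) a x → Φ w (replicate a x) ≡ a * w x
  Φ-replicate w zero    x = refl
  Φ-replicate w (suc a) x = cong (w x +_) (Φ-replicate w a x)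

  Φ-length : ∀ (xs : List A) → Φ (λ _ → 1) xs ≡ length xs
  Φ-length []       = refl
  Φ-length (x ∷ xs) = cong suc (Φ-length xs)

  ∈-replicate : ∀ {a} {x y : A} → y ∈ˡ replicate a x → y ≡ x × 0 < a
  ∈-replicate {suc a} (here p)  = p , z<s
  ∈-replicate {suc a} (there p) = proj₁ (∈-replicate p) , z<s

-- Options are numbered by Fin o.  Using option x once is worth val x and adds
-- v x s to the degree of the s-th special vertex; B bounds the degrees at
-- which exact values matter.
module Exchange {k o : ℕ} (val : Fin o → ℕ) (v : Fin o → Fin k → ℕ) (B : ℕ) where

  infix 4 _⇝_
  -- What a change of the special degrees must preserve so that no new conflict arises. Against
  -- neighbours outside `S`, whose degrees are at most `B`, exact values matter only up to `B`;
  -- among themselves, distinct values must stay distinct. The relation is transitive, so exchanges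
  -- can be made one at a time.
  _⇝_ : (d d′ : Fin k → ℕ) → Set
  d ⇝ d′ = (∀ s → d s ≤ B → d′ s ≡ d s) × (∀ s → B < d s → B < d′ s) × (∀ s s′ → d s ≢ d s′ → d′ s ≢ d′ s′)

  ≗⇒⇝ : ∀ {d d′} → d ≗ d′ → d ⇝ d′
  ≗⇒⇝ eq = (λ s _ → sym (eq s)) , (λ s → subst (B <_) (eq s)) ,
            λ s s′ ne eq′ → ne (trans (eq s) (trans eq′ (sym (eq s′))))

  ⇝-trans : ∀ {d d′ d″} → d ⇝ d′ → d′ ⇝ d″ → d ⇝ d″
  ⇝-trans (a , b , c) (a′ , b′ , c′) =
    (λ s le → trans (a′ s (subst (_≤ B) (sym (a s le)) le)) (a s le)) ,
    (λ s → b′ s ∘ b s) , (λ s s′ → c′ s s′ ∘ c s s′)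

  -- The candidate numbers of copies to keep are `suc B`, ..., `suc B + k * k`. The lower end leaves
  -- more than `B` copies; the range has one value more than there are ordered pairs of special
  -- vertices.
  M : ℕ
  M = suc B + k * k

  -- The degree at y is affine in y, so two special vertices that collide for
  -- two values of y collide for all values.
  module _ (c p q : Fin k → ℕ) (a d : ℕ) (M<a : M < a) (M<d : M < d) where

    private
      f : ℕ → Fin k → ℕ
      f y s = c s + (y * p s + (d + (a ∸ y)) * q s)

      -- Affine interpolation at `y + δ` between `y` and `a`, multiplied out to avoid division; the
      -- decomposition of `a` makes the truncated subtractions exact.
      slope : ∀ y δ ε s → a ≡ y + δ + ε → δ * f a s + ε * f y s ≡ (δ + ε) * f (y + δ) s
      slope y δ ε s refl
        rewrite n∸n≡0 (y + δ + ε) | m+n∸m≡n (y + δ) ε | +-assoc y δ ε | m+n∸m≡n y (δ + ε) =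
        solve 7 (λ y δ ε c p q d →
          δ :* (c :+ ((y :+ (δ :+ ε)) :* p :+ (d :+ con 0) :* q)) :+ ε :* (c :+ (y :* p :+ (d :+ (δ :+ ε)) :* q))
          := (δ :+ ε) :* (c :+ ((y :+ δ) :* p :+ (d :+ ε) :* q)))
          refl y δ ε (c s) (p s) (q s) d
        where open +-*-Solver

      collide : ∀ y y′ s s′ → y < y′ → y′ ≤ a → f y s ≡ f y s′ → f y′ s ≡ f y′ s′ → f a s ≡ f a s′
      collide y y′ s s′ y<y′ y′≤a e e′ with m<n⇒∃[o]m+o≡n′ y<y′ | m≤n⇒∃[o]m+o≡n y′≤a
        where
        m<n⇒∃[o]m+o≡n′ : ∀ {m n} → m < n → ∃[ δ ] m + suc δ ≡ n
        m<n⇒∃[o]m+o≡n′ {m} lt with δ , eq ← m≤n⇒∃[o]m+o≡n lt = δ , trans (+-suc m δ) eq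
      ... | δ , refl | ε , eq = *-cancelˡ-≡ (f a s) (f a s′) (suc δ)
        (+-cancelʳ-≡ (ε * f y s) (suc δ * f a s) (suc δ * f a s′) (begin
          suc δ * f a s + ε * f y s     ≡⟨ slope y (suc δ) ε s (sym eq) ⟩
          (suc δ + ε) * f (y + suc δ) s ≡⟨ cong ((suc δ + ε) *_) e′ ⟩
          (suc δ + ε) * f (y + suc δ) s′ ≡⟨ slope y (suc δ) ε s′ (sym eq) ⟨
          suc δ * f a s′ + ε * f y s′   ≡⟨ cong (λ x → suc δ * f a s′ + ε * x) e ⟨
          suc δ * f a s′ + ε * f y s    ∎))
        where open ≡-Reasoning

      Y : Fin (suc (k * k)) → ℕ
      Y i = suc B + toℕ i

      Y≤M : ∀ i → Y i ≤ M
      Y≤M i = +-monoʳ-≤ (suc B) (Finₚ.toℕ≤pred[n] i)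

      -- An obstacle is an ordered pair of special vertices, coded as a number below `k * k`. The
      -- original degrees are `f a`, since `a ∸ a` is zero.
      Bad : Fin (suc (k * k)) → Fin (k * k) → Set
      Bad i j = f a (quotient k j) ≢ f a (remainder {k} k j) × f (Y i) (quotient k j) ≡ f (Y i) (remainder {k} k j)

      good : ∃[ i ] ∀ j → ¬ Bad i j
      good = avoid (k * k) (λ i j → ¬? (_ ≟ _) ×-dec (_ ≟ _))
        (λ i i′ j lt (ne , e) (_ , e′) →
          ne (collide (Y i) (Y i′) _ _ (+-monoʳ-< (suc B) lt) (≤-trans (Y≤M i′) (<⇒≤ M<a)) e e′))

    -- A special vertex that is affected at all has degree above `B` before, because `a` and `d`
    -- exceed `B`, and also afterwards, because `y` and `d + z` do. The choice of `y` by `good`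
    -- takes care of the pairs.
    transfer : ∃[ y ] ∃[ z ] (a ≡ y + z × y ≤ M ×
      (λ s → c s + (a * p s + d * q s)) ⇝ (λ s → c s + (y * p s + (d + z) * q s)))
    transfer with good
    ... | i , ¬bad = y , a ∸ y , sym (m+[n∸m]≡n y≤a) , Y≤M i , small , large , distinct
      where
      y = Y i
      y≤a = ≤-trans (Y≤M i) (<⇒≤ M<a)
      before = λ s → c s + (a * p s + d * q s)
      fa : ∀ s → f a s ≡ before s
      fa s = cong (λ z → c s + (a * p s + z * q s)) (trans (cong (d +_) (n∸n≡0 a)) (+-identityʳ d))
      B<a = <-trans (s≤s (m≤m+n B (k * k))) M<a
      B<d = <-trans (s≤s (m≤m+n B (k * k))) M<d
      exceeds : ∀ c x y {z w} → B < x → z ≡ suc w → B < c + (x * z + y)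
      exceeds c x y {w = w} lt refl = <-≤-trans lt (≤-trans (m≤m*n x (suc w)) (≤-trans (m≤m+n _ y) (m≤n+m _ c)))
      exceeds′ : ∀ c x y {z w} → B < x → z ≡ suc w → B < c + (y + x * z)
      exceeds′ c x y {z} lt eq = subst (λ u → B < c + u) (+-comm (x * z) y) (exceeds c x y lt eq)
      constant : ∀ s → p s ≡ 0 → q s ≡ 0 → f y s ≡ before s
      constant s p0 q0 rewrite p0 | q0 | *-zeroʳ a | *-zeroʳ y | *-zeroʳ d | *-zeroʳ (d + (a ∸ y)) = refl
      small : ∀ s → before s ≤ B → f y s ≡ before s
      small s le with p s in p0 | q s in q0
      ... | zero | zero = trans (cong₂ (λ u v → c s + (y * u + (d + (a ∸ y)) * v)) (sym p0) (sym q0))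
                            (trans (constant s p0 q0) (cong₂ (λ u v → c s + (a * u + d * v)) p0 q0))
      ... | suc _ | x = contradiction (exceeds (c s) a (d * x) B<a refl) (≤⇒≯ le)
      ... | zero | suc _ = contradiction (exceeds′ (c s) d (a * 0) B<d refl) (≤⇒≯ le)
      large : ∀ s → B < before s → B < f y s
      large s lt with p s in p0 | q s in q0
      ... | zero | zero = subst (B <_) (trans (cong₂ (λ u v → c s + (a * u + d * v)) (sym p0) (sym q0))
                            (trans (sym (constant s p0 q0)) (cong₂ (λ u v → c s + (y * u + (d + (a ∸ y)) * v)) p0 q0))) lt
      ... | suc _ | x = exceeds (c s) y ((d + (a ∸ y)) * x) (s≤s (m≤m+n B (toℕ i))) refl
      ... | zero | suc _ = exceeds′ (c s) (d + (a ∸ y)) (y * 0) (<-≤-trans B<d (m≤m+n d _)) refl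
      distinct : ∀ s s′ → before s ≢ before s′ → f y s ≢ f y s′
      distinct s s′ ne eq = ¬bad (combine s s′)
        ( (λ e → ne (trans (sym (fa s)) (trans (subst₂ (λ u v → f a u ≡ f a v) qu re e) (fa s′))))
        , subst₂ (λ u v → f y u ≡ f y v) (sym qu) (sym re) eq)
        where
        qu : quotient k (combine s s′) ≡ s
        qu = cong proj₁ (Finₚ.remQuot-combine s s′)
        re : remainder {k} k (combine s s′) ≡ s′
        re = cong proj₂ (Finₚ.remQuot-combine s s′)

  private
    sizes : ∀ b z a d → a ≡ b + z → b + (d + z) ≡ a + d
    sizes b z a d refl = trans (cong (b +_) (+-comm d z)) (sym (+-assoc b z d))
    value : ∀ b z a d x y → a ≡ b + z → val x ≤ val y → a * val x + d * val y ≤ b * val x + (d + z) * val y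
    value b z _ d x y refl le = begin
      (b + z) * val x + d * val y             ≡⟨ cong (_+ d * val y) (*-distribʳ-+ (val x) b z) ⟩
      b * val x + z * val x + d * val y       ≡⟨ +-assoc (b * val x) _ _ ⟩
      b * val x + (z * val x + d * val y)     ≤⟨ +-monoʳ-≤ (b * val x) (+-monoˡ-≤ (d * val y) (*-monoʳ-≤ z le)) ⟩
      b * val x + (z * val y + d * val y)     ≡⟨ cong (b * val x +_) (trans (+-comm (z * val y) _) (sym (*-distribʳ-+ (val y) d z))) ⟩
      b * val x + (d + z) * val y             ∎
      where open ≤-Reasoning

  -- Of two options that occur a and d times, one can be made infrequent.
  Merged : (P : Fin o → Set) (c : Fin k → ℕ) (x : Fin o) (a : ℕ) (y : Fin o) (d : ℕ) → Set
  Merged P c x a y d =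
    Σ[ x′ ∈ Fin o ] Σ[ a′ ∈ ℕ ] Σ[ y′ ∈ Fin o ] Σ[ d′ ∈ ℕ ]
      (a′ ≤ M × a′ + d′ ≡ a + d × (0 < a′ → P x′) × (0 < d′ → P y′) ×
      (λ s → c s + (a * v x s + d * v y s)) ⇝ (λ s → c s + (a′ * v x′ s + d′ * v y′ s)) ×
      a * val x + d * val y ≤ a′ * val x′ + d′ * val y′)

  merge-frequent : ∀ (P : Fin o → Set) c x a y d → P x → P y → M < a → M < d → val x ≤ val y → Merged P c x a y d
  merge-frequent P c x a y d Px Py a> d> le = build (transfer c (v x) (v y) a d a> d>)
    where
    build : ∃[ b ] ∃[ z ] (a ≡ b + z × b ≤ M ×
              (λ s → c s + (a * v x s + d * v y s)) ⇝ (λ s → c s + (b * v x s + (d + z) * v y s))) →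
            Merged P c x a y d
    build (b , z , eq , b≤M , rel) =
      x , b , y , d + z , b≤M , sizes b z a d eq , (λ _ → Px) , (λ _ → Py) , rel , value b z a d x y eq le

  merge-sym : ∀ (P : Fin o → Set) c x a y d → Merged P c y d x a → Merged P c x a y d
  merge-sym P c x a y d (x′ , a′ , y′ , d′ , le , eq , Px , Py , rel , vl) =
    x′ , a′ , y′ , d′ , le , trans eq (+-comm d a) , Px , Py ,
    ⇝-trans (≗⇒⇝ (λ s → cong (c s +_) (+-comm (a * v x s) (d * v y s)))) rel ,
    ≡-≤-trans (+-comm (a * val x) (d * val y)) vl

  merge : ∀ (P : Fin o → Set) c x a y d → (0 < a → P x) → (0 < d → P y) → Merged P c x a y d
  merge P c x a y d Px Py = by-cases (a ≤? M) (d ≤? M) (≤-total (val x) (val y))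
    where
    infrequent : ∀ x a y d → (0 < a → P x) → (0 < d → P y) → a ≤ M → Merged P c x a y d
    infrequent x a y d Px Py le = x , a , y , d , le , refl , Px , Py , ≗⇒⇝ (λ _ → refl) , ≤-refl
    by-cases : Dec (a ≤ M) → Dec (d ≤ M) → val x ≤ val y ⊎ val y ≤ val x → Merged P c x a y d
    by-cases (yes le) _        _         = infrequent x a y d Px Py le
    by-cases (no _)   (yes le) _         = merge-sym P c x a y d (infrequent y d x a Py Px le)
    by-cases (no a>)  (no d>)  (inj₁ le) =
      merge-frequent P c x a y d (Px (≤-<-trans z≤n (≰⇒> a>))) (Py (≤-<-trans z≤n (≰⇒> d>))) (≰⇒> a>) (≰⇒> d>) le
    by-cases (no a>)  (no d>)  (inj₂ le) = merge-sym P c x a y d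
      (merge-frequent P c y d x a (Py (≤-<-trans z≤n (≰⇒> d>))) (Px (≤-<-trans z≤n (≰⇒> a>))) (≰⇒> d>) (≰⇒> a>) le)

  -- A normal form for the multiset of options used within a type: a few exceptions, and one option
  -- for all the rest.
  record Block : Set where
    constructor block
    field
      exceptions : List (Fin o)
      default    : Fin o
      count      : ℕ
  open Block

  weight : (Fin o → ℕ) → Block → ℕ
  weight w b = Φ w (exceptions b) + count b * w (default b)

  -- The membership fields say that each option of the block is already in use in the list, so that
  -- some clique of the same type realises it. A block with `count` zero has an arbitrary default,
  -- hence the guard in `default-from`.
  record Rearranges (m : ℕ) (l : List (Fin o)) (b : Block) : Set where
    field
      few        : length (exceptions b) ≤ M * m
      total      : length (exceptions b) + count b ≡ length l
      exceptions-from : ∀ {x} → x ∈ˡ exceptions b → x ∈ˡ l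
      default-from    : 0 < count b → default b ∈ˡ l
  open Rearranges

  private
    occurrences : Fin o → List (Fin o) → ℕ
    occurrences x []      = 0
    occurrences x (y ∷ l) with x Finₚ.≟ y
    ... | yes _ = suc (occurrences x l)
    ... | no _  = occurrences x l

    others : Fin o → List (Fin o) → List (Fin o)
    others x []      = []
    others x (y ∷ l) with x Finₚ.≟ y
    ... | yes _ = others x l
    ... | no _  = y ∷ others x l

    occurrences⇒∈ : ∀ x l → 0 < occurrences x l → x ∈ˡ l
    occurrences⇒∈ x (y ∷ l) lt with x Finₚ.≟ y
    ... | yes p = here p
    ... | no _  = there (occurrences⇒∈ x l lt)

    others⊆ : ∀ x l {y} → y ∈ˡ others x l → y ∈ˡ l
    others⊆ x (z ∷ l) p with x Finₚ.≟ z
    ... | yes _ = there (others⊆ x l p)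
    others⊆ x (z ∷ l) (here p)  | no _ = here p
    others⊆ x (z ∷ l) (there p) | no _ = there (others⊆ x l p)

    Φ-occurrences : ∀ w x l → Φ w l ≡ occurrences x l * w x + Φ w (others x l)
    Φ-occurrences w x []      = refl
    Φ-occurrences w x (y ∷ l) with x Finₚ.≟ y
    ... | yes refl = trans (cong (w x +_) (Φ-occurrences w x l)) (sym (+-assoc (w x) _ _))
    ... | no _     = trans (cong (w y +_) (Φ-occurrences w x l))
      (trans (sym (+-assoc (w y) _ _)) (trans (cong (_+ Φ w (others x l)) (+-comm (w y) _)) (+-assoc (occurrences x l * w x) (w y) _)))

    others-∈ : ∀ x os l → All (_∈ˡ (x ∷ os)) l → All (_∈ˡ os) (others x l)
    others-∈ x os []      []       = []
    others-∈ x os (y ∷ l) (p ∷ ps) with x Finₚ.≟ y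
    ... | yes _ = others-∈ x os l ps
    others-∈ x os (y ∷ l) (here p ∷ ps)  | no ne = contradiction (sym p) ne
    others-∈ x os (y ∷ l) (there p ∷ ps) | no ne = p ∷ others-∈ x os l ps

    length-occurrences : ∀ x l → length l ≡ occurrences x l + length (others x l)
    length-occurrences x l = begin
      length l                                              ≡⟨ Φ-length l ⟨
      Φ (λ _ → 1) l                                         ≡⟨ Φ-occurrences (λ _ → 1) x l ⟩
      occurrences x l * 1 + Φ (λ _ → 1) (others x l)        ≡⟨ cong₂ _+_ (*-identityʳ _) (Φ-length (others x l)) ⟩
      occurrences x l + length (others x l)                 ∎
      where open ≡-Reasoning

  -- Induction on the list of options that may occur. The occurrences of `x` are set aside, the rest
  -- is brought into block form, and `x` is merged with the default found there; whichever becomes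
  -- infrequent joins the exceptions. Each option thus adds at most `M` exceptions. Whatever a step
  -- does not touch belongs to the constant part of the degrees.
  rearrange : ∀ (x₀ : Fin o) os l (c : Fin k → ℕ) → All (_∈ˡ os) l →
    ∃[ b ] (Rearranges (length os) l b ×
            (λ s → c s + Φ (λ x → v x s) l) ⇝ (λ s → c s + weight (λ x → v x s) b) ×
            Φ val l ≤ weight val b)
  rearrange x₀ [] [] c [] =
    block [] x₀ 0 , record { few = z≤n ; total = refl ; exceptions-from = λ () ; default-from = λ () } , ≗⇒⇝ (λ _ → refl) , z≤n
  rearrange x₀ (x ∷ os) l c ⊆os
    with a ← occurrences x l
       | Φa ← (λ w → Φ-occurrences w x l)
       | la ← length-occurrences x l
       | Px ← occurrences⇒∈ x l
    with block p y d , R , rel , vl ← rearrange x₀ os (others x l) (λ s → c s + a * v x s) (others-∈ x os l ⊆os)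
    with x′ , a′ , y′ , d′ , a′≤M , sz , Px′ , Py′ , rel′ , vl′ ←
         merge (_∈ˡ l) (λ s → c s + Φ (λ x → v x s) p) x a y d Px (others⊆ x l ∘ default-from R) =
    block (replicate a′ x′ ++ p) y′ d′ ,
    record
      { few = begin
          length (replicate a′ x′ ++ p)        ≡⟨ length-prefix ⟩
          a′ + length p                        ≤⟨ +-mono-≤ a′≤M (few R) ⟩
          M + M * length os                    ≡⟨ *-suc M (length os) ⟨
          M * suc (length os)                  ∎
      ; total = begin-equality
          length (replicate a′ x′ ++ p) + d′   ≡⟨ cong (_+ d′) length-prefix ⟩
          a′ + length p + d′                   ≡⟨ swap-last a′ (length p) d′ ⟩
          a′ + d′ + length p                   ≡⟨ cong (_+ length p) sz ⟩
          a + d + length p                     ≡⟨ swap-last a d (length p) ⟩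
          a + length p + d                     ≡⟨ +-assoc a _ d ⟩
          a + (length p + d)                   ≡⟨ cong (a +_) (total R) ⟩
          a + length (others x l)              ≡⟨ la ⟨
          length l                             ∎
      ; exceptions-from = λ q → [ (λ r → let e , pos = ∈-replicate r in subst (_∈ˡ l) (sym e) (Px′ pos))
                                , others⊆ x l ∘ exceptions-from R ]′ (∈-++⁻ (replicate a′ x′) q)
      ; default-from = Py′
      } ,
    ⇝-trans (≗⇒⇝ (λ s → trans (cong (c s +_) (Φa (λ x → v x s))) (sym (+-assoc (c s) _ _))))
      (⇝-trans rel
        (⇝-trans (≗⇒⇝ (λ s → shuffle (c s) (a * v x s) (Φ (λ x → v x s) p) (d * v y s)))
          (⇝-trans rel′
            (≗⇒⇝ (λ s → trans (shuffle′ (c s) (Φ (λ x → v x s) p) (a′ * v x′ s) (d′ * v y′ s))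
              (cong (λ u → c s + (u + d′ * v y′ s)) (sym (Φ-prefix (λ x → v x s))))))))) ,
    (begin
      Φ val l                                        ≡⟨ Φa val ⟩
      a * val x + Φ val (others x l)                 ≤⟨ +-monoʳ-≤ (a * val x) vl ⟩
      a * val x + (Φ val p + d * val y)              ≡⟨ shuffle 0 (a * val x) (Φ val p) (d * val y) ⟩
      Φ val p + (a * val x + d * val y)              ≤⟨ +-monoʳ-≤ (Φ val p) vl′ ⟩
      Φ val p + (a′ * val x′ + d′ * val y′)          ≡⟨ shuffle′ 0 (Φ val p) (a′ * val x′) (d′ * val y′) ⟩
      a′ * val x′ + Φ val p + d′ * val y′            ≡⟨ cong (_+ d′ * val y′) (Φ-prefix val) ⟨
      Φ val (replicate a′ x′ ++ p) + d′ * val y′     ∎)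
    where
    open ≤-Reasoning
    open +-*-Solver
    length-prefix : length (replicate a′ x′ ++ p) ≡ a′ + length p
    length-prefix = trans (length-++ (replicate a′ x′)) (cong (_+ length p) (length-replicate a′))
    Φ-prefix : ∀ w → Φ w (replicate a′ x′ ++ p) ≡ a′ * w x′ + Φ w p
    Φ-prefix w = trans (Φ-++ w (replicate a′ x′) p) (cong (_+ Φ w p) (Φ-replicate w a′ x′))
    swap-last : ∀ a b c → a + b + c ≡ a + c + b
    swap-last a b c = solve 3 (λ a b c → a :+ b :+ c := a :+ c :+ b) refl a b c
    shuffle : ∀ c a p d → c + a + (p + d) ≡ c + p + (a + d)
    shuffle c a p d = solve 4 (λ c a p d → c :+ a :+ (p :+ d) := c :+ p :+ (a :+ d)) refl c a p d
    shuffle′ : ∀ c p a d → c + p + (a + d) ≡ c + (a + p + d)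
    shuffle′ c p a d = solve 4 (λ c p a d → c :+ p :+ (a :+ d) := c :+ (a :+ p :+ d)) refl c p a d

  -- Types are treated one at a time. Those still untouched and those already in block form count as
  -- constant in turn, and transitivity of `_⇝_` composes the changes.
  rearrange-all : ∀ {t} (x₀ : Fin o) (L : Fin t → List (Fin o)) (c : Fin k → ℕ) →
    Σ[ b ∈ (Fin t → Block) ] ((∀ i → Rearranges o (L i) (b i)) ×
            (λ s → c s + sum (λ i → Φ (λ x → v x s) (L i))) ⇝ (λ s → c s + sum (λ i → weight (λ x → v x s) (b i))) ×
            sum (λ i → Φ val (L i)) ≤ sum (λ i → weight val (b i)))
  rearrange-all {zero} x₀ L c = (λ ()) , (λ ()) , ≗⇒⇝ (λ _ → refl) , z≤n
  rearrange-all {suc t} x₀ L c =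
    let b₀ , R , rel , vl = rearrange x₀ (allFin o) (L zero) (λ s → c s + sum (λ i → Φ (λ x → v x s) (L (suc i)))) (all-∈ (L zero))
        b , Rs , rels , vls = rearrange-all x₀ (L ∘ suc) (λ s → c s + weight (λ x → v x s) b₀)
    in
    (λ { zero → b₀ ; (suc i) → b i }) ,
    (λ { zero → subst (λ m → Rearranges m (L zero) b₀) (length-tabulate id) R ; (suc i) → Rs i }) ,
    ⇝-trans (≗⇒⇝ (λ s → rot (c s) (Φ (λ x → v x s) (L zero)) _))
      (⇝-trans rel (⇝-trans (≗⇒⇝ (λ s → swap (c s) _ (weight (λ x → v x s) b₀)))
        (⇝-trans rels (≗⇒⇝ (λ s → +-assoc (c s) _ _))))) ,
    +-mono-≤ vl vls
    where
    all-∈ : ∀ l → All (_∈ˡ allFin o) l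
    all-∈ []      = []
    all-∈ (x ∷ l) = ∈-allFin x ∷ all-∈ l
    swap : ∀ a b c → a + b + c ≡ a + c + b
    swap a b c = trans (+-assoc a b c) (trans (cong (a +_) (+-comm b c)) (sym (+-assoc a c b)))
    rot : ∀ a b c → a + (b + c) ≡ a + c + b
    rot a b c = trans (sym (+-assoc a b c)) (swap a b c)

  optionAt : List (Fin o) → Fin o → ℕ → Fin o
  optionAt []      x j       = x
  optionAt (y ∷ p) x zero    = y
  optionAt (y ∷ p) x (suc j) = optionAt p x j

  -- From `length p` on, all positions read the default, so a cut-off beyond the exceptions loses
  -- nothing. This bounds the number of positions that have to be told apart.
  optionAt-⊓ : ∀ p x j g → length p ≤ g → optionAt p x (j ⊓ g) ≡ optionAt p x j
  optionAt-⊓ []      x j       g       le       = refl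
  optionAt-⊓ (y ∷ p) x zero    (suc g) le       = refl
  optionAt-⊓ (y ∷ p) x (suc j) (suc g) (s≤s le) = optionAt-⊓ p x j g le

  optionAt-∈ : ∀ p x d {l} → (∀ {y} → y ∈ˡ p → y ∈ˡ l) → (0 < d → x ∈ˡ l) → ∀ j → j < length p + d → optionAt p x j ∈ˡ l
  optionAt-∈ []      x d ⊆l x∈l j       lt       = x∈l (≤-<-trans z≤n lt)
  optionAt-∈ (y ∷ p) x d ⊆l x∈l zero    lt       = ⊆l (here refl)
  optionAt-∈ (y ∷ p) x d ⊆l x∈l (suc j) (s≤s lt) = optionAt-∈ p x d (⊆l ∘ there) x∈l j lt

  sum-optionAt : ∀ w p x d → sum {length p + d} (λ j → w (optionAt p x (toℕ j))) ≡ Φ w p + d * w x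
  sum-optionAt w []      x d = sum-const d (w x)
  sum-optionAt w (y ∷ p) x d = trans (cong (w y +_) (sum-optionAt w p x d)) (sym (+-assoc (w y) _ _))

  module _ {n t : ℕ} {R : Pred (Fin n) 0ℓ} (R? : Decidable R) (type : Fin n → Fin t) where

    InType : Fin t → Pred (Fin n) 0ℓ
    InType i r = R r × i ≡ type r

    InType? : ∀ i → Decidable (InType i)
    InType? i r = R? r ×-dec (i Finₚ.≟ type r)

  module _ {n t : ℕ} {R : Pred (Fin n) 0ℓ} (R? : Decidable R) (type : Fin n → Fin t) (σ : Fin n → Fin o) where

    private
      L : Fin t → List (Fin o)
      L i = map σ (filter (InType? R? type i) (allFin n))

      Φ-map-filter : ∀ (w : Fin o → ℕ) {m} {P : Pred (Fin n) 0ℓ} (P? : Decidable P) (e : Fin m → Fin n) →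
                     Φ w (map σ (filter P? (List.tabulate e))) ≡ sum (λ j → 𝟙 (P? (e j)) * w (σ (e j)))
      Φ-map-filter w {zero}  P? e = refl
      Φ-map-filter w {suc m} P? e with P? (e zero)
      ... | yes _ = cong₂ _+_ (sym (+-identityʳ _)) (Φ-map-filter w P? (e ∘ suc))
      ... | no _  = Φ-map-filter w P? (e ∘ suc)

      Φ-L : ∀ w i → Φ w (L i) ≡ sum (λ r → 𝟙 (InType? R? type i r) * w (σ r))
      Φ-L w i = Φ-map-filter w (InType? R? type i) id

      length-L : ∀ i → length (L i) ≡ sum (λ r → 𝟙 (InType? R? type i r))
      length-L i = trans (sym (Φ-length (L i))) (trans (Φ-L (λ _ → 1) i) (sum-cong-≗ (λ r → *-identityʳ (𝟙 (InType? R? type i r)))))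

      by-type : ∀ (f : Fin t → Fin n → ℕ) → sum (λ i → sum (λ r → 𝟙 (InType? R? type i r) * f i r)) ≡ sum (λ r → 𝟙 (R? r) * f (type r) r)
      by-type f = trans (∑-comm (λ i r → 𝟙 (InType? R? type i r) * f i r)) (sum-cong-≗ (λ r → begin
        sum (λ i → 𝟙 (InType? R? type i r) * f i r)
          ≡⟨ sum-cong-≗ (λ i → trans (cong (_* f i r) (trans (𝟙-× (R? r) (i Finₚ.≟ type r)) (*-comm (𝟙 (R? r)) _)))
               (trans (*-assoc (𝟙 (i Finₚ.≟ type r)) (𝟙 (R? r)) (f i r))
                 (cong (_* (𝟙 (R? r) * f i r)) (𝟙-cong (i Finₚ.≟ type r) (type r Finₚ.≟ i) sym sym)))) ⟩
        sum (λ i → 𝟙 (type r Finₚ.≟ i) * (𝟙 (R? r) * f i r))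
          ≡⟨ sum-pick (type r) (λ i → 𝟙 (R? r) * f i r) ⟩
        𝟙 (R? r) * f (type r) r ∎))
        where open ≡-Reasoning

    -- Degrees and values depend only on how often each option is used within each type, so a block
    -- can be dealt out to the cliques of its type in order of `rank`. The last component names a
    -- clique of the same type that used the new option before; it is what makes the option
    -- realisable.
    exchange : (x₀ : Fin o) (c : Fin k → ℕ) →
      Σ[ table ∈ (Fin t → ℕ → Fin o) ] ((∀ i j → table i (j ⊓ (M * o)) ≡ table i j) ×
        let σ′ = λ r → table (type r) (rank (InType? R? type (type r)) r) in
        (λ s → c s + sum (λ r → 𝟙 (R? r) * v (σ r) s)) ⇝ (λ s → c s + sum (λ r → 𝟙 (R? r) * v (σ′ r) s)) ×
        sum (λ r → 𝟙 (R? r) * val (σ r)) ≤ sum (λ r → 𝟙 (R? r) * val (σ′ r)) ×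
        (∀ r → R r → ∃[ r′ ] (R r′ × type r′ ≡ type r × σ r′ ≡ σ′ r)))
    exchange x₀ c with rearrange-all x₀ L c
    ... | b , Rs , rel , vl =
      (λ i j → optionAt (exceptions (b i)) (default (b i)) j) ,
      (λ i j → optionAt-⊓ (exceptions (b i)) (default (b i)) j (M * o) (few (Rs i))) ,
      ⇝-trans (≗⇒⇝ (λ s → cong (c s +_) (sym (old (λ x → v x s)))))
        (⇝-trans rel (≗⇒⇝ (λ s → cong (c s +_) (new (λ x → v x s))))) ,
      subst₂ _≤_ (old val) (new val) vl ,
      λ r Rr → origin r Rr
        (optionAt-∈ (exceptions (b (type r))) (default (b (type r))) (count (b (type r)))
          (exceptions-from (Rs (type r))) (default-from (Rs (type r))) (rank (InType? R? type (type r)) r)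
          (subst (rank (InType? R? type (type r)) r <_) (trans (sym (length-L (type r))) (sym (total (Rs (type r)))))
            (rank<count (InType? R? type (type r)) r (Rr , refl))))
      where
      new-option : Fin t → Fin n → Fin o
      new-option i r = optionAt (exceptions (b i)) (default (b i)) (rank (InType? R? type i) r)
      old : ∀ w → sum (λ i → Φ w (L i)) ≡ sum (λ r → 𝟙 (R? r) * w (σ r))
      old w = trans (sum-cong-≗ (Φ-L w)) (by-type (λ _ r → w (σ r)))
      sum-upto : ∀ {m m′} (h : ℕ → ℕ) → m ≡ m′ → sum {m} (h ∘ toℕ) ≡ sum {m′} (h ∘ toℕ)
      sum-upto h refl = refl
      new : ∀ w → sum (λ i → weight w (b i)) ≡ sum (λ r → 𝟙 (R? r) * w (new-option (type r) r))
      new w = trans (sum-cong-≗ (λ i → begin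
        weight w (b i)
          ≡⟨ sum-optionAt w (exceptions (b i)) (default (b i)) (count (b i)) ⟨
        sum {length (exceptions (b i)) + count (b i)} (h i ∘ toℕ)
          ≡⟨ sum-upto (h i) (trans (total (Rs i)) (length-L i)) ⟩
        sum {sum (λ r → 𝟙 (InType? R? type i r))} (h i ∘ toℕ)
          ≡⟨ sum-rank (InType? R? type i) (h i) ⟨
        sum (λ r → 𝟙 (InType? R? type i r) * w (new-option i r)) ∎))
        (by-type (λ i r → w (new-option i r)))
        where
        open ≡-Reasoning
        h : Fin t → ℕ → ℕ
        h i j = w (optionAt (exceptions (b i)) (default (b i)) j)
      origin : ∀ r → R r → ∀ {x} → x ∈ˡ L (type r) → ∃[ r′ ] (R r′ × type r′ ≡ type r × σ r′ ≡ x)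
      origin r Rr x∈ =
        let r′ , r′∈ , eq = ∈-map⁻ σ x∈
            _ , Rr′ , teq = ∈-filter⁻ (InType? R? type (type r)) {xs = allFin n} r′∈
        in r′ , Rr′ , sym teq , sym eq

-- Cliques, classes and types

T-does⁺ : (d : Dec P) → P → T (does d)
T-does⁺ (yes _) p = _
T-does⁺ (no ¬p) p = contradiction p ¬p

T-does⁻ : (d : Dec P) → T (does d) → P
T-does⁻ (yes p) _ = p

T⇒≡ : ∀ {b} → T b → b ≡ true
T⇒≡ {true} _ = refl

comprehension : {P : Pred (Fin n) 0ℓ} → Decidable P → Subset n
comprehension P? = Vec.tabulate (does ∘ P?)

module _ {P : Pred (Fin n) 0ℓ} (P? : Decidable P) where

  ∈-comprehension⁺ : ∀ {i} → P i → i ∈ comprehension P?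
  ∈-comprehension⁺ {i} p = lookup⇒[]= i _ (trans (lookup∘tabulate (does ∘ P?) i) (T⇒≡ (T-does⁺ (P? i) p)))

  ∈-comprehension⁻ : ∀ {i} → i ∈ comprehension P? → P i
  ∈-comprehension⁻ {i} q = T-does⁻ (P? i) (subst T (sym (trans (sym (lookup∘tabulate (does ∘ P?) i)) ([]=⇒lookup q))) _)

least : {P : Pred (Fin n) 0ℓ} → Decidable P → ∃[ i ] P i → ∃[ i ] (P i × ∀ j → P j → ¬ j Fin.< i)
least {suc n} P? (i , p) with P? zero
... | yes p₀ = zero , p₀ , λ _ _ ()
least {suc n} P? (zero , p)  | no ¬p₀ = contradiction p ¬p₀
least {suc n} P? (suc i , p) | no ¬p₀ with j , q , min ← least (P? ∘ suc) (i , p) =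
  suc j , q , λ { zero p₀ _ → ¬p₀ p₀ ; (suc l) r (s≤s lt) → min l r lt }

bit : Bool → Fin 2
bit false = 0F
bit true  = 1F

unbit : Fin 2 → Bool
unbit 0F = false
unbit 1F = true

-- Sets become numbers below `2 ^ m`, so that classes, options and types are elements of finite
-- types whose sizes enter the kernel bound.
code : ∀ {m} → (Fin m → Bool) → Fin (2 ^ m)
code f = funToFin (bit ∘ f)

decode : ∀ {m} → Fin (2 ^ m) → Fin m → Bool
decode c = unbit ∘ finToFun c

decode-code : ∀ {m} (f : Fin m → Bool) i → decode (code f) i ≡ f i
decode-code f i = trans (cong unbit (Finₚ.finToFun-funToFin (bit ∘ f) i)) (unbit-bit (f i))
  where
  unbit-bit : ∀ b → unbit (bit b) ≡ b
  unbit-bit false = refl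
  unbit-bit true  = refl

code-cong : ∀ {m} {f g : Fin m → Bool} → f ≗ g → code f ≡ code g
code-cong {zero}  eq = refl
code-cong {suc m} eq = cong₂ combine (cong bit (eq zero)) (code-cong (eq ∘ suc))

degree-sum : (G : Graph n) (U : Subset n) (i : Fin n) →
             degree G U i ≡ sum (λ v → 𝟙 (T? (adjacent G i v) ×-dec (v ∈? U)))
degree-sum G U i = trans (card (neighbours G i ∩ U)) (sum-cong-≗ (λ v →
  𝟙-cong (v ∈? (neighbours G i ∩ U)) (T? (adjacent G i v) ×-dec (v ∈? U))
    (λ p → let q , u = x∈p∩q⁻ _ U p in subst T (sym (trans (sym (lookup∘tabulate (adjacent G i) v)) ([]=⇒lookup q))) _ , u)
    (λ (e , u) → x∈p∩q⁺ (lookup⇒[]= v _ (trans (lookup∘tabulate (adjacent G i) v) (T⇒≡ e)) , u))))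

-- S is a cluster deletion set, listed by sv.
module Cluster {n : ℕ} (G : Graph n) (S : Subset n) {k : ℕ} (sv : Fin k → Fin n)
  (sv-onto : ∀ {s} → s ∈ S → ∃[ i ] sv i ≡ s)
  (cluster : ∀ {a b c} → a ∉ S → b ∉ S → c ∉ S → Edge G a b → Edge G b c → a ≢ c → Edge G a c) where

  q o B g : ℕ
  q = 2 ^ k
  o = 2 ^ q
  B = k + q
  g = (suc B + k * k) * o

  Edge-sym : ∀ {u v} → Edge G u v → Edge G v u
  Edge-sym {u} {v} = subst T (symmetric G u v)

  infix 4 _≈_ _≈?_
  -- Closed adjacency. Outside `S` it is an equivalence relation whose classes are the cliques, so
  -- components need not be computed.
  _≈_ : Fin n → Fin n → Set
  u ≈ v = u ≡ v ⊎ Edge G u v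

  _≈?_ : ∀ u v → Dec (u ≈ v)
  u ≈? v = (u Finₚ.≟ v) ⊎-dec T? (adjacent G u v)

  ≈-sym : ∀ {u v} → u ≈ v → v ≈ u
  ≈-sym (inj₁ refl) = inj₁ refl
  ≈-sym (inj₂ e)    = inj₂ (Edge-sym e)

  ≈-trans : ∀ {u v w} → u ∉ S → v ∉ S → w ∉ S → u ≈ v → v ≈ w → u ≈ w
  ≈-trans u∉ v∉ w∉ (inj₁ refl) e           = e
  ≈-trans u∉ v∉ w∉ (inj₂ d)    (inj₁ refl) = inj₂ d
  ≈-trans {u} {v} {w} u∉ v∉ w∉ (inj₂ d) (inj₂ e) with u Finₚ.≟ w
  ... | yes p = inj₁ p
  ... | no ne = inj₂ (cluster u∉ v∉ w∉ d e ne)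

  mask : Fin n → Fin q
  mask v = code (λ i → adjacent G (sv i) v)

  adjBit : Fin k → Fin q → Bool
  adjBit i A = decode A i

  adjBit-mask : ∀ i v → adjBit i (mask v) ≡ adjacent G (sv i) v
  adjBit-mask i v = decode-code (λ i → adjacent G (sv i) v) i

  mask-Edge : ∀ {s u v} → s ∈ S → mask u ≡ mask v → Edge G s u → Edge G s v
  mask-Edge {s} {u} {v} s∈ eq with i , refl ← sv-onto s∈ =
    subst T (trans (sym (adjBit-mask i u)) (trans (cong (adjBit i) eq) (adjBit-mask i v)))

  -- Meaningful only for v ∉ S, when w ranges over the clique of v.
  Trace : Subset n → Fin n → Fin q → Fin n → Set
  Trace U v A w = (w ∈ U × w ∉ S) × w ≈ v × mask w ≡ A

  Trace? : ∀ U v A w → Dec (Trace U v A w)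
  Trace? U v A w = ((w ∈? U) ×-dec ¬? (w ∈? S)) ×-dec (w ≈? v) ×-dec (mask w Finₚ.≟ A)

  trace? : ∀ U v A → Dec (∃[ w ] Trace U v A w)
  trace? U v A = Finₚ.any? (Trace? U v A)

  -- For a set of survivors this is the option used in the clique of `v`; for `⊤` it is the type of
  -- that clique.
  trace : Subset n → Fin n → Fin o
  trace U v = code (λ A → does (trace? U v A))

  infix 4 _∈ₒ_
  _∈ₒ_ : Fin q → Fin o → Set
  A ∈ₒ x = T (decode {q} x A)

  ∈-trace⁻ : ∀ {U v A} → A ∈ₒ trace U v → ∃[ w ] Trace U v A w
  ∈-trace⁻ {U} {v} {A} p = T-does⁻ (trace? U v A) (subst T (decode-code (λ A → does (trace? U v A)) A) p)

  ∈-trace⁺ : ∀ {U v A} → ∃[ w ] Trace U v A w → A ∈ₒ trace U v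
  ∈-trace⁺ {U} {v} {A} p = subst T (sym (decode-code (λ A → does (trace? U v A)) A)) (T-does⁺ (trace? U v A) p)

  trace-cong : ∀ {U U′ v v′} → (∀ A → ∃[ w ] Trace U v A w → ∃[ w ] Trace U′ v′ A w) →
               (∀ A → ∃[ w ] Trace U′ v′ A w → ∃[ w ] Trace U v A w) → trace U v ≡ trace U′ v′
  trace-cong f g = code-cong (λ A → does-⇔ (mk⇔ (f A) (g A)) (trace? _ _ A) (trace? _ _ A))

  trace-≈ : ∀ {U u v} → u ∉ S → v ∉ S → u ≈ v → trace U u ≡ trace U v
  trace-≈ u∉ v∉ u≈v = trace-cong
    (λ A (w , (w∈ , w∉) , w≈u , m) → w , (w∈ , w∉) , ≈-trans w∉ u∉ v∉ w≈u u≈v , m)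
    (λ A (w , (w∈ , w∉) , w≈v , m) → w , (w∈ , w∉) , ≈-trans w∉ v∉ u∉ w≈v (≈-sym u≈v) , m)

  type : Fin n → Fin o
  type = trace ⊤

  -- The least vertex of a clique stands for it, so that sums over cliques become sums over
  -- vertices.
  Rep : Fin n → Set
  Rep r = r ∉ S × ¬ (∃[ u ] (u ∉ S × u ≈ r × u Fin.< r))

  Rep? : Decidable Rep
  Rep? r = ¬? (r ∈? S) ×-dec ¬? (Finₚ.any? (λ u → ¬? (u ∈? S) ×-dec (u ≈? r) ×-dec (u Fin.<? r)))

  rep : ∀ {v} → v ∉ S → ∃[ r ] (Rep r × v ≈ r)
  rep {v} v∉ with r , (r∉ , r≈v) , min ← least (λ u → ¬? (u ∈? S) ×-dec (u ≈? v)) (v , v∉ , inj₁ refl) =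
    r , (r∉ , λ (u , u∉ , u≈r , lt) → min u (u∉ , ≈-trans u∉ r∉ v∉ u≈r r≈v) lt) , ≈-sym r≈v

  rep-unique : ∀ {r r′} → Rep r → Rep r′ → r ≈ r′ → r ≡ r′
  rep-unique {r} {r′} (r∉ , min) (r′∉ , min′) e with Finₚ.<-cmp r r′
  ... | tri< lt _ _ = contradiction (r , r∉ , e , lt) min′
  ... | tri≈ _ eq _ = eq
  ... | tri> _ _ gt = contradiction (r′ , r′∉ , ≈-sym e , gt) min

  -- To precede the whole clique of `v` is the same as to precede its representative. In this form
  -- the number of such `r` is visibly the same for all vertices of the clique.
  Earlier : Fin n → Fin n → Set
  Earlier v r = Rep r × type v ≡ type r × ¬ (∃[ w ] (w ∉ S × w ≈ v × ¬ r Fin.< w))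

  Earlier? : ∀ v → Decidable (Earlier v)
  Earlier? v r = Rep? r ×-dec (type v Finₚ.≟ type r) ×-dec
    ¬? (Finₚ.any? (λ w → ¬? (w ∈? S) ×-dec (w ≈? v) ×-dec ¬? (r Fin.<? w)))

  index : Fin n → ℕ
  index v = sum (λ r → 𝟙 (Earlier? v r))

  index-≈ : ∀ {u v} → u ∉ S → v ∉ S → u ≈ v → index u ≡ index v
  index-≈ u∉ v∉ u≈v = sum-cong-≗ (λ r → 𝟙-cong (Earlier? _ r) (Earlier? _ r)
    (λ (R , t , f) → R , trans (sym (trace-≈ u∉ v∉ u≈v)) t ,
      λ (w , w∉ , w≈v , ge) → f (w , w∉ , ≈-trans w∉ v∉ u∉ w≈v (≈-sym u≈v) , ge))
    (λ (R , t , f) → R , trans (trace-≈ u∉ v∉ u≈v) t ,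
      λ (w , w∉ , w≈u , ge) → f (w , w∉ , ≈-trans w∉ u∉ v∉ w≈u u≈v , ge)))

  -- Which vertex of a class survives in a clique is immaterial, as they are closed twins; the
  -- rebuilt solution always keeps the least.
  First : Fin n → Set
  First v = v ∉ S × ¬ (∃[ u ] (u ∉ S × u ≈ v × mask u ≡ mask v × u Fin.< v))

  First? : Decidable First
  First? v = ¬? (v ∈? S) ×-dec ¬? (Finₚ.any? (λ u → ¬? (u ∈? S) ×-dec (u ≈? v) ×-dec (mask u Finₚ.≟ mask v) ×-dec (u Fin.<? v)))

  val : Fin o → ℕ
  val x = sum (λ A → 𝟙 (T? (decode {q} x A)))

  contribution : Fin o → Fin k → ℕ
  contribution x i = sum (λ A → 𝟙 (T? (decode {q} x A)) * 𝟙 (T? (adjBit i A)))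

  open Exchange val contribution B public using (_⇝_; ≗⇒⇝; ⇝-trans; exchange; InType?)

  -- The consequence of local irregularity on which counting rests: with it, sizes and degrees
  -- become functions of the traces.
  Good : Subset n → Set
  Good U = ∀ {u v} → u ∈ U → v ∈ U → u ∉ S → v ∉ S → u ≈ v → mask u ≡ mask v → u ≡ v

  In? : ∀ U v → Dec (v ∈ U × v ∉ S)
  In? U v = (v ∈? U) ×-dec ¬? (v ∈? S)

  module _ {U : Subset n} (good : Good U) where

    -- After grouping by class, each class of the trace contributes exactly one survivor, because
    -- `U` is good. The weight `w` is 1 for sizes and an adjacency bit for the degrees of special
    -- vertices.
    sum-clique : ∀ {x} → x ∉ S → (w : Fin q → ℕ) →
      sum (λ v → 𝟙 (In? U v ×-dec (v ≈? x)) * w (mask v)) ≡ sum (λ A → 𝟙 (T? (decode {q} (trace U x) A)) * w A)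
    sum-clique {x} x∉ w = begin
      sum (λ v → 𝟙 (near v) * w (mask v))
        ≡⟨ sum-fibres mask _ ⟨
      sum (λ A → sum (λ v → 𝟙 (mask v Finₚ.≟ A) * (𝟙 (near v) * w (mask v))))
        ≡⟨ sum-cong-≗ fibre ⟩
      sum (λ A → 𝟙 (T? (decode {q} (trace U x) A)) * w A) ∎
      where
      open ≡-Reasoning
      near : ∀ v → Dec ((v ∈ U × v ∉ S) × v ≈ x)
      near v = In? U v ×-dec (v ≈? x)
      term : ∀ A v → 𝟙 (mask v Finₚ.≟ A) * (𝟙 (near v) * w (mask v)) ≡ 𝟙 (Trace? U x A v) * w A
      term A v with mask v Finₚ.≟ A
      ... | yes refl = trans (+-identityʳ _) (cong (_* w (mask v)) (𝟙-cong (near v) (In? U v ×-dec (v ≈? x) ×-dec yes (refl {x = mask v}))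
                         (λ (a , b) → a , b , refl) (λ (a , b , _) → a , b)))
      ... | no ne    = sym (cong (_* w A) (𝟙-no (In? U v ×-dec (v ≈? x) ×-dec no ne) (λ (_ , _ , eq) → ne eq)))
      fibre : ∀ A → sum (λ v → 𝟙 (mask v Finₚ.≟ A) * (𝟙 (near v) * w (mask v))) ≡ 𝟙 (T? (decode {q} (trace U x) A)) * w A
      fibre A = begin
        sum (λ v → 𝟙 (mask v Finₚ.≟ A) * (𝟙 (near v) * w (mask v)))
          ≡⟨ sum-cong-≗ (term A) ⟩
        sum (λ v → 𝟙 (Trace? U x A v) * w A)
          ≡⟨ *-distribʳ-sum (w A) (λ v → 𝟙 (Trace? U x A v)) ⟨
        sum (λ v → 𝟙 (Trace? U x A v)) * w A
          ≡⟨ cong (_* w A) (sum-unique (Trace? U x A) (trace? U x A)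
               (λ u v ((u∈ , u∉) , u≈ , mu) ((v∈ , v∉) , v≈ , mv) →
                 good u∈ v∈ u∉ v∉ (≈-trans u∉ x∉ v∉ u≈ (≈-sym v≈)) (trans mu (sym mv)))) ⟩
        𝟙 (trace? U x A) * w A
          ≡⟨ cong (_* w A) (𝟙-cong (trace? U x A) (T? (decode {q} (trace U x) A)) ∈-trace⁺ ∈-trace⁻) ⟩
        𝟙 (T? (decode {q} (trace U x) A)) * w A ∎

    -- Each vertex outside `S` is near exactly one representative. Inserting the sum over
    -- representatives and exchanging the order of summation regroups the vertices by cliques.
    sum-cliques : (w : Fin q → ℕ) →
      sum (λ v → 𝟙 (In? U v) * w (mask v)) ≡ sum (λ r → 𝟙 (Rep? r) * sum (λ A → 𝟙 (T? (decode {q} (trace U r) A)) * w A))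
    sum-cliques w = begin
      sum (λ v → 𝟙 (In? U v) * w (mask v))
        ≡⟨ sum-cong-≗ spread ⟩
      sum (λ v → sum (λ r → 𝟙 (Rep? r) * (𝟙 (In? U v ×-dec (v ≈? r)) * w (mask v))))
        ≡⟨ ∑-comm (λ v r → 𝟙 (Rep? r) * (𝟙 (In? U v ×-dec (v ≈? r)) * w (mask v))) ⟩
      sum (λ r → sum (λ v → 𝟙 (Rep? r) * (𝟙 (In? U v ×-dec (v ≈? r)) * w (mask v))))
        ≡⟨ sum-cong-≗ (λ r → sym (*-distribˡ-sum (𝟙 (Rep? r)) (λ v → 𝟙 (In? U v ×-dec (v ≈? r)) * w (mask v)))) ⟩
      sum (λ r → 𝟙 (Rep? r) * sum (λ v → 𝟙 (In? U v ×-dec (v ≈? r)) * w (mask v)))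
        ≡⟨ sum-cong-≗ at-rep ⟩
      sum (λ r → 𝟙 (Rep? r) * sum (λ A → 𝟙 (T? (decode {q} (trace U r) A)) * w A)) ∎
      where
      open ≡-Reasoning
      at-rep : ∀ r → 𝟙 (Rep? r) * sum (λ v → 𝟙 (In? U v ×-dec (v ≈? r)) * w (mask v))
                   ≡ 𝟙 (Rep? r) * sum (λ A → 𝟙 (T? (decode {q} (trace U r) A)) * w A)
      at-rep r = 𝟙-guard (Rep? r) (λ R → sum-clique (proj₁ R) w)
      spread : ∀ v → 𝟙 (In? U v) * w (mask v) ≡ sum (λ r → 𝟙 (Rep? r) * (𝟙 (In? U v ×-dec (v ≈? r)) * w (mask v)))
      spread v = begin
        𝟙 (In? U v) * w (mask v)
          ≡⟨ cong (_* w (mask v)) (𝟙-cong (In? U v) (Finₚ.any? home)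
               (λ p → let r , R , e = rep (proj₂ p) in r , R , p , e) (λ (_ , _ , p , _) → p)) ⟩
        𝟙 (Finₚ.any? home) * w (mask v)
          ≡⟨ cong (_* w (mask v)) (sum-unique home (Finₚ.any? home)
               (λ r r′ (R , (_ , v∉) , e) (R′ , _ , e′) → rep-unique R R′ (≈-trans (proj₁ R) v∉ (proj₁ R′) (≈-sym e) e′))) ⟨
        sum (λ r → 𝟙 (home r)) * w (mask v)
          ≡⟨ *-distribʳ-sum (w (mask v)) (λ r → 𝟙 (home r)) ⟩
        sum (λ r → 𝟙 (home r) * w (mask v))
          ≡⟨ sum-cong-≗ (λ r → trans (cong (_* w (mask v)) (𝟙-× (Rep? r) (In? U v ×-dec (v ≈? r)))) (*-assoc (𝟙 (Rep? r)) _ _)) ⟩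
        sum (λ r → 𝟙 (Rep? r) * (𝟙 (In? U v ×-dec (v ≈? r)) * w (mask v))) ∎
        where
        home : ∀ r → Dec (Rep r × (v ∈ U × v ∉ S) × v ≈ r)
        home r = Rep? r ×-dec (In? U v ×-dec (v ≈? r))

  split-S : {P : Pred (Fin n) 0ℓ} (P? : Decidable P) →
            sum (λ v → 𝟙 (P? v)) ≡ sum (λ v → 𝟙 ((v ∈? S) ×-dec P? v)) + sum (λ v → 𝟙 (P? v ×-dec ¬? (v ∈? S)))
  split-S P? = trans (sum-cong-≗ (λ v → term (v ∈? S) (P? v))) (∑-distrib-+ (λ v → 𝟙 ((v ∈? S) ×-dec P? v)) (λ v → 𝟙 (P? v ×-dec ¬? (v ∈? S))))
    where
    term : (d : Dec P) (e : Dec Q) → 𝟙 e ≡ 𝟙 (d ×-dec e) + 𝟙 (e ×-dec ¬? d)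
    term (yes _) (yes _) = refl
    term (yes _) (no _)  = refl
    term (no _)  (yes _) = refl
    term (no _)  (no _)  = refl

  degree-in-S : Subset n → Fin n → ℕ
  degree-in-S U v = sum (λ s → 𝟙 ((s ∈? S) ×-dec (T? (adjacent G v s) ×-dec (s ∈? U))))

  degree-in-S-cong : ∀ {U U′ u v} → (∀ {s} → s ∈ S → s ∈ U → s ∈ U′) → (∀ {s} → s ∈ S → s ∈ U′ → s ∈ U) →
                     mask u ≡ mask v → degree-in-S U u ≡ degree-in-S U′ v
  degree-in-S-cong {U} {U′} {u} {v} f g eq = sum-cong-≗ (λ s →
    𝟙-cong ((s ∈? S) ×-dec (T? (adjacent G u s) ×-dec (s ∈? U))) ((s ∈? S) ×-dec (T? (adjacent G v s) ×-dec (s ∈? U′)))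
      (λ (s∈ , e , s∈U) → s∈ , Edge-sym (mask-Edge s∈ eq (Edge-sym e)) , f s∈ s∈U)
      (λ (s∈ , e , s∈U) → s∈ , Edge-sym (mask-Edge s∈ (sym eq) (Edge-sym e)) , g s∈ s∈U))

  degree-in-S≤k : ∀ U v → degree-in-S U v ≤ k
  degree-in-S≤k U v = sum-onto (λ s → (s ∈? S) ×-dec (T? (adjacent G v s) ×-dec (s ∈? U))) sv (sv-onto ∘ proj₁)

  -- The `suc` counts `v` among the survivors of its own clique; the right-hand side then depends on
  -- `v` only through its clique and its class.
  degree-retained-outside : ∀ {U v} → v ∈ U → v ∉ S →
                   suc (degree G U v) ≡ degree-in-S U v + sum (λ w → 𝟙 (In? U w ×-dec (w ≈? v)))
  degree-retained-outside {U} {v} v∈ v∉ = begin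
    suc (degree G U v)
      ≡⟨ cong suc (trans (degree-sum G U v) (split-S (λ w → T? (adjacent G v w) ×-dec (w ∈? U)))) ⟩
    suc (degree-in-S U v + sum (λ w → 𝟙 (nb w)))
      ≡⟨ +-suc (degree-in-S U v) _ ⟨
    degree-in-S U v + suc (sum (λ w → 𝟙 (nb w)))
      ≡⟨ cong (λ x → degree-in-S U v + (x + sum (λ w → 𝟙 (nb w)))) (sum-unique (v Finₚ.≟_) (yes (v , refl)) (λ i j p q → trans (sym p) q)) ⟨
    degree-in-S U v + (sum (λ w → 𝟙 (v Finₚ.≟ w)) + sum (λ w → 𝟙 (nb w)))
      ≡⟨ cong (degree-in-S U v +_) (trans (sym (∑-distrib-+ (λ w → 𝟙 (v Finₚ.≟ w)) (λ w → 𝟙 (nb w)))) (sum-cong-≗ term)) ⟩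
    degree-in-S U v + sum (λ w → 𝟙 (In? U w ×-dec (w ≈? v))) ∎
    where
    open ≡-Reasoning
    nb : ∀ w → Dec ((Edge G v w × w ∈ U) × w ∉ S)
    nb w = (T? (adjacent G v w) ×-dec (w ∈? U)) ×-dec ¬? (w ∈? S)
    term : ∀ w → 𝟙 (v Finₚ.≟ w) + 𝟙 (nb w) ≡ 𝟙 (In? U w ×-dec (w ≈? v))
    term w with v Finₚ.≟ w
    ... | yes refl = trans (cong suc (𝟙-no (nb v) (λ ((e , _) , _) → subst T (loopless G v) e)))
                           (sym (𝟙-yes (In? U v ×-dec (v ≈? v)) ((v∈ , v∉) , inj₁ refl)))
    ... | no ne = 𝟙-cong (nb w) (In? U w ×-dec (w ≈? v))
      (λ ((e , w∈) , w∉) → (w∈ , w∉) , inj₂ (Edge-sym e))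
      λ { ((w∈ , w∉) , inj₁ eq) → contradiction (sym eq) ne ; ((w∈ , w∉) , inj₂ e) → (Edge-sym e , w∈) , w∉ }

  -- Closed twins have equal degrees.
  irregular⇒good : ∀ {U} → LocallyIrregular G U → Good U
  irregular⇒good {U} irr {u} {v} u∈ v∈ u∉ v∉ (inj₁ eq) m = eq
  irregular⇒good {U} irr {u} {v} u∈ v∈ u∉ v∉ (inj₂ e) m = contradiction
    (suc-injective (begin
      suc (degree G U u)                                                ≡⟨ degree-retained-outside u∈ u∉ ⟩
      degree-in-S U u + sum (λ w → 𝟙 (In? U w ×-dec (w ≈? u)))          ≡⟨ cong₂ _+_ (degree-in-S-cong (λ _ p → p) (λ _ p → p) m) (sum-cong-≗ same) ⟩
      degree-in-S U v + sum (λ w → 𝟙 (In? U w ×-dec (w ≈? v)))          ≡⟨ degree-retained-outside v∈ v∉ ⟨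
      suc (degree G U v)                                                ∎))
    (irr u v u∈ v∈ e)
    where
    open ≡-Reasoning
    same : ∀ w → 𝟙 (In? U w ×-dec (w ≈? u)) ≡ 𝟙 (In? U w ×-dec (w ≈? v))
    same w = 𝟙-cong (In? U w ×-dec (w ≈? u)) (In? U w ×-dec (w ≈? v))
      (λ ((w∈ , w∉) , p) → (w∈ , w∉) , ≈-trans w∉ u∉ v∉ p (inj₂ e))
      (λ ((w∈ , w∉) , p) → (w∈ , w∉) , ≈-trans w∉ v∉ u∉ p (inj₂ (Edge-sym e)))

  degree-good : ∀ {U v} → Good U → v ∈ U → v ∉ S → suc (degree G U v) ≡ degree-in-S U v + val (trace U v)
  degree-good {U} {v} good v∈ v∉ = trans (degree-retained-outside v∈ v∉) (cong (degree-in-S U v +_) (begin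
    sum (λ w → 𝟙 (In? U w ×-dec (w ≈? v)))        ≡⟨ sum-cong-≗ (λ w → sym (*-identityʳ (𝟙 (In? U w ×-dec (w ≈? v))))) ⟩
    sum (λ w → 𝟙 (In? U w ×-dec (w ≈? v)) * 1)    ≡⟨ sum-clique good v∉ (λ _ → 1) ⟩
    sum (λ A → 𝟙 (T? (decode {q} (trace U v) A)) * 1) ≡⟨ sum-cong-≗ (λ A → *-identityʳ (𝟙 (T? (decode {q} (trace U v) A)))) ⟩
    val (trace U v)                               ∎))
    where open ≡-Reasoning

  degree≤B : ∀ {U v} → Good U → v ∈ U → v ∉ S → degree G U v ≤ B
  degree≤B {U} {v} good v∈ v∉ = begin
    degree G U v                          ≤⟨ n≤1+n _ ⟩
    suc (degree G U v)                    ≡⟨ degree-good good v∈ v∉ ⟩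
    degree-in-S U v + val (trace U v)     ≤⟨ +-mono-≤ (degree-in-S≤k U v) (≤-trans (sum-mono (λ A → 𝟙≤1 (T? (decode {q} (trace U v) A)))) (≤-reflexive (trans (sum-const q 1) (*-identityʳ q)))) ⟩
    k + q                                 ∎
    where open ≤-Reasoning

  -- This is the shape on which the exchange acts: a constant part inside `S`, and a sum over
  -- cliques of a function of the option.
  degree-special : ∀ {U} → Good U → ∀ i →
    degree G U (sv i) ≡ degree-in-S U (sv i) + sum (λ r → 𝟙 (Rep? r) * contribution (trace U r) i)
  degree-special {U} good i = begin
    degree G U (sv i)
      ≡⟨ trans (degree-sum G U (sv i)) (split-S (λ w → T? (adjacent G (sv i) w) ×-dec (w ∈? U))) ⟩
    degree-in-S U (sv i) + sum (λ w → 𝟙 ((T? (adjacent G (sv i) w) ×-dec (w ∈? U)) ×-dec ¬? (w ∈? S)))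
      ≡⟨ cong (degree-in-S U (sv i) +_) (trans (sum-cong-≗ term) (sum-cliques good (λ A → 𝟙 (T? (adjBit i A))))) ⟩
    degree-in-S U (sv i) + sum (λ r → 𝟙 (Rep? r) * contribution (trace U r) i) ∎
    where
    open ≡-Reasoning
    term : ∀ w → 𝟙 ((T? (adjacent G (sv i) w) ×-dec (w ∈? U)) ×-dec ¬? (w ∈? S)) ≡ 𝟙 (In? U w) * 𝟙 (T? (adjBit i (mask w)))
    term w = trans
      (𝟙-cong ((T? (adjacent G (sv i) w) ×-dec (w ∈? U)) ×-dec ¬? (w ∈? S)) (In? U w ×-dec T? (adjBit i (mask w)))
        (λ ((e , w∈) , w∉) → (w∈ , w∉) , subst T (sym (adjBit-mask i w)) e)
        (λ ((w∈ , w∉) , e) → (subst T (adjBit-mask i w) e , w∈) , w∉))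
      (𝟙-× (In? U w) (T? (adjBit i (mask w))))

  size : ∀ {U} → Good U → ∣ U ∣ ≡ sum (λ s → 𝟙 ((s ∈? S) ×-dec (s ∈? U))) + sum (λ r → 𝟙 (Rep? r) * val (trace U r))
  size {U} good = begin
    ∣ U ∣
      ≡⟨ trans (card U) (split-S (_∈? U)) ⟩
    sum (λ s → 𝟙 ((s ∈? S) ×-dec (s ∈? U))) + sum (λ v → 𝟙 (In? U v))
      ≡⟨ cong (sum (λ s → 𝟙 ((s ∈? S) ×-dec (s ∈? U))) +_) (begin
           sum (λ v → 𝟙 (In? U v))            ≡⟨ sum-cong-≗ (λ v → sym (*-identityʳ (𝟙 (In? U v)))) ⟩
           sum (λ v → 𝟙 (In? U v) * 1)        ≡⟨ sum-cliques good (λ _ → 1) ⟩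
           sum (λ r → 𝟙 (Rep? r) * sum (λ A → 𝟙 (T? (decode {q} (trace U r) A)) * 1))
             ≡⟨ sum-cong-≗ (λ r → cong (𝟙 (Rep? r) *_) (sum-cong-≗ (λ A → *-identityʳ (𝟙 (T? (decode {q} (trace U r) A)))))) ⟩
           sum (λ r → 𝟙 (Rep? r) * val (trace U r)) ∎) ⟩
    sum (λ s → 𝟙 ((s ∈? S) ×-dec (s ∈? U))) + sum (λ r → 𝟙 (Rep? r) * val (trace U r)) ∎
    where open ≡-Reasoning

  -- A table prescribes the retained classes of a clique in terms of its type
  -- and of the number, cut off at g, of preceding cliques of the same type.
  Follows : Subset n → (Fin o → ℕ → Fin o) → Pred (Fin n) 0ℓ
  Follows U table v = (v ∈ S × v ∈ U) ⊎ (First v × mask v ∈ₒ table (type v) (index v ⊓ g))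

  Follows? : ∀ U table → Decidable (Follows U table)
  Follows? U table v = ((v ∈? S) ×-dec (v ∈? U)) ⊎-dec (First? v ×-dec T? (decode (table (type v) (index v ⊓ g)) (mask v)))

  -- Links the position that the program computes with the rank by which options are dealt out.
  index-rep : ∀ {r} → Rep r → index r ≡ rank (InType? Rep? type (type r)) r
  index-rep {r} (r∉ , min) = sum-cong-≗ (λ r′ → 𝟙-cong (Earlier? r r′) (InType? Rep? type (type r) r′ ×-dec (r′ Fin.<? r))
    (λ (R′ , t , f) → (R′ , t) , lt R′ f)
    (λ ((R′ , t) , lt) → R′ , t , λ (w , w∉ , w≈r , ¬lt) → ¬lt (<-≤-trans lt (≮⇒≥ (λ lt′ → min (w , w∉ , w≈r , lt′))))))
    where
    lt : ∀ {r′} → Rep r′ → ¬ (∃[ w ] (w ∉ S × w ≈ r × ¬ r′ Fin.< w)) → r′ Fin.< r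
    lt {r′} R′ f with r′ Fin.<? r
    ... | yes p = p
    ... | no ¬p = contradiction (r , r∉ , inj₁ refl , ¬p) f

  σ[_,_] : (Fin o → ℕ → Fin o) → Subset n → Fin n → Fin o
  σ[ table , U ] r = table (type r) (rank (InType? Rep? type (type r)) r)

  Exchanged : Subset n → (Fin o → ℕ → Fin o) → Set
  Exchanged U table =
    (∀ i j → table i (j ⊓ g) ≡ table i j) ×
    (λ i → degree-in-S U (sv i) + sum (λ r → 𝟙 (Rep? r) * contribution (trace U r) i)) ⇝
    (λ i → degree-in-S U (sv i) + sum (λ r → 𝟙 (Rep? r) * contribution (σ[ table , U ] r) i)) ×
    sum (λ r → 𝟙 (Rep? r) * val (trace U r)) ≤ sum (λ r → 𝟙 (Rep? r) * val (σ[ table , U ] r)) ×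
    (∀ r → Rep r → ∃[ r′ ] (Rep r′ × type r′ ≡ type r × trace U r′ ≡ σ[ table , U ] r))

  -- The set prescribed by the table is locally irregular and no smaller

  module Tabulated {U : Subset n} (irr : LocallyIrregular G U) (table : Fin o → ℕ → Fin o) (exchanged : Exchanged U table) where

    private
      good   = irregular⇒good irr
      cut    = proj₁ exchanged
      rel    = proj₁ (proj₂ exchanged)
      worth  = proj₁ (proj₂ (proj₂ exchanged))
      origin = proj₂ (proj₂ (proj₂ exchanged))
      σ′     = σ[ table , U ]

    U′ : Subset n
    U′ = comprehension (Follows? U table)

    ∈U′⁺ : ∀ {v} → Follows U table v → v ∈ U′
    ∈U′⁺ = ∈-comprehension⁺ (Follows? U table)
    ∈U′⁻ : ∀ {v} → v ∈ U′ → Follows U table v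
    ∈U′⁻ = ∈-comprehension⁻ (Follows? U table)

    S∩U′ : ∀ {s} → s ∈ S → s ∈ U → s ∈ U′
    S∩U′ s∈ p = ∈U′⁺ (inj₁ (s∈ , p))
    S∩U : ∀ {s} → s ∈ S → s ∈ U′ → s ∈ U
    S∩U s∈ p with ∈U′⁻ p
    ... | inj₁ (_ , q)        = q
    ... | inj₂ ((s∉ , _) , _) = contradiction s∈ s∉
    retained-outside : ∀ {v} → v ∈ U′ → v ∉ S → First v × mask v ∈ₒ table (type v) (index v ⊓ g)
    retained-outside v∈ v∉ with ∈U′⁻ v∈
    ... | inj₁ (v∈S , _) = contradiction v∈S v∉
    ... | inj₂ p         = p

    good′ : Good U′
    good′ {u} {v} u∈ v∈ u∉ v∉ e m with (_ , minu) , _ ← retained-outside u∈ u∉ | (_ , minv) , _ ← retained-outside v∈ v∉ with Finₚ.<-cmp u v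
    ... | tri< lt _ _ = contradiction (u , u∉ , e , m , lt) minv
    ... | tri≈ _ eq _ = eq
    ... | tri> _ _ gt = contradiction (v , v∉ , ≈-sym e , sym m , gt) minu

    prescribed : ∀ {r v} → Rep r → v ∉ S → v ≈ r → table (type v) (index v ⊓ g) ≡ σ′ r
    prescribed {r} {v} R v∉ e = trans (cut (type v) (index v))
      (cong₂ table (trace-≈ v∉ (proj₁ R) e) (trans (index-≈ v∉ (proj₁ R) e) (index-rep R)))

    -- A class of the new option occurs in the clique of `r′`, and the types agree, so it is present
    -- in the clique of `v` as well. Its least vertex there is the one that is retained.
    trace′ : ∀ {r r′ v} → Rep r → v ∉ S → v ≈ r → type r′ ≡ type r → trace U r′ ≡ σ′ r → trace U′ v ≡ trace U r′
    trace′ {r} {r′} {v} R v∉ v≈r t eq = trace-cong to from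
      where
      r∉ = proj₁ R
      to : ∀ A → ∃[ w ] Trace U′ v A w → ∃[ w ] Trace U r′ A w
      to A (w , (w∈ , w∉) , w≈v , refl) =
        ∈-trace⁻ (subst (mask w ∈ₒ_) (trans (prescribed R w∉ (≈-trans w∉ v∉ r∉ w≈v v≈r)) (sym eq)) (proj₂ (retained-outside w∈ w∉)))
      from : ∀ A → ∃[ w ] Trace U r′ A w → ∃[ w ] Trace U′ v A w
      from A p@(w , (w∈ , w∉) , w≈r′ , m)
        with u , ((_ , u∉) , u≈r , refl) , min ←
               least (Trace? ⊤ r A) (∈-trace⁻ (subst (A ∈ₒ_) t (∈-trace⁺ (w , (∈⊤ , w∉) , w≈r′ , m)))) =
        u , (∈U′⁺ (inj₂ ((u∉ , λ (x , x∉ , x≈u , mx , lt) → min x ((∈⊤ , x∉) , ≈-trans x∉ u∉ r∉ x≈u u≈r , mx) lt) ,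
               subst (mask u ∈ₒ_) (trans eq (sym (prescribed R u∉ u≈r))) (∈-trace⁺ p))) , u∉) ,
        ≈-trans u∉ r∉ v∉ u≈r (≈-sym v≈r) , refl

    trace-rep : ∀ {r} → Rep r → trace U′ r ≡ σ′ r
    trace-rep {r} R with r′ , R′ , t , eq ← origin r R = trans (trace′ R (proj₁ R) (inj₁ refl) t eq) eq

    rel′ : (λ i → degree G U (sv i)) ⇝ (λ i → degree G U′ (sv i))
    rel′ = ⇝-trans (≗⇒⇝ (degree-special good)) (⇝-trans rel (≗⇒⇝ (λ i → sym (begin
      degree G U′ (sv i)
        ≡⟨ degree-special good′ i ⟩
      degree-in-S U′ (sv i) + sum (λ r → 𝟙 (Rep? r) * contribution (trace U′ r) i)
        ≡⟨ cong₂ _+_ (degree-in-S-cong {U′} {U} (S∩U) S∩U′ refl) (sum-cong-≗ (at-rep (λ x → contribution x i))) ⟩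
      degree-in-S U (sv i) + sum (λ r → 𝟙 (Rep? r) * contribution (σ′ r) i) ∎))))
      where
      open ≡-Reasoning
      at-rep : ∀ (f : Fin o → ℕ) r → 𝟙 (Rep? r) * f (trace U′ r) ≡ 𝟙 (Rep? r) * f (σ′ r)
      at-rep f r = 𝟙-guard (Rep? r) (cong f ∘ trace-rep)

    -- The clique of `r′` used in `U` the option that the clique of `r` uses in `U′`. The vertex of
    -- the class of `v` that survived there sees the same part of `S` and equally many survivors of
    -- its clique, hence has the same degree.
    twin : ∀ {r r′ v} → Rep r → Rep r′ → type r′ ≡ type r → trace U r′ ≡ σ′ r → v ∈ U′ → v ∉ S → v ≈ r →
           ∃[ w ] (w ∈ U × w ∉ S × w ≈ r′ × mask w ≡ mask v × degree G U w ≡ degree G U′ v)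
    twin {r} {r′} {v} R R′ t eq v∈ v∉ v≈r
      with w , (w∈ , w∉) , w≈r′ , m ← ∈-trace⁻ (subst (mask v ∈ₒ_) (trans (prescribed R v∉ v≈r) (sym eq)) (proj₂ (retained-outside v∈ v∉))) =
      w , w∈ , w∉ , w≈r′ , m , suc-injective (begin
        suc (degree G U w)                   ≡⟨ degree-good good w∈ w∉ ⟩
        degree-in-S U w + val (trace U w)    ≡⟨ cong₂ _+_ (degree-in-S-cong {U} {U′} S∩U′ S∩U m)
                                                 (cong val (trans (trace-≈ w∉ (proj₁ R′) w≈r′) (sym (trace′ R v∉ v≈r t eq)))) ⟩
        degree-in-S U′ v + val (trace U′ v)  ≡⟨ degree-good good′ v∈ v∉ ⟨
        suc (degree G U′ v)                  ∎)
      where open ≡-Reasoning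

    Twin : Fin n → Fin n → Fin n → Set
    Twin r′ x w = w ∈ U × w ∉ S × w ≈ r′ × mask w ≡ mask x × degree G U w ≡ degree G U′ x

    -- A single `r′` serves the whole clique of `v`, so that the twins of two adjacent vertices are
    -- adjacent or equal.
    Twins : Fin n → Set
    Twins v = ∃[ r′ ] (r′ ∉ S × (∀ {x} → x ∈ U′ → x ∉ S → x ≈ v → ∃[ w ] Twin r′ x w))

    twins : ∀ {v} → v ∉ S → Twins v
    twins {v} v∉ = at-rep (rep v∉)
      where
      at-origin : ∀ {r} → Rep r → v ≈ r → ∃[ r′ ] (Rep r′ × type r′ ≡ type r × trace U r′ ≡ σ′ r) → Twins v
      at-origin R v≈r (r′ , R′ , t , eq) =
        r′ , proj₁ R′ , λ x∈ x∉ x≈v → twin R R′ t eq x∈ x∉ (≈-trans x∉ v∉ (proj₁ R) x≈v v≈r)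
      at-rep : ∃[ r ] (Rep r × v ≈ r) → Twins v
      at-rep (r , R , v≈r) = at-origin R v≈r (origin r R)

    -- The twin of `v` has the class of `v`, so it is adjacent to `s` too. If the degree of `s` in
    -- `U` is at most `B`, it is unchanged and the conflict was already present in `U`; otherwise
    -- the new degree of `s` exceeds `B`, and that of `v` does not.
    irr-mixed : ∀ {s v} → s ∈ S → s ∈ U′ → v ∉ S → v ∈ U′ → Edge G s v → degree G U′ s ≢ degree G U′ v
    irr-mixed {s} {v} s∈ s∈U′ v∉ v∈ e eq′ = contra (sv-onto s∈) (twins v∉)
      where
      by-degree : ∀ {i w} → sv i ≡ s → w ∈ U → Edge G s w → degree G U w ≡ degree G U′ v → Dec (degree G U (sv i) ≤ B) → ⊥
      by-degree {i} {w} refl w∈ e′ dw (yes le) = irr s w (S∩U s∈ s∈U′) w∈ e′ (trans (sym (proj₁ rel′ i le)) (trans eq′ (sym dw)))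
      by-degree {i} refl w∈ e′ dw (no gt) =
        <⇒≱ (proj₁ (proj₂ rel′) i (≰⇒> gt)) (≡-≤-trans eq′ (degree≤B good′ v∈ v∉))
      contra : ∃[ i ] sv i ≡ s → Twins v → ⊥
      contra (i , eq) (r′ , _ , tw) = by-twin (tw v∈ v∉ (inj₁ refl))
        where
        by-twin : ∃[ w ] Twin r′ v w → ⊥
        by-twin (w , w∈ , w∉ , w≈r′ , m , dw) =
          by-degree {i} eq w∈ (mask-Edge s∈ (sym m) e) dw (degree G U (sv i) ≤? B)

    irr-special : ∀ {u v} → u ∈ U′ → v ∈ U′ → Edge G u v → ∃[ i ] sv i ≡ u → ∃[ j ] sv j ≡ v → u ∈ S → v ∈ S →
                  degree G U′ u ≢ degree G U′ v
    irr-special u∈ v∈ e (i , refl) (j , refl) u∈S v∈S =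
      proj₂ (proj₂ rel′) i j (irr (sv i) (sv j) (S∩U u∈S u∈) (S∩U v∈S v∈) e)

    -- The twins of `u` and `v` lie in one clique. If they differ, they are adjacent and have equal
    -- degrees in `U`; if they coincide, `u` and `v` have the same class and `good′` identifies
    -- them.
    irr-retained-outside : ∀ {u v} → u ∈ U′ → v ∈ U′ → u ∉ S → v ∉ S → Edge G u v → degree G U′ u ≢ degree G U′ v
    irr-retained-outside {u} {v} u∈ v∈ u∉ v∉ e eq′ = contra (twins u∉)
      where
      contra : Twins u → ⊥
      contra (r′ , r′∉ , tw) = differ (tw u∈ u∉ (inj₁ refl)) (tw v∈ v∉ (≈-sym (inj₂ e)))
        where
        adjacent-twins : ∀ {x y} → Twin r′ u x → Twin r′ v y → x ≈ y → ⊥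
        adjacent-twins {x} {y} (x∈ , _ , _ , mx , dx) (y∈ , _ , _ , my , dy) (inj₂ e′) =
          irr x y x∈ y∈ e′ (trans dx (trans eq′ (sym dy)))
        adjacent-twins (_ , _ , _ , mx , _) (_ , _ , _ , my , _) (inj₁ refl) = subst T (loopless G u)
          (subst (Edge G u) (sym (good′ u∈ v∈ u∉ v∉ (inj₂ e) (trans (sym mx) my))) e)
        differ : ∃[ w ] Twin r′ u w → ∃[ w ] Twin r′ v w → ⊥
        differ (x , p@(_ , x∉ , x≈ , _)) (y , p′@(_ , y∉ , y≈ , _)) =
          adjacent-twins p p′ (≈-trans x∉ r′∉ y∉ x≈ (≈-sym y≈))

    irr′ : LocallyIrregular G U′
    irr′ u v u∈ v∈ e = by-sides (u ∈? S) (v ∈? S)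
      where
      by-sides : Dec (u ∈ S) → Dec (v ∈ S) → degree G U′ u ≢ degree G U′ v
      by-sides (yes u∈S) (yes v∈S) = irr-special u∈ v∈ e (sv-onto u∈S) (sv-onto v∈S) u∈S v∈S
      by-sides (yes u∈S) (no v∉)   = irr-mixed u∈S u∈ v∉ v∈ e
      by-sides (no u∉)   (yes v∈S) = irr-mixed v∈S v∈ u∉ u∈ (Edge-sym e) ∘ sym
      by-sides (no u∉)   (no v∉)   = irr-retained-outside u∈ v∈ u∉ v∉ e

    bigger : ∣ U ∣ ≤ ∣ U′ ∣
    bigger = begin
      ∣ U ∣
        ≡⟨ size good ⟩
      sum (λ s → 𝟙 ((s ∈? S) ×-dec (s ∈? U))) + sum (λ r → 𝟙 (Rep? r) * val (trace U r))
        ≤⟨ +-mono-≤ (≤-reflexive (sum-cong-≗ (λ s → 𝟙-cong ((s ∈? S) ×-dec (s ∈? U)) ((s ∈? S) ×-dec (s ∈? U′))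
                      (λ (a , b) → a , S∩U′ a b) (λ (a , b) → a , S∩U a b)))) worth ⟩
      sum (λ s → 𝟙 ((s ∈? S) ×-dec (s ∈? U′))) + sum (λ r → 𝟙 (Rep? r) * val (σ′ r))
        ≡⟨ cong (sum (λ s → 𝟙 ((s ∈? S) ×-dec (s ∈? U′))) +_) (sum-cong-≗ at-rep) ⟩
      sum (λ s → 𝟙 ((s ∈? S) ×-dec (s ∈? U′))) + sum (λ r → 𝟙 (Rep? r) * val (trace U′ r))
        ≡⟨ size good′ ⟨
      ∣ U′ ∣ ∎
      where
      open ≤-Reasoning
      at-rep : ∀ r → 𝟙 (Rep? r) * val (σ′ r) ≡ 𝟙 (Rep? r) * val (trace U′ r)
      at-rep r = 𝟙-guard (Rep? r) (sym ∘ cong val ∘ trace-rep)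

  tabulated : ∀ {U} → LocallyIrregular G U → Σ[ table ∈ (Fin o → ℕ → Fin o) ]
    (LocallyIrregular G (comprehension (Follows? U table)) × ∣ U ∣ ≤ ∣ comprehension (Follows? U table) ∣)
  -- The empty option is the default of empty blocks; the constant part of the special degrees is
  -- their part inside `S`.
  tabulated {U} irr = build (exchange Rep? type (trace U) (code {q} (λ _ → false)) (λ i → degree-in-S U (sv i)))
    where
    build : Σ[ table ∈ (Fin o → ℕ → Fin o) ] Exchanged U table → _
    build (table , exchanged) = table , Tabulated.irr′ irr table exchanged , Tabulated.bigger irr table exchanged

-- A typed language, its compilation and its running time

data Ty : Set where
  unit bool vtx gr : Ty
  list : Ty → Ty

Ctx : Set
Ctx = List Ty

private
  variable
    A B C D E F H I : Ty
    Γ Δ : Ctx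

infix 4 _∋_
data _∋_ : Ctx → Ty → Set where
  here  : A ∷ Γ ∋ A
  there : Γ ∋ A → B ∷ Γ ∋ A

mutual
  -- The only recursion is `fold`, and `app` evaluates a term in a context of its own. Evaluation is
  -- therefore total and its cost compositional; only the lengths of the lists folded over remain to
  -- be bounded.
  data Tm (Γ : Ctx) : Ty → Set where
    var    : Γ ∋ A → Tm Γ A
    unit   : Tm Γ unit
    ff tt  : Tm Γ bool
    if     : Tm Γ bool → Tm Γ A → Tm Γ A → Tm Γ A
    nil    : Tm Γ (list A)
    cons   : Tm Γ A → Tm Γ (list A) → Tm Γ (list A)
    uncons : Tm Γ (list A) → Tm Γ B → Tm (A ∷ list A ∷ Γ) B → Tm Γ B
    fold   : Tm Γ (list A) → Tm Γ B → Tm (A ∷ B ∷ Γ) B → Tm Γ B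
    app    : Tm Δ A → Args Γ Δ → Tm Γ A
    vtxs   : Tm Γ gr → Tm Γ (list vtx)
    adj    : Tm Γ gr → Tm Γ vtx → Tm Γ vtx → Tm Γ bool
    lt     : Tm Γ vtx → Tm Γ vtx → Tm Γ bool

  infixr 5 _∷_
  data Args (Γ : Ctx) : Ctx → Set where
    []  : Args Γ []
    _∷_ : Tm Γ A → Args Γ Δ → Args Γ (A ∷ Δ)

nthF : Function 2
nthF = fun (case (var 0F)
  (case (var 1F) nil (var 0F))
  (case (var 3F) nil (self (var 3F ∷ var 1F ∷ []))))

ltF : Function 2
ltF = fun (case (var 1F)
  nil
  (case (var 2F) (cons nil nil) (self (var 1F ∷ var 3F ∷ []))))

-- The second argument is a unary counter; one vertex number is produced for each row of the matrix,
-- whose contents do not matter.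
vtxsF : Function 2
vtxsF = fun (case (var 0F)
  nil
  (cons (var 3F) (self (var 1F ∷ cons nil (var 3F) ∷ []))))

-- Compiled code carries extra variables, bound by `case` and `bind`, that the typed context lacks;
-- a slot assignment tells where each typed variable is stored.
Slots : Ctx → ℕ → Set
Slots Γ n = ∀ {A} → Γ ∋ A → Fin n

shift : ∀ {n} m → Slots Γ n → Slots Γ (m + n)
shift m η x = m ↑ʳ η x

push : ∀ {n} → Fin n → Slots Γ n → Slots (A ∷ Γ) n
push i η here      = i
push i η (there x) = η x

slots : ∀ Γ → Slots Γ (length Γ)
slots (A ∷ Γ) here      = zero
slots (A ∷ Γ) (there x) = suc (slots Γ x)

vars : ∀ {a n} Γ → Slots Γ n → Vec (Expr a n) (length Γ)
vars []      η = []
vars (A ∷ Γ) η = var (η here) ∷ vars Γ (λ x → η (there x))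

mutual
  compile : ∀ {a n} → Slots Γ n → Tm Γ A → Expr a n
  compile η (var x)        = var (η x)
  compile η unit           = nil
  compile η ff             = nil
  compile η tt             = cons nil nil
  compile η (if c e₁ e₂)   = case (compile η c) (compile η e₂) (compile (shift 2 η) e₁)
  compile η nil            = nil
  compile η (cons e₁ e₂)   = cons (compile η e₁) (compile η e₂)
  compile η (uncons e z s) = case (compile η e) (compile η z) (compile (push 0F (push 1F (shift 2 η))) s)
  compile {Γ} η (fold e z s) = call (foldF Γ z s) (compile η e ∷ vars Γ η)
  compile {Γ} η (app {Δ = Δ} f es) = call (function f) (compiles η es)
  compile η (vtxs e)       = call vtxsF (compile η e ∷ nil ∷ [])
  compile η (adj e₁ e₂ e₃) = call nthF (compile η e₃ ∷ call nthF (compile η e₂ ∷ compile η e₁ ∷ []) ∷ [])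
  compile η (lt e₁ e₂)     = call ltF (compile η e₁ ∷ compile η e₂ ∷ [])

  compiles : ∀ {a n} → Slots Γ n → Args Γ Δ → Vec (Expr a n) (length Δ)
  compiles η []       = []
  compiles η (e ∷ es) = compile η e ∷ compiles η es

  foldF : ∀ Γ → Tm Γ B → Tm (A ∷ B ∷ Γ) B → Function (suc (length Γ))
  foldF Γ z s = fun (case (var 0F)
    (compile (shift 1 (slots Γ)) z)
    (bind (self (var 1F ∷ vars Γ (shift 3 (slots Γ))))
          -- Above the environment lie the recursive result, the head, the tail and the whole list,
          -- in this order: the head is in slot 1 and the result in slot 0.
          (compile (push 1F (push 0F (shift 4 (slots Γ)))) s)))

  function : Tm Γ A → Function (length Γ)
  function {Γ} e = fun (compile (slots Γ) e)

-- An upper bound on the running time in terms of a bound on n and on the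
-- lengths of all lists over which the evaluation folds.
mutual
  time : Tm Γ A → ℕ → ℕ
  time (var x)        m = 1
  time unit           m = 1
  time ff             m = 1
  time tt             m = 3
  time (if c e₁ e₂)   m = 1 + (time c m + (time e₁ m + time e₂ m))
  time nil            m = 1
  time (cons e₁ e₂)   m = 1 + (time e₁ m + time e₂ m)
  time (uncons e z s) m = 1 + (time e m + (time z m + time s m))
  time {Γ} (fold e z s) m = 1 + (time e m + length Γ) + suc m * (6 + length Γ + (time z m + time s m))
  time (app f es)     m = 1 + (times es m + time f m)
  time (vtxs e)       m = 1 + (time e m + 1) + 9 * suc m
  time (adj e₁ e₂ e₃) m = 1 + (time e₃ m + (1 + (time e₂ m + time e₁ m) + 7 * suc m)) + 7 * suc m
  time (lt e₁ e₂)     m = 1 + (time e₁ m + time e₂ m) + 7 * suc m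

  times : Args Γ Δ → ℕ → ℕ
  times []       m = 0
  times (e ∷ es) m = time e m + times es m

-- Denotation of the typed language and correctness of its compilation

module Semantics {n : ℕ} (G : Graph n) where

  ⟦_⟧ₜ : Ty → Set
  ⟦ unit ⟧ₜ   = Unit
  ⟦ bool ⟧ₜ   = Bool
  ⟦ vtx ⟧ₜ    = Fin n
  ⟦ gr ⟧ₜ     = Unit
  ⟦ list A ⟧ₜ = List ⟦ A ⟧ₜ

  Env : Ctx → Set
  Env []      = Unit
  Env (A ∷ Γ) = ⟦ A ⟧ₜ × Env Γ

  get : Γ ∋ A → Env Γ → ⟦ A ⟧ₜ
  get here      ρ = proj₁ ρ
  get (there x) ρ = get x (proj₂ ρ)

  mutual
    ⟦_⟧ : Tm Γ A → Env Γ → ⟦ A ⟧ₜ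
    ⟦ var x ⟧ ρ        = get x ρ
    ⟦ unit ⟧ ρ         = tt
    ⟦ ff ⟧ ρ           = false
    ⟦ tt ⟧ ρ           = true
    ⟦ if c e₁ e₂ ⟧ ρ   = if ⟦ c ⟧ ρ then ⟦ e₁ ⟧ ρ else ⟦ e₂ ⟧ ρ
    ⟦ nil ⟧ ρ          = []
    ⟦ cons e₁ e₂ ⟧ ρ   = ⟦ e₁ ⟧ ρ ∷ ⟦ e₂ ⟧ ρ
    ⟦ uncons e z s ⟧ ρ = unconsₛ (⟦ e ⟧ ρ) (⟦ z ⟧ ρ) (λ h t → ⟦ s ⟧ (h , t , ρ))
    ⟦ fold e z s ⟧ ρ   = foldr (λ h r → ⟦ s ⟧ (h , r , ρ)) (⟦ z ⟧ ρ) (⟦ e ⟧ ρ)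
    ⟦ app f es ⟧ ρ     = ⟦ f ⟧ (⟦ es ⟧ₐ ρ)
    ⟦ vtxs e ⟧ ρ       = allFin n
    ⟦ adj e₁ e₂ e₃ ⟧ ρ = adjacent G (⟦ e₂ ⟧ ρ) (⟦ e₃ ⟧ ρ)
    ⟦ lt e₁ e₂ ⟧ ρ     = toℕ (⟦ e₁ ⟧ ρ) <ᵇ toℕ (⟦ e₂ ⟧ ρ)

    ⟦_⟧ₐ : Args Γ Δ → Env Γ → Env Δ
    ⟦ [] ⟧ₐ ρ     = tt
    ⟦ e ∷ es ⟧ₐ ρ = ⟦ e ⟧ ρ , ⟦ es ⟧ₐ ρ

    unconsₛ : ∀ {X Y : Set} → List X → Y → (X → List X → Y) → Y
    unconsₛ []      z s = z
    unconsₛ (h ∷ t) z s = s h t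

  enc : ∀ A → ⟦ A ⟧ₜ → Tree
  enc unit     x  = nil
  enc bool     b  = encodeBool b
  enc vtx      v  = encodeℕ (toℕ v)
  enc gr       g  = encodeGraph G
  enc (list A) xs = encodeList (map (enc A) xs)

  encEnv : ∀ Γ → Env Γ → Vec Tree (length Γ)
  encEnv []      ρ       = []
  encEnv (A ∷ Γ) (x , ρ) = enc A x ∷ encEnv Γ ρ

  module Bounded (M : ℕ) (n≤M : n ≤ M) where

    mutual
      -- Along the actual evaluation, every folded list has length at most `M`. A branch of `if` is
      -- constrained only when taken, and the step of a fold only at accumulators that arise from
      -- suffixes of the list; at arbitrary ones the condition can fail, as in `pow2E`.
      Bnd : Tm Γ A → Env Γ → Set
      Bnd (var x)        ρ = Unit
      Bnd unit           ρ = Unit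
      Bnd ff             ρ = Unit
      Bnd tt             ρ = Unit
      Bnd (if c e₁ e₂)   ρ = Bnd c ρ × (⟦ c ⟧ ρ ≡ true → Bnd e₁ ρ) × (⟦ c ⟧ ρ ≡ false → Bnd e₂ ρ)
      Bnd nil            ρ = Unit
      Bnd (cons e₁ e₂)   ρ = Bnd e₁ ρ × Bnd e₂ ρ
      Bnd (uncons e z s) ρ = Bnd e ρ × Bnd z ρ × (∀ h t → ⟦ e ⟧ ρ ≡ h ∷ t → Bnd s (h , t , ρ))
      Bnd (fold e z s)   ρ = Bnd e ρ × length (⟦ e ⟧ ρ) ≤ M × Bnd z ρ ×
        (∀ l h t → ⟦ e ⟧ ρ ≡ l ++ h ∷ t →
          Bnd s (h , foldr (λ h r → ⟦ s ⟧ (h , r , ρ)) (⟦ z ⟧ ρ) t , ρ))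
      Bnd (app f es)     ρ = Bnds es ρ × Bnd f (⟦ es ⟧ₐ ρ)
      Bnd (vtxs e)       ρ = Bnd e ρ
      Bnd (adj e₁ e₂ e₃) ρ = Bnd e₁ ρ × Bnd e₂ ρ × Bnd e₃ ρ
      Bnd (lt e₁ e₂)     ρ = Bnd e₁ ρ × Bnd e₂ ρ

      Bnds : Args Γ Δ → Env Γ → Set
      Bnds []       ρ = Unit
      Bnds (e ∷ es) ρ = Bnd e ρ × Bnds es ρ

    private
      variable
        a m : ℕ

    Within : Function a → Vec Tree a → Tree → ℕ → Set
    Within F vs v b = ∃[ t ] (F · vs ⇓ v ⟨ t ⟩ × t ≤ b)

    Eval : Function a → Vec Tree m → Expr a m → Tree → ℕ → Set
    Eval F ρ e v b = ∃[ t ] (F , ρ ⊢ e ⇓ v ⟨ t ⟩ × t ≤ b)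

    Eval* : Function a → Vec Tree m → ∀ {b} → Vec (Expr a m) b → Vec Tree b → ℕ → Set
    Eval* F ρ es vs b = ∃[ t ] (F , ρ ⊢ es ⇓* vs ⟨ t ⟩ × t ≤ b)

    Stored : Slots Γ m → Env Γ → Vec Tree m → Set
    Stored {Γ = Γ} η ρ ρ′ = ∀ {A} (x : Γ ∋ A) → Vec.lookup ρ′ (η x) ≡ enc A (get x ρ)

    slots-stored : ∀ Γ (ρ : Env Γ) → Stored (slots Γ) ρ (encEnv Γ ρ)
    slots-stored (A ∷ Γ) ρ here      = refl
    slots-stored (A ∷ Γ) ρ (there x) = slots-stored Γ (proj₂ ρ) x

    push-stored : ∀ (ρ′ : Vec Tree m) {ρ : Env Γ} {x : ⟦ A ⟧ₜ} i (η : Slots Γ m) →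
                  Vec.lookup ρ′ i ≡ enc A x → Stored η ρ ρ′ →
                  Stored {Γ = A ∷ Γ} (push i η) (x , ρ) ρ′
    push-stored ρ′ i η p st here      = p
    push-stored ρ′ i η p st (there x) = st x

    eval-var : ∀ {F : Function a} {ρ : Vec Tree m} x {v} → Vec.lookup ρ x ≡ v → F , ρ ⊢ var x ⇓ v ⟨ 1 ⟩
    eval-var x refl = var x

    eval-vars : ∀ {F : Function a} {ρ′ : Vec Tree m} Γ (η : Slots Γ m) (ρ : Env Γ) →
                Stored η ρ ρ′ → F , ρ′ ⊢ vars Γ η ⇓* encEnv Γ ρ ⟨ length Γ ⟩
    eval-vars []      η ρ st = []
    eval-vars (A ∷ Γ) η ρ st = eval-var (η here) (st here) ∷ eval-vars Γ (λ x → η (there x)) (proj₂ ρ) (λ x → st (there x))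

    nth-within : ∀ {m} (f : Fin m → Tree) i →
                 Within nthF (encodeℕ (toℕ i) ∷ encodeList (List.tabulate f) ∷ []) (f i) (7 * suc (toℕ i))
    nth-within f zero = _ , apply (case-nil (var 0F) (case-cons (var 1F) (var 0F))) , m≤m+n 5 2
    nth-within f (suc i) with t , d , le ← nth-within (f ∘ suc) i =
      _ , apply (case-cons (var 0F) (case-cons (var 3F) (self (var 3F ∷ var 1F ∷ []) d))) ,
      ≤-trans (+-monoʳ-≤ 7 le) (≤-reflexive (sym (*-suc 7 (suc (toℕ i)))))

    lt-within : ∀ i j → Within ltF (encodeℕ i ∷ encodeℕ j ∷ []) (encodeBool (i <ᵇ j)) (7 * suc j)
    lt-within i zero = _ , apply (case-nil (var 1F) nil) , m≤m+n 3 4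
    lt-within zero (suc j) = _ , apply (case-cons (var 1F) (case-nil (var 2F) (cons nil nil))) , ≤-trans (m≤m+n 7 (7 * suc j)) (≤-reflexive (sym (*-suc 7 (suc j))))
    lt-within (suc i) (suc j) with t , d , le ← lt-within i j =
      _ , apply (case-cons (var 1F) (case-cons (var 2F) (self (var 1F ∷ var 3F ∷ []) d))) ,
      ≤-trans (+-monoʳ-≤ 7 le) (≤-reflexive (sym (*-suc 7 (suc j))))

    vtxs-within : ∀ {m} (f : Fin m → Tree) (g : Fin m → Tree) i →
                  (∀ j → g j ≡ encodeℕ (toℕ j + i)) →
                  Within vtxsF (encodeList (List.tabulate f) ∷ encodeℕ i ∷ []) (encodeList (List.tabulate g)) (9 * suc m)
    vtxs-within {zero} f g i eq = _ , apply (case-nil (var 0F) nil) , m≤m+n 3 6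
    vtxs-within {suc m} f g i eq
      with t , d , le ← vtxs-within (f ∘ suc) (g ∘ suc) (suc i) (λ j → trans (eq (suc j)) (cong encodeℕ (sym (+-suc (toℕ j) i)))) =
      _ , subst (λ x → vtxsF · _ ⇓ cons x _ ⟨ _ ⟩) (sym (eq zero))
            (apply (case-cons (var 0F) (cons (var 3F) (self (var 1F ∷ cons nil (var 3F) ∷ []) d)))) ,
      ≤-trans (+-monoʳ-≤ 9 le) (≤-reflexive (sym (*-suc 9 (suc m))))

    <M : ∀ (i : Fin n) → toℕ i ≤ M
    <M i = ≤-trans (<⇒≤ (Finₚ.toℕ<n i)) n≤M

    graph-rows : encodeGraph G ≡ encodeList (List.tabulate (λ i → encodeList (List.tabulate (λ j → encodeBool (adjacent G i j)))))
    graph-rows = cong encodeList (trans (map-tabulate (λ i → i) _)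
      (tabulate-cong′ (λ i → cong encodeList (map-tabulate (λ j → j) _))))
      where
      tabulate-cong′ : ∀ {m} {f g : Fin m → Tree} → (∀ i → f i ≡ g i) → List.tabulate f ≡ List.tabulate g
      tabulate-cong′ {zero}  p = refl
      tabulate-cong′ {suc m} p = cong₂ _∷_ (p zero) (tabulate-cong′ (p ∘ suc))

    mutual
      evaluate : ∀ {F : Function a} {ρ′ : Vec Tree m} (η : Slots Γ m) (e : Tm Γ A) (ρ : Env Γ) →
                 Stored η ρ ρ′ → Bnd e ρ → Eval F ρ′ (compile η e) (enc A (⟦ e ⟧ ρ)) (time e M)
      evaluate η (var x) ρ st b = _ , eval-var (η x) (st x) , ≤-refl
      evaluate η unit ρ st b = _ , nil , ≤-refl
      evaluate η ff ρ st b = _ , nil , ≤-refl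
      evaluate η tt ρ st b = _ , cons nil nil , ≤-refl
      evaluate η (if c e₁ e₂) ρ st (bc , b₁ , b₂) with ⟦ c ⟧ ρ in eq | evaluate η c ρ st bc
      ... | true  | t , d , le with evaluate (shift 2 η) e₁ ρ st (b₁ eq)
      ...   | t₁ , d₁ , le₁ = _ , case-cons d d₁ , s≤s (+-mono-≤ le (≤-trans le₁ (m≤m+n _ _)))
      evaluate η (if c e₁ e₂) ρ st (bc , b₁ , b₂) | false | t , d , le with evaluate η e₂ ρ st (b₂ eq)
      ...   | t₂ , d₂ , le₂ = _ , case-nil d d₂ , s≤s (+-mono-≤ le (≤-trans le₂ (m≤n+m _ _)))
      evaluate η nil ρ st b = _ , nil , ≤-refl
      evaluate η (cons e₁ e₂) ρ st (b₁ , b₂) with evaluate η e₁ ρ st b₁ | evaluate η e₂ ρ st b₂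
      ... | t₁ , d₁ , le₁ | t₂ , d₂ , le₂ = _ , cons d₁ d₂ , s≤s (+-mono-≤ le₁ le₂)
      evaluate η (uncons e z s) ρ st (be , bz , bs) with ⟦ e ⟧ ρ in eq | evaluate η e ρ st be
      ... | [] | t , d , le with evaluate η z ρ st bz
      ...   | t₁ , d₁ , le₁ = _ , case-nil d d₁ , s≤s (+-mono-≤ le (≤-trans le₁ (m≤m+n _ _)))
      evaluate {ρ′ = ρ′} η (uncons {A = A} e z s) ρ st (be , bz , bs) | h ∷ l | t , d , le
        with evaluate (push 0F (push 1F (shift 2 η))) s (h , l , ρ)
               (let ρ″ = enc A h ∷ enc (list A) l ∷ ρ′ in
                push-stored ρ″ 0F (push 1F (shift 2 η)) refl (push-stored ρ″ 1F (shift 2 η) refl st))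
               (bs h l eq)
      ...   | t₁ , d₁ , le₁ = _ , case-cons d d₁ , s≤s (+-mono-≤ le (≤-trans le₁ (m≤n+m _ _)))
      evaluate {Γ = Γ} η (fold e z s) ρ st (be , len , bz , bs) with evaluate η e ρ st be
      ... | t₁ , d₁ , le₁ with evaluate-fold z s ρ (⟦ e ⟧ ρ) bz bs
      ...   | t₂ , d₂ , le₂ =
        _ , call (d₁ ∷ eval-vars Γ η ρ st) d₂ ,
        +-mono-≤ (s≤s (+-monoˡ-≤ (length Γ) le₁))
                 (≤-trans le₂ (*-monoˡ-≤ (6 + length Γ + (time z M + time s M)) (s≤s len)))
      evaluate η (app f es) ρ st (bs , b) with evaluates η es ρ st bs | evaluate-function f (⟦ es ⟧ₐ ρ) b
      ... | t₁ , d₁ , le₁ | t₂ , d₂ , le₂ = _ , call d₁ d₂ , s≤s (+-mono-≤ le₁ le₂)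
      evaluate {F = F} {ρ′} η (vtxs e) ρ st b with evaluate {F = F} {ρ′} η e ρ st b
      ... | t , d , le with vtxs-within _ (encodeℕ ∘ toℕ) 0 (λ j → cong encodeℕ (sym (+-identityʳ (toℕ j))))
      ...   | t′ , d′ , le′ =
        _ , subst (λ x → F , ρ′ ⊢ call vtxsF (compile η e ∷ nil ∷ []) ⇓ x ⟨ _ ⟩)
              (cong encodeList (sym (map-tabulate (λ i → i) (encodeℕ ∘ toℕ))))
              (call (subst (λ x → F , ρ′ ⊢ compile η e ⇓ x ⟨ t ⟩) graph-rows d ∷ nil ∷ []) d′) ,
        +-mono-≤ (s≤s (+-monoˡ-≤ 1 le)) (≤-trans le′ (*-monoʳ-≤ 9 (s≤s n≤M)))
      evaluate {F = F} {ρ′} η (adj e₁ e₂ e₃) ρ st (b₁ , b₂ , b₃)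
        with evaluate {F = F} {ρ′} η e₁ ρ st b₁ | evaluate {F = F} {ρ′} η e₂ ρ st b₂ | evaluate {F = F} {ρ′} η e₃ ρ st b₃
           | nth-within (λ i → encodeList (List.tabulate (λ j → encodeBool (adjacent G i j)))) (⟦ e₂ ⟧ ρ)
           | nth-within (λ j → encodeBool (adjacent G (⟦ e₂ ⟧ ρ) j)) (⟦ e₃ ⟧ ρ)
      ... | t₁ , d₁ , le₁ | t₂ , d₂ , le₂ | t₃ , d₃ , le₃ | t₄ , d₄ , le₄ | t₅ , d₅ , le₅ =
        _ , call (d₃ ∷ call (d₂ ∷ subst (λ x → F , ρ′ ⊢ compile η e₁ ⇓ x ⟨ t₁ ⟩) graph-rows d₁ ∷ []) d₄ ∷ []) d₅ ,
        +-mono-≤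
          (s≤s (+-mono-≤ le₃ (≡-≤-trans (+-identityʳ _)
            (+-mono-≤ (s≤s (+-mono-≤ le₂ (≡-≤-trans (+-identityʳ t₁) le₁)))
                      (≤-trans le₄ (*-monoʳ-≤ 7 (s≤s (<M (⟦ e₂ ⟧ ρ)))))))))
          (≤-trans le₅ (*-monoʳ-≤ 7 (s≤s (<M (⟦ e₃ ⟧ ρ)))))
      evaluate η (lt e₁ e₂) ρ st (b₁ , b₂)
        with evaluate η e₁ ρ st b₁ | evaluate η e₂ ρ st b₂ | lt-within (toℕ (⟦ e₁ ⟧ ρ)) (toℕ (⟦ e₂ ⟧ ρ))
      ... | t₁ , d₁ , le₁ | t₂ , d₂ , le₂ | t , d , le =
        _ , call (d₁ ∷ d₂ ∷ []) d ,
        +-mono-≤ (s≤s (+-mono-≤ le₁ (≡-≤-trans (+-identityʳ t₂) le₂))) (≤-trans le (*-monoʳ-≤ 7 (s≤s (<M (⟦ e₂ ⟧ ρ)))))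

      evaluates : ∀ {F : Function a} {ρ′ : Vec Tree m} (η : Slots Γ m) (es : Args Γ Δ) (ρ : Env Γ) →
                  Stored η ρ ρ′ → Bnds es ρ → Eval* F ρ′ (compiles η es) (encEnv Δ (⟦ es ⟧ₐ ρ)) (times es M)
      evaluates η []       ρ st b = _ , [] , ≤-refl
      evaluates η (e ∷ es) ρ st (b , bs) with evaluate η e ρ st b | evaluates η es ρ st bs
      ... | t₁ , d₁ , le₁ | t₂ , d₂ , le₂ = _ , d₁ ∷ d₂ , +-mono-≤ le₁ le₂

      evaluate-function : ∀ (e : Tm Γ A) (ρ : Env Γ) → Bnd e ρ →
                          Within (function e) (encEnv Γ ρ) (enc A (⟦ e ⟧ ρ)) (time e M)
      evaluate-function {Γ = Γ} e ρ b with evaluate {F = function e} (slots Γ) e ρ (slots-stored Γ ρ) b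
      ... | t , d , le = t , apply d , le

      evaluate-fold : ∀ (z : Tm Γ B) (s : Tm (A ∷ B ∷ Γ) B) (ρ : Env Γ) (xs : List ⟦ A ⟧ₜ) →
        Bnd z ρ →
        (∀ l h t → xs ≡ l ++ h ∷ t → Bnd s (h , foldr (λ h r → ⟦ s ⟧ (h , r , ρ)) (⟦ z ⟧ ρ) t , ρ)) →
        Within (foldF Γ z s) (encodeList (map (enc A) xs) ∷ encEnv Γ ρ)
               (enc B (foldr (λ h r → ⟦ s ⟧ (h , r , ρ)) (⟦ z ⟧ ρ) xs))
               (suc (length xs) * (6 + length Γ + (time z M + time s M)))
      evaluate-fold {Γ = Γ} z s ρ [] bz bs with evaluate {F = foldF Γ z s} {ρ′ = nil ∷ encEnv Γ ρ} (shift 1 (slots Γ)) z ρ (slots-stored Γ ρ) bz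
      ... | t , d , le = _ , apply (case-nil (var 0F) d) ,
        ≤-trans (+-mono-≤ (≤-trans (m≤m+n 2 4) (m≤m+n 6 (length Γ))) (≤-trans le (m≤m+n _ _))) (m≤m+n _ 0)
      evaluate-fold {Γ = Γ} {B = B} {A = A} z s ρ (x ∷ xs) bz bs
        with evaluate-fold z s ρ xs bz (λ l h t eq → bs (x ∷ l) h t (cong (x ∷_) eq))
      ... | t , d , le
        with evaluate {F = foldF Γ z s}
               (push 1F (push 0F (shift 4 (slots Γ)))) s (x , _ , ρ)
               (let ρ″ = enc B (foldr (λ h r → ⟦ s ⟧ (h , r , ρ)) (⟦ z ⟧ ρ) xs) ∷ enc A x ∷
                         enc (list A) xs ∷ enc (list A) (x ∷ xs) ∷ encEnv Γ ρ in
                push-stored ρ″ 1F (push 0F (shift 4 (slots Γ))) refl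
                  (push-stored ρ″ 0F (shift 4 (slots Γ)) refl (slots-stored Γ ρ)))
               (bs [] x xs refl)
      ...   | t₂ , d₂ , le₂ =
        _ , apply (case-cons (var 0F) (bind (self (var 1F ∷ eval-vars Γ (shift 3 (slots Γ)) ρ (slots-stored Γ ρ)) d) d₂)) ,
        (begin
          2 + (1 + (1 + (1 + length Γ) + t) + t₂)
            ≡⟨ arith (length Γ) t t₂ ⟩
          (5 + length Γ + t₂) + t
            ≤⟨ +-mono-≤ (+-mono-≤ (n≤1+n (5 + length Γ)) (≤-trans le₂ (m≤n+m (time s M) (time z M)))) le ⟩
          suc (suc (length xs)) * (6 + length Γ + (time z M + time s M)) ∎)
        where
        open ≤-Reasoning
        arith : ∀ g t t₂ → 2 + (1 + (1 + (1 + g) + t) + t₂) ≡ (5 + g + t₂) + t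
        arith g t t₂ = cong (5 +_) (trans (+-assoc g t t₂) (trans (cong (g +_) (+-comm t t₂)) (sym (+-assoc g t₂ t))))

-- Polynomial bounds on running times

Poly : (ℕ → ℕ) → Set
Poly f = ∃[ c ] ∃[ d ] (∀ m → f m ≤ c * suc m ^ d)

const-poly : ∀ c → Poly (λ _ → c)
const-poly c = c , 0 , λ m → ≤-reflexive (sym (*-identityʳ c))

linear-poly : ∀ c → Poly (λ m → c * suc m)
linear-poly c = c , 1 , λ m → ≤-reflexive (cong (c *_) (sym (*-identityʳ (suc m))))

+-poly : ∀ {f g} → Poly f → Poly g → Poly (λ m → f m + g m)
+-poly {f} {g} (c , d , p) (c′ , d′ , p′) = c + c′ , d + d′ , λ m → begin
  f m + g m
    ≤⟨ +-mono-≤ (p m) (p′ m) ⟩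
  c * suc m ^ d + c′ * suc m ^ d′
    -- The base `suc m` is positive, so both exponents can be raised to `d + d′`.
    ≤⟨ +-mono-≤ (*-monoʳ-≤ c (^-monoʳ-≤ (suc m) (m≤m+n d d′))) (*-monoʳ-≤ c′ (^-monoʳ-≤ (suc m) (m≤n+m d′ d))) ⟩
  c * suc m ^ (d + d′) + c′ * suc m ^ (d + d′)
    ≡⟨ *-distribʳ-+ _ c c′ ⟨
  (c + c′) * suc m ^ (d + d′) ∎
  where open ≤-Reasoning

suc*-poly : ∀ {f} → Poly f → Poly (λ m → suc m * f m)
suc*-poly {f} (c , d , p) = c , 1 + d , λ m → begin
  suc m * f m               ≤⟨ *-monoʳ-≤ (suc m) (p m) ⟩
  suc m * (c * suc m ^ d)   ≡⟨ *-assoc (suc m) c _ ⟨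
  suc m * c * suc m ^ d     ≡⟨ cong (_* suc m ^ d) (*-comm (suc m) c) ⟩
  c * suc m * suc m ^ d     ≡⟨ *-assoc c (suc m) _ ⟩
  c * suc m ^ suc d         ∎
  where open ≤-Reasoning

mutual
  time-poly : (e : Tm Γ A) → Poly (time e)
  time-poly (var x)        = const-poly 1
  time-poly unit           = const-poly 1
  time-poly ff             = const-poly 1
  time-poly tt             = const-poly 3
  time-poly (if c e₁ e₂)   = +-poly (const-poly 1) (+-poly (time-poly c) (+-poly (time-poly e₁) (time-poly e₂)))
  time-poly nil            = const-poly 1
  time-poly (cons e₁ e₂)   = +-poly (const-poly 1) (+-poly (time-poly e₁) (time-poly e₂))
  time-poly (uncons e z s) = +-poly (const-poly 1) (+-poly (time-poly e) (+-poly (time-poly z) (time-poly s)))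
  time-poly {Γ} (fold e z s) =
    +-poly (+-poly (const-poly 1) (+-poly (time-poly e) (const-poly (length Γ))))
           (suc*-poly (+-poly (const-poly (6 + length Γ)) (+-poly (time-poly z) (time-poly s))))
  time-poly (app f es)     = +-poly (const-poly 1) (+-poly (times-poly es) (time-poly f))
  time-poly (vtxs e)       = +-poly (+-poly (const-poly 1) (+-poly (time-poly e) (const-poly 1))) (linear-poly 9)
  time-poly (adj e₁ e₂ e₃) =
    +-poly (+-poly (const-poly 1) (+-poly (time-poly e₃)
      (+-poly (+-poly (const-poly 1) (+-poly (time-poly e₂) (time-poly e₁))) (linear-poly 7)))) (linear-poly 7)
  time-poly (lt e₁ e₂)     = +-poly (+-poly (const-poly 1) (+-poly (time-poly e₁) (time-poly e₂))) (linear-poly 7)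

  times-poly : (es : Args Γ Δ) → Poly (times es)
  times-poly []       = const-poly 0
  times-poly (e ∷ es) = +-poly (time-poly e) (times-poly es)

-- The program

x0 : Tm (A ∷ Γ) A
x0 = var here

x1 : Tm (A ∷ B ∷ Γ) B
x1 = var (there here)

x2 : Tm (A ∷ B ∷ C ∷ Γ) C
x2 = var (there (there here))

x3 : Tm (A ∷ B ∷ C ∷ D ∷ Γ) D
x3 = var (there (there (there here)))

x4 : Tm (A ∷ B ∷ C ∷ D ∷ E ∷ Γ) E
x4 = var (there (there (there (there here))))

x5 : Tm (A ∷ B ∷ C ∷ D ∷ E ∷ F ∷ Γ) F
x5 = var (there (there (there (there (there here)))))

x6 : Tm (A ∷ B ∷ C ∷ D ∷ E ∷ F ∷ H ∷ Γ) H
x6 = var (there (there (there (there (there (there here))))))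

x7 : Tm (A ∷ B ∷ C ∷ D ∷ E ∷ F ∷ H ∷ I ∷ Γ) I
x7 = var (there (there (there (there (there (there (there here)))))))

notE : Tm Γ bool → Tm Γ bool
notE c = if c ff tt

andE orE : Tm Γ bool → Tm Γ bool → Tm Γ bool
andE a b = if a b ff
orE a b = if a tt b

-- In the body of the following three, x0 is the list element and x1 must not
-- be used.
anyE allE : Tm Γ (list A) → Tm (A ∷ bool ∷ Γ) bool → Tm Γ bool
anyE l p = fold l ff (if p tt x1)
allE l p = fold l tt (if p x1 ff)

filterE : Tm Γ (list A) → Tm (A ∷ list A ∷ Γ) bool → Tm Γ (list A)
filterE l p = fold l nil (if p (cons x0 x1) x1)

opaque
  -- The subprograms are opaque, so that proofs about a larger program rest on their specifications
  -- and not on their unfolded code.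
  appendE : Tm (list A ∷ list A ∷ []) (list A)
  appendE = fold x0 x1 (cons x0 x1)

opaque
  unitsE : Tm (list A ∷ []) (list unit)
  unitsE = fold x0 nil (cons unit x1)

opaque
  -- The first list matters only by its length: each of its entries removes one entry of the second.
  -- Comparisons of lengths are derived from this.
  dropE : Tm (list A ∷ list B ∷ []) (list B)
  dropE = fold x0 x1 (uncons x1 nil x1)

opaque
  shorterE : Tm (list A ∷ list B ∷ []) bool
  shorterE = uncons (app dropE (x0 ∷ x1 ∷ [])) ff tt

opaque
  sameLengthE : Tm (list A ∷ list B ∷ []) bool
  sameLengthE = andE (notE (app shorterE (x0 ∷ x1 ∷ []))) (notE (app shorterE (x1 ∷ x0 ∷ [])))

Number : Ty
Number = list unit

opaque
  timesE : Tm (Number ∷ Number ∷ []) Number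
  timesE = fold x0 nil (app appendE (x3 ∷ x1 ∷ []))

opaque
  pow2E : Tm (Number ∷ []) Number
  pow2E = fold x0 (cons unit nil) (app appendE (x1 ∷ x1 ∷ []))

-- The cut-off g as a function of k; codesE bounds the size of the kernel.
opaque
  cutoffE : Tm (Number ∷ []) Number
  cutoffE = app timesE
    ( cons unit (app appendE (app appendE (x0 ∷ app pow2E (x0 ∷ []) ∷ []) ∷ app timesE (x0 ∷ x0 ∷ []) ∷ []))
    ∷ app pow2E (app pow2E (x0 ∷ []) ∷ []) ∷ [])

opaque
  codesE : Tm (Number ∷ []) Number
  codesE = app appendE
    ( x0
    ∷ app timesE (app pow2E (x0 ∷ []) ∷ app timesE (app pow2E (app pow2E (x0 ∷ []) ∷ []) ∷ cons unit (app cutoffE (x0 ∷ [])) ∷ []) ∷ [])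
    ∷ [])

Vertices : Ty
Vertices = list vtx

opaque
  eqE : Tm (vtx ∷ vtx ∷ []) bool
  eqE = andE (notE (lt x0 x1)) (notE (lt x1 x0))

opaque
  memberE : Tm (vtx ∷ Vertices ∷ []) bool
  memberE = anyE x1 (app eqE (x2 ∷ x0 ∷ []))

opaque
  nearE : Tm (gr ∷ vtx ∷ vtx ∷ []) bool
  nearE = orE (app eqE (x1 ∷ x2 ∷ [])) (adj x0 x1 x2)

opaque
  outsideNearE : Tm (gr ∷ Vertices ∷ vtx ∷ vtx ∷ []) bool
  outsideNearE = andE (notE (app memberE (x2 ∷ x1 ∷ []))) (app nearE (x0 ∷ x2 ∷ x3 ∷ []))

opaque
  sameMaskE : Tm (gr ∷ Vertices ∷ vtx ∷ vtx ∷ []) bool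
  sameMaskE = allE x1 (if (adj x2 x0 x4) (adj x2 x0 x5) (notE (adj x2 x0 x5)))

opaque
  firstE : Tm (gr ∷ Vertices ∷ vtx ∷ []) bool
  firstE = andE (notE (app memberE (x2 ∷ x1 ∷ [])))
    (notE (anyE (vtxs x0) (andE (app outsideNearE (x2 ∷ x3 ∷ x0 ∷ x4 ∷ []))
                                (andE (app sameMaskE (x2 ∷ x3 ∷ x0 ∷ x4 ∷ [])) (lt x0 x4)))))

opaque
  repE : Tm (gr ∷ Vertices ∷ vtx ∷ []) bool
  repE = andE (notE (app memberE (x2 ∷ x1 ∷ [])))
    (notE (anyE (vtxs x0) (andE (app outsideNearE (x2 ∷ x3 ∷ x0 ∷ x4 ∷ [])) (lt x0 x4))))

opaque
  hasClassE : Tm (gr ∷ Vertices ∷ vtx ∷ vtx ∷ []) bool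
  hasClassE = anyE (vtxs x0) (andE (app outsideNearE (x2 ∷ x3 ∷ x0 ∷ x4 ∷ [])) (app sameMaskE (x2 ∷ x3 ∷ x0 ∷ x5 ∷ [])))

opaque
  -- A type is never written down as a set of classes. Two cliques are compared by checking that
  -- each contains the classes of the other.
  coversE : Tm (gr ∷ Vertices ∷ vtx ∷ vtx ∷ []) bool
  coversE = notE (anyE (vtxs x0) (andE (app outsideNearE (x2 ∷ x3 ∷ x0 ∷ x4 ∷ []))
                                       (notE (app hasClassE (x2 ∷ x3 ∷ x5 ∷ x0 ∷ [])))))

opaque
  sameTypeE : Tm (gr ∷ Vertices ∷ vtx ∷ vtx ∷ []) bool
  sameTypeE = andE (app coversE (x0 ∷ x1 ∷ x2 ∷ x3 ∷ [])) (app coversE (x0 ∷ x1 ∷ x3 ∷ x2 ∷ []))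

opaque
  earlierE : Tm (gr ∷ Vertices ∷ vtx ∷ vtx ∷ []) bool
  earlierE = andE (app repE (x0 ∷ x1 ∷ x3 ∷ [])) (andE (app sameTypeE (x0 ∷ x1 ∷ x2 ∷ x3 ∷ []))
    (notE (anyE (vtxs x0) (andE (app outsideNearE (x2 ∷ x3 ∷ x0 ∷ x4 ∷ [])) (notE (lt x5 x0))))))

opaque
  beforeE : Tm (gr ∷ Vertices ∷ vtx ∷ []) Vertices
  beforeE = filterE (vtxs x0) (app earlierE (x2 ∷ x3 ∷ x4 ∷ x0 ∷ []))

opaque
  -- Compares two lengths cut off at that of the first argument: below the cut-off they must agree,
  -- otherwise both must reach it.
  sameLevelE : Tm (Number ∷ Vertices ∷ Vertices ∷ []) bool
  sameLevelE = if (app shorterE (x1 ∷ x0 ∷ [])) (app sameLengthE (x1 ∷ x2 ∷ [])) (notE (app shorterE (x2 ∷ x0 ∷ [])))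

opaque
  matchE : Tm (gr ∷ Vertices ∷ Number ∷ vtx ∷ vtx ∷ []) bool
  matchE = if (app memberE (x3 ∷ x1 ∷ [])) (app eqE (x3 ∷ x4 ∷ []))
    (andE (notE (app memberE (x4 ∷ x1 ∷ [])))
      (andE (app sameMaskE (x0 ∷ x1 ∷ x3 ∷ x4 ∷ []))
        (andE (app sameTypeE (x0 ∷ x1 ∷ x3 ∷ x4 ∷ []))
          (app sameLevelE (x2 ∷ app beforeE (x0 ∷ x1 ∷ x3 ∷ []) ∷ app beforeE (x0 ∷ x1 ∷ x4 ∷ []) ∷ [])))))

opaque
  inKernelE : Tm (gr ∷ Vertices ∷ Number ∷ vtx ∷ []) bool
  inKernelE = notE (anyE (vtxs x0) (andE (app matchE (x2 ∷ x3 ∷ x4 ∷ x0 ∷ x5 ∷ [])) (lt x0 x5)))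

opaque
  kernelE : Tm (gr ∷ Vertices ∷ Number ∷ []) Vertices
  kernelE = filterE (vtxs x0) (app inKernelE (x2 ∷ x3 ∷ x4 ∷ x0 ∷ []))

opaque
  retainedE : Tm (gr ∷ Vertices ∷ Number ∷ Vertices ∷ vtx ∷ []) bool
  retainedE = andE (orE (app memberE (x4 ∷ x1 ∷ [])) (app firstE (x0 ∷ x1 ∷ x4 ∷ [])))
    (anyE x3 (app matchE (x2 ∷ x3 ∷ x4 ∷ x0 ∷ x6 ∷ [])))

opaque
  survivorsE : Tm (gr ∷ Vertices ∷ Number ∷ Vertices ∷ []) Vertices
  survivorsE = filterE (vtxs x0) (app retainedE (x2 ∷ x3 ∷ x4 ∷ x5 ∷ x0 ∷ []))

opaque
  neighboursE : Tm (gr ∷ Vertices ∷ vtx ∷ []) Vertices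
  neighboursE = filterE x1 (adj x2 x4 x0)

opaque
  irregularE : Tm (gr ∷ Vertices ∷ []) bool
  irregularE = notE (anyE x1 (anyE x3 (andE (adj x4 x2 x0)
    (app sameLengthE (app neighboursE (x4 ∷ x5 ∷ x2 ∷ []) ∷ app neighboursE (x4 ∷ x5 ∷ x0 ∷ []) ∷ [])))))

opaque
  removedE : Tm (gr ∷ Vertices ∷ []) Vertices
  removedE = filterE (vtxs x0) (notE (app memberE (x0 ∷ x3 ∷ [])))

opaque
  improveE : Tm (Vertices ∷ Vertices ∷ []) Vertices
  improveE = if (app shorterE (x0 ∷ x1 ∷ [])) x0 x1

opaque
  candidateE : Tm (gr ∷ Vertices ∷ Vertices ∷ []) Vertices
  candidateE = if (app irregularE (x0 ∷ x1 ∷ [])) (app improveE (app removedE (x0 ∷ x1 ∷ []) ∷ x2 ∷ [])) x2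

opaque
  bestE : Tm (gr ∷ Vertices ∷ Number ∷ list Vertices ∷ []) Vertices
  -- Deleting all vertices is an irregulator, whence the initial value.
  bestE = fold x3 (vtxs x0) (app candidateE (x2 ∷ app survivorsE (x2 ∷ x3 ∷ x4 ∷ x0 ∷ []) ∷ x1 ∷ []))

opaque
  consAllE : Tm (A ∷ list (list A) ∷ []) (list (list A))
  consAllE = fold x1 nil (cons (cons x2 x0) x1)

opaque
  powersetE : Tm (list A ∷ []) (list (list A))
  powersetE = fold x0 (cons nil nil) (app appendE (app consAllE (x0 ∷ x1 ∷ []) ∷ x1 ∷ []))

opaque
  P₃E : Tm (gr ∷ Vertices ∷ vtx ∷ vtx ∷ vtx ∷ []) bool
  P₃E = andE (notE (app memberE (x2 ∷ x1 ∷ []))) (andE (notE (app memberE (x3 ∷ x1 ∷ []))) (andE (notE (app memberE (x4 ∷ x1 ∷ [])))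
    (andE (adj x0 x2 x3) (andE (adj x0 x3 x4) (notE (app nearE (x0 ∷ x2 ∷ x4 ∷ [])))))))

opaque
  -- The three branches for one induced path, or the empty list if there is none, so that it doubles
  -- as the test for a cluster deletion set. Each path found replaces the result for the previous
  -- one, which keeps the branching at three.
  expandE : Tm (gr ∷ Vertices ∷ []) (list Vertices)
  expandE = fold (vtxs x0) nil (fold (vtxs x2) x1 (fold (vtxs x4) x1
    (if (app P₃E (x6 ∷ x7 ∷ x4 ∷ x2 ∷ x0 ∷ [])) (cons (cons x4 x7) (cons (cons x2 x7) (cons (cons x0 x7) nil))) x1)))

opaque
  isClusterE : Tm (gr ∷ Vertices ∷ []) bool
  isClusterE = uncons (app expandE (x0 ∷ x1 ∷ [])) tt ff

opaque
  expandAllE : Tm (gr ∷ list Vertices ∷ []) (list Vertices)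
  expandAllE = fold x1 nil (app appendE (app expandE (x2 ∷ x0 ∷ []) ∷ x1 ∷ []))

opaque
  -- Expansion stops once some candidate leaves only cliques. Every expansion lengthens all
  -- candidates by one, so the first success occurs at the least possible length.
  stepE : Tm (gr ∷ list Vertices ∷ []) (list Vertices)
  stepE = if (anyE x1 (app isClusterE (x2 ∷ x0 ∷ []))) x1 (app expandAllE (x0 ∷ x1 ∷ []))

opaque
  -- As k is not part of the input, the step is iterated n times; after a success it changes
  -- nothing.
  searchE : Tm (gr ∷ []) (list Vertices)
  searchE = fold (vtxs x0) (cons nil nil) (app stepE (x2 ∷ x1 ∷ []))

opaque
  pickE : Tm (gr ∷ list Vertices ∷ []) Vertices
  pickE = fold x1 nil (if (app isClusterE (x2 ∷ x0 ∷ [])) x0 x1)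

opaque
  solveE : Tm (gr ∷ Vertices ∷ Number ∷ []) Number
  solveE = app unitsE (app bestE (x0 ∷ x1 ∷ x2 ∷ app powersetE (app kernelE (x0 ∷ x1 ∷ x2 ∷ []) ∷ []) ∷ []) ∷ [])

opaque
  solveWithE : Tm (gr ∷ Vertices ∷ []) Number
  solveWithE = app solveE (x0 ∷ x1 ∷ app cutoffE (app unitsE (x1 ∷ []) ∷ []) ∷ [])

opaque
  mainE : Tm (gr ∷ []) Number
  mainE = app solveWithE (x0 ∷ app pickE (x0 ∷ app searchE (x0 ∷ []) ∷ []) ∷ [])

opaque
  -- From here on, the terms compute the bound and not the solution: the function of k in the
  -- running time is shown to be computable by programming it in the same language.
  pow3E : Tm (Number ∷ []) Number
  pow3E = fold x0 (cons unit nil) (app appendE (x1 ∷ app appendE (x1 ∷ x1 ∷ []) ∷ []))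

opaque
  sizeE : Tm (Number ∷ []) Number
  sizeE = app appendE
    ( app pow2E (app codesE (x0 ∷ []) ∷ [])
    ∷ app appendE (app cutoffE (x0 ∷ []) ∷ app appendE (app pow3E (x0 ∷ []) ∷ cons unit (cons unit (cons unit nil)) ∷ []) ∷ []) ∷ [])

powerE : ℕ → Tm (Number ∷ []) Number
powerE zero    = cons unit nil
powerE (suc d) = app timesE (x0 ∷ app (powerE d) (x0 ∷ []) ∷ [])

literalE : ℕ → Tm Γ Number
literalE zero    = nil
literalE (suc c) = cons unit (literalE c)

boundE : ℕ → ℕ → Tm (Number ∷ []) Number
boundE c d = app timesE (literalE c ∷ app (powerE d) (cons unit (cons unit (app sizeE (x0 ∷ []))) ∷ []) ∷ [])

-- What the program computes

private
  variable
    b c : Bool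
    X : Set

R-map : (P → Q) → (Q → P) → Reflects P b → Reflects Q b
R-map f g (ofʸ p)  = ofʸ (f p)
R-map f g (ofⁿ ¬p) = ofⁿ (¬p ∘ g)

R-not : Reflects P b → Reflects (¬ P) (if b then false else true)
R-not (ofʸ p)  = ofⁿ (λ ¬p → ¬p p)
R-not (ofⁿ ¬p) = ofʸ ¬p

R-and : Reflects P b → Reflects Q c → Reflects (P × Q) (if b then c else false)
R-and (ofʸ p)  (ofʸ q)  = ofʸ (p , q)
R-and (ofʸ p)  (ofⁿ ¬q) = ofⁿ (¬q ∘ proj₂)
R-and (ofⁿ ¬p) _        = ofⁿ (¬p ∘ proj₁)

R-or : Reflects P b → Reflects Q c → Reflects (P ⊎ Q) (if b then true else c)
R-or (ofʸ p)  _        = ofʸ (inj₁ p)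
R-or (ofⁿ ¬p) (ofʸ q)  = ofʸ (inj₂ q)
R-or (ofⁿ ¬p) (ofⁿ ¬q) = ofⁿ [ ¬p , ¬q ]′

R-any : {P : X → Set} {p : X → Bool} (xs : List X) → (∀ x → Reflects (P x) (p x)) →
        Reflects (∃[ x ] (x ∈ˡ xs × P x)) (foldr (λ h r → if p h then true else r) false xs)
R-any []       R = ofⁿ λ ()
R-any (x ∷ xs) R = R-map
  [ (λ p → x , here refl , p) , (λ (y , y∈ , q) → y , there y∈ , q) ]′
  (λ { (_ , here refl , p) → inj₁ p ; (y , there y∈ , q) → inj₂ (y , y∈ , q) })
  (R-or (R x) (R-any xs R))

R-all : {P : X → Set} {p : X → Bool} (xs : List X) → (∀ x → Reflects (P x) (p x)) →
        Reflects (∀ x → x ∈ˡ xs → P x) (foldr (λ h r → if p h then r else false) true xs)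
R-all []       R = ofʸ λ _ ()
R-all (x ∷ xs) R = R-map
  (λ { (p , ps) _ (here refl) → p ; (p , ps) y (there y∈) → ps y y∈ })
  (λ f → f x (here refl) , λ y → f y ∘ there)
  (R-and (R x) (R-all xs R))

R-anyV : ∀ {n} {P : Fin n → Set} {p : Fin n → Bool} → (∀ x → Reflects (P x) (p x)) →
         Reflects (∃[ x ] P x) (foldr (λ h r → if p h then true else r) false (allFin n))
R-anyV {n} R = R-map (λ (x , _ , p) → x , p) (λ (x , p) → x , ∈-allFin x , p) (R-any (allFin n) R)

filterᵇ : (X → Bool) → List X → List X
filterᵇ p = foldr (λ h r → if p h then h ∷ r else r) []

module _ {P : X → Set} {p : X → Bool} (R : ∀ x → Reflects (P x) (p x)) where

  ∈-filterᵇ⁺ : ∀ {xs x} → x ∈ˡ xs → P x → x ∈ˡ filterᵇ p xs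
  ∈-filterᵇ⁺ {y ∷ xs} x∈ q with p y | R y
  ∈-filterᵇ⁺ {y ∷ xs} (here refl) q | true  | _      = here refl
  ∈-filterᵇ⁺ {y ∷ xs} (here refl) q | false | ofⁿ ¬q = contradiction q ¬q
  ∈-filterᵇ⁺ {y ∷ xs} (there x∈)  q | true  | _      = there (∈-filterᵇ⁺ x∈ q)
  ∈-filterᵇ⁺ {y ∷ xs} (there x∈)  q | false | _      = ∈-filterᵇ⁺ x∈ q

  ∈-filterᵇ⁻ : ∀ xs {x} → x ∈ˡ filterᵇ p xs → x ∈ˡ xs × P x
  ∈-filterᵇ⁻ (y ∷ xs) x∈ with p y | R y
  ∈-filterᵇ⁻ (y ∷ xs) (here refl) | true  | ofʸ q = here refl , q
  ∈-filterᵇ⁻ (y ∷ xs) (there x∈)  | true  | _     = let a , q = ∈-filterᵇ⁻ xs x∈ in there a , q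
  ∈-filterᵇ⁻ (y ∷ xs) x∈          | false | _     = let a , q = ∈-filterᵇ⁻ xs x∈ in there a , q

length-filterᵇ≤ : ∀ (p : X → Bool) xs → length (filterᵇ p xs) ≤ length xs
length-filterᵇ≤ p [] = z≤n
length-filterᵇ≤ p (x ∷ xs) with p x
... | true  = s≤s (length-filterᵇ≤ p xs)
... | false = ≤-trans (length-filterᵇ≤ p xs) (n≤1+n _)

length-filterᵇ : ∀ {n m} {P : Fin n → Set} {p : Fin n → Bool} (e : Fin m → Fin n) →
                 (∀ x → Reflects (P x) (p x)) → (P? : Decidable P) →
                 length (filterᵇ p (List.tabulate e)) ≡ sum (λ j → 𝟙 (P? (e j)))
length-filterᵇ {m = zero}  e R P? = refl
length-filterᵇ {m = suc m} {p = p} e R P? with p (e zero) | R (e zero) | P? (e zero)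
... | true  | _      | yes _ = cong suc (length-filterᵇ (e ∘ suc) R P?)
... | true  | ofʸ q  | no ¬q = contradiction q ¬q
... | false | ofⁿ ¬q | yes q = contradiction q ¬q
... | false | _      | no _  = length-filterᵇ (e ∘ suc) R P?

filterᵇ-filterᵇ : ∀ (p q : X → Bool) xs → filterᵇ q (filterᵇ p xs) ≡ filterᵇ (λ x → if p x then q x else false) xs
filterᵇ-filterᵇ p q [] = refl
filterᵇ-filterᵇ p q (x ∷ xs) with p x
... | false = filterᵇ-filterᵇ p q xs
... | true with q x
...   | true  = cong (x ∷_) (filterᵇ-filterᵇ p q xs)
...   | false = filterᵇ-filterᵇ p q xs

foldr-++ : ∀ (xs ys : List X) → foldr _∷_ ys xs ≡ xs ++ ys
foldr-++ []       ys = refl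
foldr-++ (x ∷ xs) ys = cong (x ∷_) (foldr-++ xs ys)

cutoff : ℕ → ℕ
cutoff k = (suc (k + 2 ^ k) + k * k) * 2 ^ (2 ^ k)

-- One code for each special vertex, and one for each combination of a class, a type and a level
-- between 0 and the cut-off.
codes : ℕ → ℕ
codes k = k + 2 ^ k * (2 ^ (2 ^ k) * suc (cutoff k))

module Specifications {n : ℕ} (G : Graph n) where

  open Semantics G

  append : List ⟦ A ⟧ₜ → List ⟦ A ⟧ₜ → List ⟦ A ⟧ₜ
  append {A} xs ys = ⟦ appendE {A} ⟧ (xs , ys , tt)

  opaque
    unfolding appendE

    append-++ : ∀ (xs ys : List ⟦ A ⟧ₜ) → append {A} xs ys ≡ xs ++ ys
    append-++ = foldr-++

  length-append : ∀ (xs ys : List ⟦ A ⟧ₜ) → length (append {A} xs ys) ≡ length xs + length ys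
  length-append {A} xs ys = trans (cong length (append-++ {A} xs ys)) (length-++ xs)

  opaque
    unfolding unitsE

    length-units : ∀ (xs : List ⟦ A ⟧ₜ) → length (⟦ unitsE {A} ⟧ (xs , tt)) ≡ length xs
    length-units []       = refl
    length-units {A} (x ∷ xs) = cong suc (length-units {A} xs)

  drop : List ⟦ A ⟧ₜ → List ⟦ B ⟧ₜ → List ⟦ B ⟧ₜ
  drop {A} {B} xs ys = ⟦ dropE {A} {B} ⟧ (xs , ys , tt)

  opaque
    unfolding dropE

    length-drop : ∀ (xs : List ⟦ A ⟧ₜ) (ys : List ⟦ B ⟧ₜ) → length (drop {A} {B} xs ys) ≡ length ys ∸ length xs
    length-drop [] ys = refl
    length-drop {A} {B} (x ∷ xs) ys with drop {A} {B} xs ys | length-drop {A} {B} xs ys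
    ... | []    | eq = trans (cong (_∸ 1) eq) (trans (∸-+-assoc (length ys) (length xs) 1) (cong (length ys ∸_) (+-comm (length xs) 1)))
    ... | _ ∷ _ | eq = trans (cong (_∸ 1) eq) (trans (∸-+-assoc (length ys) (length xs) 1) (cong (length ys ∸_) (+-comm (length xs) 1)))

  opaque
    unfolding shorterE

    shorter-spec : ∀ (xs : List ⟦ A ⟧ₜ) (ys : List ⟦ B ⟧ₜ) → Reflects (length xs < length ys) (⟦ shorterE {A} {B} ⟧ (xs , ys , tt))
    shorter-spec {A} {B} xs ys with drop {A} {B} xs ys | length-drop {A} {B} xs ys
    ... | []    | eq = ofⁿ (λ lt → <⇒≢ (m<n⇒0<n∸m lt) eq)
    ... | _ ∷ _ | eq = ofʸ (≰⇒> (λ le → 1+n≢0 (trans eq (m≤n⇒m∸n≡0 le))))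

  opaque
    unfolding sameLengthE

    sameLength-spec : ∀ (xs : List ⟦ A ⟧ₜ) (ys : List ⟦ B ⟧ₜ) → Reflects (length xs ≡ length ys) (⟦ sameLengthE {A} {B} ⟧ (xs , ys , tt))
    sameLength-spec {A} {B} xs ys = R-map
      (λ (a , b) → ≤-antisym (≮⇒≥ b) (≮⇒≥ a)) (λ eq → <-irrefl eq , <-irrefl (sym eq))
      (R-and (R-not (shorter-spec {A} {B} xs ys)) (R-not (shorter-spec {B} {A} ys xs)))

  infixl 7 _⊗_
  _⊗_ : List Unit → List Unit → List Unit
  xs ⊗ ys = ⟦ timesE ⟧ (xs , ys , tt)

  pow2 : List Unit → List Unit
  pow2 xs = ⟦ pow2E ⟧ (xs , tt)

  opaque
    unfolding timesE

    length-times : ∀ xs ys → length (xs ⊗ ys) ≡ length xs * length ys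
    length-times []       ys = refl
    length-times (x ∷ xs) ys = trans (length-append {unit} ys (xs ⊗ ys)) (cong (length ys +_) (length-times xs ys))

  opaque
    unfolding pow2E

    length-pow2 : ∀ xs → length (pow2 xs) ≡ 2 ^ length xs
    length-pow2 []       = refl
    length-pow2 (x ∷ xs) = trans (length-append {unit} (pow2 xs) (pow2 xs))
      (cong₂ _+_ (length-pow2 xs) (trans (length-pow2 xs) (sym (+-identityʳ (2 ^ length xs)))))

  length-pow2-pow2 : ∀ xs → length (pow2 (pow2 xs)) ≡ 2 ^ (2 ^ length xs)
  length-pow2-pow2 xs = trans (length-pow2 (pow2 xs)) (cong (2 ^_) (length-pow2 xs))

  opaque
    unfolding cutoffE

    length-cutoff : ∀ xs → length (⟦ cutoffE ⟧ (xs , tt)) ≡ cutoff (length xs)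
    length-cutoff xs = trans (length-times (tt ∷ append {unit} (append {unit} xs (pow2 xs)) (xs ⊗ xs)) (pow2 (pow2 xs)))
      (cong₂ _*_
        (cong suc (trans (length-append {unit} (append {unit} xs (pow2 xs)) (xs ⊗ xs))
          (cong₂ _+_ (trans (length-append {unit} xs (pow2 xs)) (cong (length xs +_) (length-pow2 xs))) (length-times xs xs))))
        (length-pow2-pow2 xs))

  opaque
    unfolding codesE

    length-codes : ∀ xs → length (⟦ codesE ⟧ (xs , tt)) ≡ codes (length xs)
    length-codes xs = trans (length-append {unit} xs (pow2 xs ⊗ rest)) (cong (length xs +_)
      (trans (length-times (pow2 xs) rest) (cong₂ _*_ (length-pow2 xs)
        (trans (length-times (pow2 (pow2 xs)) (tt ∷ ⟦ cutoffE ⟧ (xs , tt)))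
          (cong₂ _*_ (length-pow2-pow2 xs) (cong suc (length-cutoff xs)))))))
      where
      rest : List Unit
      rest = pow2 (pow2 xs) ⊗ (tt ∷ ⟦ cutoffE ⟧ (xs , tt))

  lt-spec : ∀ (u v : Fin n) → Reflects (u Fin.< v) (toℕ u <ᵇ toℕ v)
  lt-spec u v = <ᵇ-reflects-< (toℕ u) (toℕ v)

  opaque
    unfolding eqE

    eq-spec : ∀ (u v : Fin n) → Reflects (u ≡ v) (⟦ eqE ⟧ (u , v , tt))
    eq-spec u v = R-map
      (λ (a , b) → Finₚ.toℕ-injective (≤-antisym (≮⇒≥ b) (≮⇒≥ a))) (λ { refl → <-irrefl refl , <-irrefl refl })
      (R-and (R-not (lt-spec u v)) (R-not (lt-spec v u)))

  opaque
    unfolding memberE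

    member-spec : ∀ (v : Fin n) l → Reflects (v ∈ˡ l) (⟦ memberE ⟧ (v , l , tt))
    member-spec v l = R-map (λ { (_ , v∈ , refl) → v∈ }) (λ v∈ → v , v∈ , refl) (R-any l (eq-spec v))

  edge-spec : ∀ u v → Reflects (Edge G u v) (adjacent G u v)
  edge-spec u v with adjacent G u v
  ... | true  = ofʸ _
  ... | false = ofⁿ λ ()

  opaque
    unfolding consAllE

    ∈-consAll : ∀ {x : ⟦ A ⟧ₜ} {xs xss} → xs ∈ˡ xss → x ∷ xs ∈ˡ ⟦ consAllE {A} ⟧ (x , xss , tt)
    ∈-consAll (here refl) = here refl
    ∈-consAll {A} (there p) = there (∈-consAll {A} p)

  opaque
    unfolding consAllE

    length-consAll : ∀ x xss → length (⟦ consAllE {A} ⟧ (x , xss , tt)) ≡ length xss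
    length-consAll x []         = refl
    length-consAll {A} x (xs ∷ xss) = cong suc (length-consAll {A} x xss)

  opaque
    unfolding consAllE

    ∈-consAll⁻ : ∀ {x : ⟦ A ⟧ₜ} {ys} xss → ys ∈ˡ ⟦ consAllE {A} ⟧ (x , xss , tt) → ∃[ zs ] (zs ∈ˡ xss × ys ≡ x ∷ zs)
    ∈-consAll⁻ (xs ∷ xss) (here refl) = xs , here refl , refl
    ∈-consAll⁻ {A} (xs ∷ xss) (there p) = let zs , zs∈ , eq = ∈-consAll⁻ {A} xss p in zs , there zs∈ , eq

  powerset : List ⟦ A ⟧ₜ → List (List ⟦ A ⟧ₜ)
  powerset {A} xs = ⟦ powersetE {A} ⟧ (xs , tt)

  opaque
    unfolding powersetE

    -- The part of the kernel that encodes an optimal solution is obtained by filtering it, so this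
    -- is the completeness that the exhaustive search relies on.
    filterᵇ-∈-powerset : ∀ (p : ⟦ A ⟧ₜ → Bool) xs → filterᵇ p xs ∈ˡ powerset {A} xs
    filterᵇ-∈-powerset p [] = here refl
    filterᵇ-∈-powerset {A} p (x ∷ xs) with p x
    ... | true  = subst (x ∷ filterᵇ p xs ∈ˡ_) (sym (append-++ {list A} (⟦ consAllE {A} ⟧ (x , powerset {A} xs , tt)) (powerset {A} xs)))
                    (Anyₚ.++⁺ˡ (∈-consAll {A} (filterᵇ-∈-powerset {A} p xs)))
    ... | false = subst (filterᵇ p xs ∈ˡ_) (sym (append-++ {list A} (⟦ consAllE {A} ⟧ (x , powerset {A} xs , tt)) (powerset {A} xs)))
                    (Anyₚ.++⁺ʳ (⟦ consAllE {A} ⟧ (x , powerset {A} xs , tt)) (filterᵇ-∈-powerset {A} p xs))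

  opaque
    unfolding powersetE

    length-powerset : ∀ (xs : List ⟦ A ⟧ₜ) → length (powerset {A} xs) ≡ 2 ^ length xs
    length-powerset [] = refl
    length-powerset {A} (x ∷ xs) = trans (length-append {list A} (⟦ consAllE {A} ⟧ (x , powerset {A} xs , tt)) (powerset {A} xs))
      (cong₂ _+_ (trans (length-consAll {A} x (powerset {A} xs)) (length-powerset {A} xs)) (trans (length-powerset {A} xs) (sym (+-identityʳ _))))

  opaque
    unfolding powersetE

    ∈-powerset⇒length≤ : ∀ xs {ys} → ys ∈ˡ powerset {A} xs → length ys ≤ length xs
    ∈-powerset⇒length≤ [] (here refl) = z≤n
    ∈-powerset⇒length≤ {A} (x ∷ xs) {ys} ys∈ =
      [ (λ p → let _ , zs∈ , eq = ∈-consAll⁻ {A} (powerset {A} xs) p in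
               ≡-≤-trans (cong length eq) (s≤s (∈-powerset⇒length≤ {A} xs zs∈)))
      , (λ p → ≤-trans (∈-powerset⇒length≤ {A} xs p) (n≤1+n (length xs))) ]′
      (Anyₚ.++⁻ (⟦ consAllE {A} ⟧ (x , powerset {A} xs , tt))
        (subst (ys ∈ˡ_) (append-++ {list A} (⟦ consAllE {A} ⟧ (x , powerset {A} xs , tt)) (powerset {A} xs)) ys∈))

R-stable : Reflects P b → ¬ ¬ P → P
R-stable (ofʸ p)  _   = p
R-stable (ofⁿ ¬p) ¬¬p = contradiction ¬p ¬¬p

R-≡ : ∀ b c → Reflects (b ≡ c) (if b then c else (if c then false else true))
R-≡ true  true  = ofʸ refl
R-≡ true  false = ofⁿ λ ()
R-≡ false true  = ofⁿ λ ()
R-≡ false false = ofʸ refl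

R-if : ∀ {c′} → Reflects P b → (P → Reflects Q c) → (¬ P → Reflects Q c′) → Reflects Q (if b then c else c′)
R-if (ofʸ p)  f g = f p
R-if (ofⁿ ¬p) f g = g ¬p

_∈ˡ?_ : ∀ {n} (v : Fin n) l → Dec (v ∈ˡ l)
v ∈ˡ? l = Any.any? (v Finₚ.≟_) l

fromList : ∀ {n} → List (Fin n) → Subset n
fromList l = comprehension (_∈ˡ? l)

module _ {n : ℕ} (l : List (Fin n)) where

  ∈-fromList⁺ : ∀ {v} → v ∈ˡ l → v ∈ fromList l
  ∈-fromList⁺ = ∈-comprehension⁺ (_∈ˡ? l)

  ∈-fromList⁻ : ∀ {v} → v ∈ fromList l → v ∈ˡ l
  ∈-fromList⁻ = ∈-comprehension⁻ (_∈ˡ? l)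

  lookup-onto : ∀ {s} → s ∈ fromList l → ∃[ i ] lookup l i ≡ s
  lookup-onto s∈ = let p = ∈-fromList⁻ s∈ in Any.index p , sym (Anyₚ.lookup-index p)

module Programs {n : ℕ} (G : Graph n) (Sl : List (Fin n)) where

  open Semantics G
  open Specifications G

  S : Subset n
  S = fromList Sl

  special-spec : ∀ v → Reflects (v ∈ S) (⟦ memberE ⟧ (v , Sl , tt))
  special-spec v = R-map (∈-fromList⁺ Sl) (∈-fromList⁻ Sl) (member-spec v Sl)

  opaque
    unfolding nearE

    nearᵇ : ∀ u v → Reflects (u ≡ v ⊎ Edge G u v) (⟦ nearE ⟧ (tt , u , v , tt))
    nearᵇ u v = R-or (eq-spec u v) (edge-spec u v)

  IsP₃ : Fin n → Fin n → Fin n → Set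
  IsP₃ a b c = a ∉ S × b ∉ S × c ∉ S × Edge G a b × Edge G b c × ¬ (a ≡ c ⊎ Edge G a c)

  opaque
    unfolding P₃E

    P₃-spec : ∀ a b c → Reflects (IsP₃ a b c) (⟦ P₃E ⟧ (tt , Sl , a , b , c , tt))
    P₃-spec a b c =
      R-and (R-not (special-spec a)) (R-and (R-not (special-spec b)) (R-and (R-not (special-spec c))
        (R-and (edge-spec a b) (R-and (edge-spec b c) (R-not (nearᵇ a c))))))

  module _ (cluster : ∀ {a b c} → a ∉ S → b ∉ S → c ∉ S → Edge G a b → Edge G b c → a ≢ c → Edge G a c)
           (gl : List Unit) (length-gl : length gl ≡ cutoff (length Sl)) where

    open Cluster G S (lookup Sl) (lookup-onto Sl) cluster

    near-spec : ∀ u v → Reflects (u ≈ v) (⟦ nearE ⟧ (tt , u , v , tt))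
    near-spec = nearᵇ

    opaque
      unfolding outsideNearE

      outsideNear-spec : ∀ u v → Reflects (u ∉ S × u ≈ v) (⟦ outsideNearE ⟧ (tt , Sl , u , v , tt))
      outsideNear-spec u v = R-and (R-not (special-spec u)) (near-spec u v)

    opaque
      unfolding sameMaskE

      sameMask-spec : ∀ u v → Reflects (mask u ≡ mask v) (⟦ sameMaskE ⟧ (tt , Sl , u , v , tt))
      sameMask-spec u v = R-map
        (λ f → code-cong (λ i → f (lookup Sl i) (∈-lookup i)))
        (λ eq s s∈ → at (Any.index s∈) (Anyₚ.lookup-index s∈) eq)
        (R-all Sl (λ s → R-≡ (adjacent G s u) (adjacent G s v)))
        where
        at : ∀ {s} i → s ≡ lookup Sl i → mask u ≡ mask v → adjacent G s u ≡ adjacent G s v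
        at i refl eq = trans (sym (adjBit-mask i u)) (trans (cong (adjBit i) eq) (adjBit-mask i v))

    opaque
      unfolding firstE

      first-spec : ∀ v → Reflects (First v) (⟦ firstE ⟧ (tt , Sl , v , tt))
      first-spec v = R-and (R-not (special-spec v)) (R-not (R-map
        (λ (u , (u∉ , e) , m , l) → u , u∉ , e , m , l) (λ (u , u∉ , e , m , l) → u , (u∉ , e) , m , l)
        (R-anyV (λ u → R-and (outsideNear-spec u v) (R-and (sameMask-spec u v) (lt-spec u v))))))

    opaque
      unfolding repE

      rep-spec : ∀ v → Reflects (Rep v) (⟦ repE ⟧ (tt , Sl , v , tt))
      rep-spec v = R-and (R-not (special-spec v)) (R-not (R-map
        (λ (u , (u∉ , e) , l) → u , u∉ , e , l) (λ (u , u∉ , e , l) → u , (u∉ , e) , l)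
        (R-anyV (λ u → R-and (outsideNear-spec u v) (lt-spec u v)))))

    HasClass : Fin n → Fin n → Set
    HasClass v w = ∃[ x ] ((x ∉ S × x ≈ v) × mask x ≡ mask w)

    opaque
      unfolding hasClassE

      hasClass-spec : ∀ v w → Reflects (HasClass v w) (⟦ hasClassE ⟧ (tt , Sl , v , w , tt))
      hasClass-spec v w = R-anyV (λ x → R-and (outsideNear-spec x v) (sameMask-spec x w))

    opaque
      unfolding coversE

      covers-spec : ∀ u v → Reflects (¬ (∃[ w ] ((w ∉ S × w ≈ u) × ¬ HasClass v w))) (⟦ coversE ⟧ (tt , Sl , u , v , tt))
      covers-spec u v = R-not (R-anyV (λ w → R-and (outsideNear-spec w u) (R-not (hasClass-spec v w))))

    -- The test reports only that no class is left uncovered. A covering vertex can be extracted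
    -- from the double negation because a Boolean decides its existence.
    covers⇒Trace : ∀ {u v} → ¬ (∃[ w ] ((w ∉ S × w ≈ u) × ¬ HasClass v w)) →
                   ∀ A → ∃[ w ] Trace ⊤ u A w → ∃[ w ] Trace ⊤ v A w
    covers⇒Trace {u} {v} f A (w , (_ , w∉) , e , refl)
      with x , (x∉ , e′) , m ← R-stable (hasClass-spec v w) (λ ¬h → f (w , (w∉ , e) , ¬h)) =
      x , (∈⊤ , x∉) , e′ , m

    type≡⇒covers : ∀ {u v} → type u ≡ type v → ¬ (∃[ w ] ((w ∉ S × w ≈ u) × ¬ HasClass v w))
    type≡⇒covers {u} {v} eq (w , (w∉ , e) , ¬h) = absurd (∈-trace⁻ {⊤} {v} {mask w} (subst (mask w ∈ₒ_) eq (∈-trace⁺ {⊤} {u} {mask w} (w , (∈⊤ , w∉) , e , refl))))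
      where
      absurd : ∃[ x ] Trace ⊤ v (mask w) x → ⊥
      absurd (x , (_ , x∉) , e′ , m) = ¬h (x , (x∉ , e′) , m)

    opaque
      unfolding sameTypeE

      sameType-spec : ∀ u v → Reflects (type u ≡ type v) (⟦ sameTypeE ⟧ (tt , Sl , u , v , tt))
      sameType-spec u v = R-map
        (λ (f , g) → trace-cong {⊤} {⊤} {u} {v} (covers⇒Trace f) (covers⇒Trace g))
        (λ eq → type≡⇒covers eq , type≡⇒covers (sym eq))
        (R-and (covers-spec u v) (covers-spec v u))

    opaque
      unfolding earlierE

      earlier-spec : ∀ v r → Reflects (Earlier v r) (⟦ earlierE ⟧ (tt , Sl , v , r , tt))
      earlier-spec v r = R-and (rep-spec r) (R-and (sameType-spec v r) (R-not (R-map
        (λ (u , (u∉ , e) , l) → u , u∉ , e , l) (λ (u , u∉ , e , l) → u , (u∉ , e) , l)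
        (R-anyV (λ w → R-and (outsideNear-spec w v) (R-not (lt-spec r w)))))))

    before : Fin n → List (Fin n)
    before v = ⟦ beforeE ⟧ (tt , Sl , v , tt)

    opaque
      unfolding beforeE

      length-before : ∀ v → length (before v) ≡ index v
      length-before v = length-filterᵇ id (earlier-spec v) (Earlier? v)

    opaque
      unfolding sameLevelE

      sameLevel-spec : ∀ u v → Reflects (index u ⊓ g ≡ index v ⊓ g) (⟦ sameLevelE ⟧ (gl , before u , before v , tt))
      sameLevel-spec u v = subst₂ (λ a b → Reflects (a ⊓ g ≡ b ⊓ g) (⟦ sameLevelE ⟧ (gl , before u , before v , tt)))
        (length-before u) (length-before v)
        (subst (λ x → Reflects (length (before u) ⊓ x ≡ length (before v) ⊓ x) (⟦ sameLevelE ⟧ (gl , before u , before v , tt)))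
          length-gl (level (before u) (before v)))
        where
        capped : ∀ a b c → c ≤ a → (¬ b < c → a ⊓ c ≡ b ⊓ c) × (a ⊓ c ≡ b ⊓ c → ¬ b < c)
        capped a b c le =
          (λ ¬lt → trans (m≥n⇒m⊓n≡n le) (sym (m≥n⇒m⊓n≡n (≮⇒≥ ¬lt)))) ,
          (λ eq l → <⇒≱ l (m⊓n≡n⇒n≤m (trans (sym eq) (m≥n⇒m⊓n≡n le))))
        uncapped : ∀ a b c → a < c → a ⊓ c ≡ b ⊓ c → a ≡ b
        uncapped a b c l eq with ≤-total b c
        ... | inj₁ le = trans (sym (m≤n⇒m⊓n≡m (<⇒≤ l))) (trans eq (m≤n⇒m⊓n≡m le))
        ... | inj₂ ge = contradiction (trans (sym (m≤n⇒m⊓n≡m (<⇒≤ l))) (trans eq (m≥n⇒m⊓n≡n ge))) (<⇒≢ l)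
        level : ∀ xs ys → Reflects (length xs ⊓ length gl ≡ length ys ⊓ length gl) (⟦ sameLevelE ⟧ (gl , xs , ys , tt))
        level xs ys = R-if (shorter-spec {vtx} {unit} xs gl)
          (λ l → R-map (cong (_⊓ length gl)) (uncapped _ _ _ l) (sameLength-spec {vtx} {vtx} xs ys))
          (λ ¬lt → let f , h = capped (length xs) (length ys) (length gl) (≮⇒≥ ¬lt) in
                   R-map f h (R-not (shorter-spec {vtx} {unit} ys gl)))

    -- A table prescribes the same for matching vertices. Special vertices, of which tables do not
    -- speak, match only themselves.
    Match : Fin n → Fin n → Set
    Match x v = (x ∈ S × x ≡ v) ⊎ (x ∉ S × v ∉ S × mask x ≡ mask v × type x ≡ type v × index x ⊓ g ≡ index v ⊓ g)

    opaque
      unfolding matchE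

      match-spec : ∀ x v → Reflects (Match x v) (⟦ matchE ⟧ (tt , Sl , gl , x , v , tt))
      match-spec x v = R-if (special-spec x)
        (λ x∈ → R-map (λ eq → inj₁ (x∈ , eq)) [ proj₂ , (λ (x∉ , _) → contradiction x∈ x∉) ]′ (eq-spec x v))
        (λ x∉ → R-map (λ p → inj₂ (x∉ , p)) [ (λ (x∈ , _) → contradiction x∈ x∉) , proj₂ ]′
          (R-and (R-not (special-spec v)) (R-and (sameMask-spec x v) (R-and (sameType-spec x v) (sameLevel-spec x v)))))

    Match-refl : ∀ v → Match v v
    Match-refl v with v ∈? S
    ... | yes v∈ = inj₁ (v∈ , refl)
    ... | no v∉  = inj₂ (v∉ , v∉ , refl , refl , refl)

    Match-trans : ∀ {u v w} → Match u v → Match v w → Match u w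
    Match-trans (inj₁ (u∈ , refl)) m = m
    Match-trans (inj₂ p) (inj₁ (v∈ , refl)) = inj₂ p
    Match-trans (inj₂ (u∉ , v∉ , a , b , c)) (inj₂ (_ , w∉ , a′ , b′ , c′)) =
      inj₂ (u∉ , w∉ , trans a a′ , trans b b′ , trans c c′)

    InKernel : Fin n → Set
    InKernel v = ¬ (∃[ u ] (Match u v × u Fin.< v))

    opaque
      unfolding inKernelE

      inKernel-spec : ∀ v → Reflects (InKernel v) (⟦ inKernelE ⟧ (tt , Sl , gl , v , tt))
      inKernel-spec v = R-not (R-anyV (λ u → R-and (match-spec u v) (lt-spec u v)))

    kernel : List (Fin n)
    kernel = ⟦ kernelE ⟧ (tt , Sl , gl , tt)

    opaque
      unfolding kernelE

      kernel-filterᵇ : kernel ≡ filterᵇ (λ v → ⟦ inKernelE ⟧ (tt , Sl , gl , v , tt)) (allFin n)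
      kernel-filterᵇ = refl

    ∈-kernel : ∀ {v} → InKernel v → v ∈ˡ kernel
    ∈-kernel {v} p = subst (v ∈ˡ_) (sym kernel-filterᵇ) (∈-filterᵇ⁺ inKernel-spec (∈-allFin v) p)

    match? : ∀ x v → Dec (Match x v)
    match? x v = _ Relation.Nullary.because match-spec x v

    representative : ∀ v → ∃[ x ] (InKernel x × Match x v)
    representative v with x , m , min ← least (λ x → match? x v) (v , Match-refl v) =
      x , (λ (u , m′ , l) → min u (Match-trans m′ m) l) , m

    Retained : List (Fin n) → Fin n → Set
    Retained Xl v = (v ∈ S ⊎ First v) × ∃[ x ] (x ∈ˡ Xl × Match x v)

    opaque
      unfolding retainedE

      retained-spec : ∀ Xl v → Reflects (Retained Xl v) (⟦ retainedE ⟧ (tt , Sl , gl , Xl , v , tt))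
      retained-spec Xl v = R-and (R-or (special-spec v) (first-spec v)) (R-any Xl (λ x → match-spec x v))

    survivors : List (Fin n) → List (Fin n)
    survivors Xl = ⟦ survivorsE ⟧ (tt , Sl , gl , Xl , tt)

    opaque
      unfolding survivorsE

      survivors-filterᵇ : ∀ Xl → survivors Xl ≡ filterᵇ (λ v → ⟦ retainedE ⟧ (tt , Sl , gl , Xl , v , tt)) (allFin n)
      survivors-filterᵇ Xl = refl

    module _ (U : Subset n) (table : Fin o → ℕ → Fin o) where

      -- This is `Follows` without the demand to be first in the class, which makes it invariant
      -- under `Match` and readable from the representatives in the kernel; `Retained` reinstates
      -- the demand.
      Chosen : Fin n → Set
      Chosen x = (x ∈ S × x ∈ U) ⊎ (x ∉ S × mask x ∈ₒ table (type x) (index x ⊓ g))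

      Chosen? : Decidable Chosen
      Chosen? x = ((x ∈? S) ×-dec (x ∈? U)) ⊎-dec (¬? (x ∈? S) ×-dec T? (decode {q} (table (type x) (index x ⊓ g)) (mask x)))

      choice : List (Fin n)
      choice = filterᵇ (does ∘ Chosen?) kernel

      ∈-choice⁺ : ∀ {x} → InKernel x → Chosen x → x ∈ˡ choice
      ∈-choice⁺ p c = ∈-filterᵇ⁺ (λ x → Dec.proof (Chosen? x)) (∈-kernel p) c

      ∈-choice⁻ : ∀ {x} → x ∈ˡ choice → Chosen x
      ∈-choice⁻ x∈ = proj₂ (∈-filterᵇ⁻ (λ x → Dec.proof (Chosen? x)) kernel x∈)

      Chosen-Match : ∀ {x v} → Match x v → Chosen x → Chosen v
      Chosen-Match (inj₁ (_ , refl)) c = c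
      Chosen-Match (inj₂ (x∉ , _)) (inj₁ (x∈ , _)) = contradiction x∈ x∉
      Chosen-Match {x} {v} (inj₂ (_ , v∉ , m , t , i)) (inj₂ (_ , c)) =
        inj₂ (v∉ , subst₂ (λ A y → A ∈ₒ y) m (cong₂ table t i) c)

      Match-sym : ∀ {x v} → Match x v → Match v x
      Match-sym (inj₁ (x∈ , refl)) = inj₁ (x∈ , refl)
      Match-sym (inj₂ (x∉ , v∉ , m , t , i)) = inj₂ (v∉ , x∉ , sym m , sym t , sym i)

      Follows⇒Retained : ∀ {v} → Follows U table v → Retained choice v
      Follows⇒Retained {v} f = side f , represented (representative v)
        where
        side : Follows U table v → v ∈ S ⊎ First v
        side (inj₁ (v∈ , _)) = inj₁ v∈
        side (inj₂ (F , _))  = inj₂ F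
        chosen : Follows U table v → Chosen v
        chosen (inj₁ p)              = inj₁ p
        chosen (inj₂ ((v∉ , _) , m)) = inj₂ (v∉ , m)
        represented : ∃[ x ] (InKernel x × Match x v) → ∃[ x ] (x ∈ˡ choice × Match x v)
        represented (x , K , m) = x , ∈-choice⁺ K (Chosen-Match (Match-sym m) (chosen f)) , m

      Retained⇒Follows : ∀ {v} → Retained choice v → Follows U table v
      Retained⇒Follows {v} (side , x , x∈ , m) = follows side (Chosen-Match m (∈-choice⁻ x∈))
        where
        follows : v ∈ S ⊎ First v → Chosen v → Follows U table v
        follows _                (inj₁ p)        = inj₁ p
        follows (inj₁ v∈)        (inj₂ (v∉ , _)) = contradiction v∈ v∉
        follows (inj₂ F)         (inj₂ (_ , c))  = inj₂ (F , c)

-- Optimality of the exhaustive search over the kernel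

module _ {n : ℕ} (G : Graph n) where

  open Semantics G
  open Specifications G

  module Sublist {P : Fin n → Set} {p : Fin n → Bool} (R : ∀ v → Reflects (P v) (p v))
                 (Ul : List (Fin n)) (Ul≡ : Ul ≡ filterᵇ p (allFin n)) where

    private
      P? : Decidable P
      P? v = _ Relation.Nullary.because R v

    ∈-sublist⁺ : ∀ {v} → P v → v ∈ fromList Ul
    ∈-sublist⁺ {v} q = ∈-fromList⁺ Ul (subst (v ∈ˡ_) (sym Ul≡) (∈-filterᵇ⁺ R (∈-allFin v) q))

    ∈-sublist⁻ : ∀ {v} → v ∈ fromList Ul → P v
    ∈-sublist⁻ {v} v∈ = proj₂ (∈-filterᵇ⁻ R (allFin n) (subst (v ∈ˡ_) Ul≡ (∈-fromList⁻ Ul v∈)))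

    opaque
      unfolding neighboursE

      neighbours-degree : ∀ i → length (⟦ neighboursE ⟧ (tt , Ul , i , tt)) ≡ degree G (fromList Ul) i
      neighbours-degree i = begin
        length (filterᵇ (adjacent G i) Ul)
          ≡⟨ cong (length ∘ filterᵇ (adjacent G i)) Ul≡ ⟩
        length (filterᵇ (adjacent G i) (filterᵇ p (allFin n)))
          ≡⟨ cong length (filterᵇ-filterᵇ p (adjacent G i) (allFin n)) ⟩
        length (filterᵇ (λ v → if p v then adjacent G i v else false) (allFin n))
          ≡⟨ length-filterᵇ id (λ v → R-and (R v) (edge-spec i v)) (λ v → P? v ×-dec T? (adjacent G i v)) ⟩
        sum (λ v → 𝟙 (P? v ×-dec T? (adjacent G i v)))
          ≡⟨ sum-cong-≗ (λ v → 𝟙-cong (P? v ×-dec T? (adjacent G i v)) (T? (adjacent G i v) ×-dec (v ∈? fromList Ul))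
               (λ (q , e) → e , ∈-sublist⁺ q) (λ (e , v∈) → ∈-sublist⁻ v∈ , e)) ⟩
        sum (λ v → 𝟙 (T? (adjacent G i v) ×-dec (v ∈? fromList Ul)))
          ≡⟨ degree-sum G (fromList Ul) i ⟨
        degree G (fromList Ul) i ∎
        where open ≡-Reasoning

    Conflict : Set
    Conflict = ∃[ i ] (i ∈ˡ Ul × ∃[ j ] (j ∈ˡ Ul × Edge G i j ×
      length (⟦ neighboursE ⟧ (tt , Ul , i , tt)) ≡ length (⟦ neighboursE ⟧ (tt , Ul , j , tt))))

    opaque
      unfolding irregularE

      no-conflict-spec : Reflects (¬ Conflict) (⟦ irregularE ⟧ (tt , Ul , tt))
      no-conflict-spec = R-not (R-any Ul (λ i → R-any Ul (λ j → R-and (edge-spec i j)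
        (sameLength-spec {vtx} {vtx} (⟦ neighboursE ⟧ (tt , Ul , i , tt)) (⟦ neighboursE ⟧ (tt , Ul , j , tt))))))

    irregular-spec : Reflects (LocallyIrregular G (fromList Ul)) (⟦ irregularE ⟧ (tt , Ul , tt))
    irregular-spec = R-map {P = ¬ Conflict}
      (λ f i j i∈ j∈ e eq → f (i , ∈-fromList⁻ Ul i∈ , j , ∈-fromList⁻ Ul j∈ , e ,
        trans (neighbours-degree i) (trans eq (sym (neighbours-degree j)))))
      (λ f (i , i∈ , j , j∈ , e , eq) → f i j (∈-fromList⁺ Ul i∈) (∈-fromList⁺ Ul j∈) e
        (trans (sym (neighbours-degree i)) (trans eq (neighbours-degree j))))
      no-conflict-spec

  opaque
    unfolding removedE

    length-removed : ∀ Ul → length (⟦ removedE ⟧ (tt , Ul , tt)) ≡ ∣ ∁ (fromList Ul) ∣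
    length-removed Ul = begin
      length (⟦ removedE ⟧ (tt , Ul , tt))
        ≡⟨ length-filterᵇ id (λ v → R-not (member-spec v Ul)) (λ v → ¬? (v ∈ˡ? Ul)) ⟩
      sum (λ v → 𝟙 (¬? (v ∈ˡ? Ul)))
        ≡⟨ sum-cong-≗ (λ v → 𝟙-cong (¬? (v ∈ˡ? Ul)) (v ∈? ∁ (fromList Ul))
             (λ v∉ → x∉p⇒x∈∁p (v∉ ∘ ∈-fromList⁻ Ul)) (λ v∈ → x∈∁p⇒x∉p v∈ ∘ ∈-fromList⁺ Ul)) ⟩
      sum (λ v → 𝟙 (v ∈? ∁ (fromList Ul)))
        ≡⟨ card (∁ (fromList Ul)) ⟨
      ∣ ∁ (fromList Ul) ∣ ∎
      where open ≡-Reasoning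

  irregular-cong : ∀ {U U′} → (∀ {v} → v ∈ U → v ∈ U′) → (∀ {v} → v ∈ U′ → v ∈ U) → LocallyIrregular G U → LocallyIrregular G U′
  irregular-cong {U} {U′} f h irr i j i∈ j∈ e eq = irr i j (h i∈) (h j∈) e (trans (same i) (trans eq (sym (same j))))
    where
    same : ∀ i → degree G U i ≡ degree G U′ i
    same i = trans (degree-sum G U i) (trans
      (sum-cong-≗ (λ v → 𝟙-cong (T? (adjacent G i v) ×-dec (v ∈? U)) (T? (adjacent G i v) ×-dec (v ∈? U′))
        (λ (e , v∈) → e , f v∈) (λ (e , v∈) → e , h v∈)))
      (sym (degree-sum G U′ i)))

  IrregulatorOfSize : ℕ → Set
  IrregulatorOfSize m = ∃[ I ] (IsVertexIrregulator G I × ∣ I ∣ ≡ m)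

  ∁∁ : ∀ (U : Subset n) {v} → (v ∈ U → v ∈ ∁ (∁ U)) × (v ∈ ∁ (∁ U) → v ∈ U)
  ∁∁ U {v} = (λ v∈ → x∉p⇒x∈∁p (λ v∈∁ → x∈∁p⇒x∉p v∈∁ v∈)) , back
    where
    back : v ∈ ∁ (∁ U) → v ∈ U
    back v∈ with v ∈? U
    ... | yes p = p
    ... | no ¬p = contradiction (x∉p⇒x∈∁p ¬p) (x∈∁p⇒x∉p v∈)

  opaque
    unfolding improveE

    improve-spec : ∀ (xs ys : List (Fin n)) → let zs = ⟦ improveE ⟧ (xs , ys , tt) in
                   (zs ≡ xs ⊎ zs ≡ ys) × length zs ≤ length xs × length zs ≤ length ys
    improve-spec xs ys with ⟦ shorterE {vtx} {vtx} ⟧ (xs , ys , tt) | shorter-spec {vtx} {vtx} xs ys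
    ... | true  | ofʸ shorter = inj₁ refl , ≤-refl , <⇒≤ shorter
    ... | false | ofⁿ longer  = inj₂ refl , ≮⇒≥ longer , ≤-refl

  -- The invariant of the optimisation. Of the list `r′` only the length is claimed to be that of an
  -- irregulator; the list serves as a number.
  Improves : List (Fin n) → List (Fin n) → List (Fin n) → Set
  Improves Ul r r′ = IrregulatorOfSize (length r′) × length r′ ≤ length r ×
    (LocallyIrregular G (fromList Ul) → length r′ ≤ ∣ ∁ (fromList Ul) ∣)

  opaque
    unfolding candidateE

    candidate-spec : ∀ Ul r → Reflects (LocallyIrregular G (fromList Ul)) (⟦ irregularE ⟧ (tt , Ul , tt)) →
      IrregulatorOfSize (length r) → Improves Ul r (⟦ candidateE ⟧ (tt , Ul , r , tt))
    candidate-spec Ul r R I = by-irregular (⟦ irregularE ⟧ (tt , Ul , tt)) R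
      where
      rem better : List (Fin n)
      rem    = ⟦ removedE ⟧ (tt , Ul , tt)
      better = ⟦ improveE ⟧ (rem , r , tt)
      by-irregular : ∀ b → Reflects (LocallyIrregular G (fromList Ul)) b → Improves Ul r (if b then better else r)
      by-irregular false (ofⁿ ¬irr) = I , ≤-refl , λ irr → contradiction irr ¬irr
      by-irregular true (ofʸ irr) = from (improve-spec rem r)
        where
        witness : better ≡ rem ⊎ better ≡ r → IrregulatorOfSize (length better)
        witness (inj₁ eq) = ∁ (fromList Ul) , irregular-cong (proj₁ (∁∁ _)) (proj₂ (∁∁ _)) irr , sym (trans (cong length eq) (length-removed Ul))
        witness (inj₂ eq) = subst (IrregulatorOfSize ∘ length) (sym eq) I
        from : (better ≡ rem ⊎ better ≡ r) × length better ≤ length rem × length better ≤ length r → Improves Ul r better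
        from (e , le , le′) = witness e , le′ , λ _ → ≤-trans le (≤-reflexive (length-removed Ul))

  module Best (Sl : List (Fin n)) (gl : List Unit)
    (R : ∀ X → Reflects (LocallyIrregular G (fromList (⟦ survivorsE ⟧ (tt , Sl , gl , X , tt))))
                        (⟦ irregularE ⟧ (tt , ⟦ survivorsE ⟧ (tt , Sl , gl , X , tt) , tt))) where

    best : List (List (Fin n)) → List (Fin n)
    best Xs = ⟦ bestE ⟧ (tt , Sl , gl , Xs , tt)

    opaque
      unfolding bestE

      best-[] : best [] ≡ allFin n
      best-[] = refl

      best-∷ : ∀ X Xs → best (X ∷ Xs) ≡ ⟦ candidateE ⟧ (tt , ⟦ survivorsE ⟧ (tt , Sl , gl , X , tt) , best Xs , tt)
      best-∷ X Xs = refl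

    improves : ∀ X Xs → IrregulatorOfSize (length (best Xs)) → Improves (⟦ survivorsE ⟧ (tt , Sl , gl , X , tt)) (best Xs) (best (X ∷ Xs))
    improves X Xs I = subst (Improves Ul (best Xs)) (sym (best-∷ X Xs)) (candidate-spec Ul (best Xs) (R X) I)
      where
      Ul : List (Fin n)
      Ul = ⟦ survivorsE ⟧ (tt , Sl , gl , X , tt)

    best-irregulator : ∀ Xs → IrregulatorOfSize (length (best Xs))
    best-irregulator [] = ⊤ , (λ i j i∈ → contradiction ∈⊤ (x∈∁p⇒x∉p i∈)) ,
      trans (∣⊤∣≡n n) (sym (trans (cong length best-[]) (length-tabulate id)))
    best-irregulator (X ∷ Xs) = proj₁ (improves X Xs (best-irregulator Xs))

    best-minimal : ∀ {Xs X} → X ∈ˡ Xs → let Ul = ⟦ survivorsE ⟧ (tt , Sl , gl , X , tt) in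
                   LocallyIrregular G (fromList Ul) → length (best Xs) ≤ ∣ ∁ (fromList Ul) ∣
    best-minimal {X ∷ Xs} (here refl) irr = proj₂ (proj₂ (improves X Xs (best-irregulator Xs))) irr
    best-minimal {X ∷ Xs} (there X∈) irr = ≤-trans (proj₁ (proj₂ (improves X Xs (best-irregulator Xs)))) (best-minimal X∈ irr)

  module _ (Sl : List (Fin n))
    (cluster : ∀ {a b c} → a ∉ fromList Sl → b ∉ fromList Sl → c ∉ fromList Sl → Edge G a b → Edge G b c → a ≢ c → Edge G a c)
    (gl : List Unit) (length-gl : length gl ≡ cutoff (length Sl)) where

    open Programs G Sl

    private
      ker : List (Fin n)
      ker = kernel cluster gl length-gl
      module Survivors X = Sublist (retained-spec cluster gl length-gl X) (survivors cluster gl length-gl X) (survivors-filterᵇ cluster gl length-gl X)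

    open Best Sl gl (λ X → Survivors.irregular-spec X)

    -- The complement of any irregulator can be traded for a tabulated set that is no smaller, and
    -- this set is what the corresponding subset of the kernel lets survive. Its complement is thus
    -- among the sets compared.
    solve-correct : IsIᵥ G (length (best (powerset {vtx} ker)))
    solve-correct = best-irregulator (powerset {vtx} ker) , minimal
      where
      open Cluster G S (lookup Sl) (lookup-onto Sl) cluster using (o; Follows; Follows?; tabulated)
      minimal : ∀ I → IsVertexIrregulator G I → length (best (powerset {vtx} ker)) ≤ ∣ I ∣
      minimal I irr = from-table (tabulated irr)
        where
        U : Subset n
        U = ∁ I
        from-table : Σ[ table ∈ (Fin o → ℕ → Fin o) ]
          (LocallyIrregular G (comprehension (Follows? U table)) × ∣ U ∣ ≤ ∣ comprehension (Follows? U table) ∣) →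
          length (best (powerset {vtx} ker)) ≤ ∣ I ∣
        from-table (table , irr′ , le) = begin
          length (best (powerset {vtx} ker))
            ≤⟨ best-minimal (filterᵇ-∈-powerset {vtx} (does ∘ Chosen? cluster gl length-gl U table) ker)
                 (irregular-cong to from irr′) ⟩
          ∣ ∁ (fromList W) ∣            ≡⟨ ∣∁p∣≡n∸∣p∣ (fromList W) ⟩
          n ∸ ∣ fromList W ∣            ≤⟨ ∸-monoʳ-≤ n (≤-trans le (≡-≤-trans (card U′) (≤-trans (sum-mono (λ v → 𝟙-mono (v ∈? U′) (v ∈? fromList W) to)) (≤-reflexive (sym (card (fromList W))))))) ⟩
          n ∸ ∣ ∁ I ∣                   ≡⟨ ∣∁p∣≡n∸∣p∣ (∁ I) ⟨
          ∣ ∁ (∁ I) ∣                   ≡⟨ trans (card (∁ (∁ I))) (trans (sum-cong-≗ (λ v → 𝟙-cong (v ∈? ∁ (∁ I)) (v ∈? I) (proj₂ (∁∁ I)) (proj₁ (∁∁ I)))) (sym (card I))) ⟩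
          ∣ I ∣                         ∎
          where
          open ≤-Reasoning
          Xl W : List (Fin n)
          Xl = choice cluster gl length-gl U table
          W = survivors cluster gl length-gl Xl
          U′ : Subset n
          U′ = comprehension (Follows? U table)
          to : ∀ {v} → v ∈ U′ → v ∈ fromList W
          to v∈ = Survivors.∈-sublist⁺ Xl (Follows⇒Retained cluster gl length-gl U table (∈-comprehension⁻ (Follows? U table) v∈))
          from : ∀ {v} → v ∈ fromList W → v ∈ U′
          from v∈ = ∈-comprehension⁺ (Follows? U table) (Retained⇒Follows cluster gl length-gl U table (Survivors.∈-sublist⁻ Xl v∈))

    -- A kernel vertex is the least among those matching it, so distinct kernel vertices do not
    -- match. Numbering by position in `Sl`, or by class, type and level, is therefore injective on
    -- the kernel.
    length-kernel : length ker ≤ codes (length Sl)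
    length-kernel = ≤-trans
      (≤-reflexive (trans (cong length (kernel-filterᵇ cluster gl length-gl)) (length-filterᵇ id (inKernel-spec cluster gl length-gl) (λ v → _ Relation.Nullary.because inKernel-spec cluster gl length-gl v))))
      (sum-injective (λ v → _ Relation.Nullary.because inKernel-spec cluster gl length-gl v) number injective)
      where
      open Cluster G S (lookup Sl) (lookup-onto Sl) cluster using (q; o; g; mask; type; index)
      level : Fin n → Fin (suc g)
      level v = fromℕ< (s≤s (m⊓n≤n (index v) g))
      class : Fin n → Fin (q * (o * suc g))
      class v = combine (mask v) (combine (type v) (level v))
      numberBy : ∀ v → Dec (v ∈ S) → Fin (length Sl + q * (o * suc g))
      numberBy v (yes v∈) = proj₁ (lookup-onto Sl v∈) ↑ˡ (q * (o * suc g))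
      numberBy v (no _)   = length Sl ↑ʳ class v
      number : Fin n → Fin (codes (length Sl))
      number v = numberBy v (v ∈? S)
      class-Match : ∀ {u v} → u ∉ S → v ∉ S → class u ≡ class v → Match cluster gl length-gl u v
      class-Match {u} {v} u∉ v∉ eq =
        let m , rest = Finₚ.combine-injective (mask u) (combine (type u) (level u)) (mask v) (combine (type v) (level v)) eq
            t , l = Finₚ.combine-injective (type u) (level u) (type v) (level v) rest
        in inj₂ (u∉ , v∉ , m , t , trans (sym (Finₚ.toℕ-fromℕ< _)) (trans (cong toℕ l) (Finₚ.toℕ-fromℕ< _)))
      same-number : ∀ u v (d : Dec (u ∈ S)) (e : Dec (v ∈ S)) → numberBy u d ≡ numberBy v e → Match cluster gl length-gl u v
      same-number u v (yes u∈) (yes v∈) eq =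
        inj₁ (u∈ , trans (sym (proj₂ (lookup-onto Sl u∈)))
          (trans (cong (lookup Sl) (Finₚ.↑ˡ-injective (q * (o * suc g)) _ _ eq)) (proj₂ (lookup-onto Sl v∈))))
      same-number u v (no u∉) (no v∉) eq = class-Match u∉ v∉ (Finₚ.↑ʳ-injective (length Sl) (class u) (class v) eq)
      same-number u v (yes u∈) (no v∉) eq = contradiction
        (trans (sym (Finₚ.splitAt-↑ˡ (length Sl) (proj₁ (lookup-onto Sl u∈)) (q * (o * suc g)))) (trans (cong (splitAt (length Sl)) eq) (Finₚ.splitAt-↑ʳ (length Sl) (q * (o * suc g)) (class v)))) λ ()
      same-number u v (no u∉) (yes v∈) eq = contradiction
        (trans (sym (Finₚ.splitAt-↑ʳ (length Sl) (q * (o * suc g)) (class u))) (trans (cong (splitAt (length Sl)) eq) (Finₚ.splitAt-↑ˡ (length Sl) (proj₁ (lookup-onto Sl v∈)) (q * (o * suc g))))) λ ()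
      injective : ∀ u v → InKernel cluster gl length-gl u → InKernel cluster gl length-gl v → number u ≡ number v → u ≡ v
      injective u v Ku Kv eq with Finₚ.<-cmp u v
      ... | tri< u<v _ _ = contradiction (u , same-number u v (u ∈? S) (v ∈? S) eq , u<v) Kv
      ... | tri≈ _ p _   = p
      ... | tri> _ _ v<u = contradiction (v , same-number v u (v ∈? S) (u ∈? S) (sym eq) , v<u) Ku

-- The search for a minimum cluster deletion set

foldr-preserves : ∀ {X Y : Set} (I : Y → Set) {h : X → Y → Y} {z} xs → I z → (∀ x {r} → I r → I (h x r)) → I (foldr h z xs)
foldr-preserves I []       p step = p
foldr-preserves I (x ∷ xs) p step = step x (foldr-preserves I xs p step)

-- The property is established when `x` is processed, whatever the accumulator is, and kept from
-- then on.
foldr-attains : ∀ {X Y : Set} (I : Y → Set) {h : X → Y → Y} {z} {x} xs → x ∈ˡ xs →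
                (∀ r → I (h x r)) → (∀ x {r} → I r → I (h x r)) → I (foldr h z xs)
foldr-attains I (x ∷ xs) (here refl) start step = start _
foldr-attains I (x ∷ xs) (there x∈)  start step = step x (foldr-attains I xs x∈ start step)

module Search {n : ℕ} (G : Graph n) where

  open Semantics G
  open Specifications G
  open module Prog Sl = Programs G Sl using (IsP₃; P₃-spec)

  expand : List (Fin n) → List (List (Fin n))
  expand Sl = ⟦ expandE ⟧ (tt , Sl , tt)

  Expansion : List (Fin n) → List (List (Fin n)) → Set
  Expansion Sl r = r ≡ [] ⊎ ∃[ a ] ∃[ b ] ∃[ c ] (IsP₃ Sl a b c × r ≡ (a ∷ Sl) ∷ (b ∷ Sl) ∷ (c ∷ Sl) ∷ [])

  NonEmpty : ∀ {X : Set} → List X → Set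
  NonEmpty xs = xs ≢ []

  scan : List (Fin n) → Fin n → Fin n → Fin n → List (List (Fin n)) → List (List (Fin n))
  scan Sl a b c r = if ⟦ P₃E ⟧ (tt , Sl , a , b , c , tt) then (a ∷ Sl) ∷ (b ∷ Sl) ∷ (c ∷ Sl) ∷ [] else r

  scan-Expansion : ∀ Sl a b c {r} → Expansion Sl r → Expansion Sl (scan Sl a b c r)
  scan-Expansion Sl a b c {r} e = go _ (P₃-spec Sl a b c)
    where
    go : ∀ d → Reflects (IsP₃ Sl a b c) d → Expansion Sl (if d then (a ∷ Sl) ∷ (b ∷ Sl) ∷ (c ∷ Sl) ∷ [] else r)
    go true  (ofʸ p) = inj₂ (a , b , c , p , refl)
    go false _       = e

  scan-NonEmpty : ∀ Sl a b c {r} → NonEmpty r → NonEmpty (scan Sl a b c r)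
  scan-NonEmpty Sl a b c {r} e with ⟦ P₃E ⟧ (tt , Sl , a , b , c , tt)
  ... | true  = λ ()
  ... | false = e

  scan-P₃ : ∀ Sl a b c → IsP₃ Sl a b c → ∀ r → NonEmpty (scan Sl a b c r)
  scan-P₃ Sl a b c p r with ⟦ P₃E ⟧ (tt , Sl , a , b , c , tt) | P₃-spec Sl a b c
  ... | true  | _      = λ ()
  ... | false | ofⁿ ¬p = contradiction p ¬p

  opaque
    unfolding expandE

    expand-scan : ∀ Sl → expand Sl ≡ foldr (λ a r → foldr (λ b r → foldr (λ c r → scan Sl a b c r) r (allFin n)) r (allFin n)) [] (allFin n)
    expand-scan Sl = refl

  expand-Expansion : ∀ Sl → Expansion Sl (expand Sl)
  expand-Expansion Sl = subst (Expansion Sl) (sym (expand-scan Sl))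
    (foldr-preserves (Expansion Sl) (allFin n) (inj₁ refl) λ a e →
      foldr-preserves (Expansion Sl) (allFin n) e λ b e →
        foldr-preserves (Expansion Sl) (allFin n) e λ c → scan-Expansion Sl a b c)

  expand-P₃ : ∀ Sl {a b c} → IsP₃ Sl a b c → NonEmpty (expand Sl)
  expand-P₃ Sl {a} {b} {c} p = subst NonEmpty (sym (expand-scan Sl))
    (foldr-attains NonEmpty (allFin n) (∈-allFin a)
      (λ r → foldr-attains NonEmpty (allFin n) (∈-allFin b)
        (λ r → foldr-attains NonEmpty (allFin n) (∈-allFin c) (scan-P₃ Sl a b c p) (λ c → scan-NonEmpty Sl a b c))
        (λ b → keep a b))
      (λ a e → foldr-preserves NonEmpty (allFin n) e (λ b → keep a b)))
    where
    keep : ∀ a b {r} → NonEmpty r → NonEmpty (foldr (λ c r → scan Sl a b c r) r (allFin n))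
    keep a b e = foldr-preserves NonEmpty (allFin n) e (λ c → scan-NonEmpty Sl a b c)

  P₃-Free : List (Fin n) → Set
  P₃-Free Sl = ∀ a b c → ¬ IsP₃ Sl a b c

  opaque
    unfolding isClusterE

    isCluster-spec : ∀ Sl → Reflects (P₃-Free Sl) (⟦ isClusterE ⟧ (tt , Sl , tt))
    isCluster-spec Sl = go (expand Sl) (expand-Expansion Sl) (λ p → expand-P₃ Sl p)
      where
      go : ∀ r → Expansion Sl r → (∀ {a b c} → IsP₃ Sl a b c → NonEmpty r) → Reflects (P₃-Free Sl) (unconsₛ r true (λ _ _ → false))
      go []      _                          ne = ofʸ (λ a b c p → ne p refl)
      go (x ∷ r) (inj₂ (a , b , c , p , _)) ne = ofⁿ (λ free → free a b c p)

  length-expand≤3 : ∀ Sl → length (expand Sl) ≤ 3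
  length-expand≤3 Sl with expand-Expansion Sl
  ... | inj₁ eq                      = ≡-≤-trans (cong length eq) z≤n
  ... | inj₂ (_ , _ , _ , _ , eq)    = ≤-reflexive (cong length eq)

  ∈-expand : ∀ {Sl X} → X ∈ˡ expand Sl → length X ≡ suc (length Sl)
  ∈-expand {Sl} {X} X∈ with expand-Expansion Sl
  ... | inj₁ eq = contradiction (subst (X ∈ˡ_) eq X∈) λ ()
  ... | inj₂ (a , b , c , p , eq) with subst (X ∈ˡ_) eq X∈
  ...   | here refl                 = refl
  ...   | there (here refl)         = refl
  ...   | there (there (here refl)) = refl

  expandAll : List (List (Fin n)) → List (List (Fin n))
  expandAll st = ⟦ expandAllE ⟧ (tt , st , tt)

  opaque
    unfolding expandAllE

    expandAll-∷ : ∀ Sl st → expandAll (Sl ∷ st) ≡ append {Vertices} (expand Sl) (expandAll st)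
    expandAll-∷ Sl st = refl

    expandAll-[] : expandAll [] ≡ []
    expandAll-[] = refl

  expandAll-++ : ∀ Sl st → expandAll (Sl ∷ st) ≡ expand Sl ++ expandAll st
  expandAll-++ Sl st = trans (expandAll-∷ Sl st) (append-++ {Vertices} (expand Sl) (expandAll st))

  length-expandAll : ∀ st → length (expandAll st) ≤ 3 * length st
  length-expandAll []        = ≤-reflexive (cong length expandAll-[])
  length-expandAll (Sl ∷ st) = begin
    length (expandAll (Sl ∷ st))                  ≡⟨ trans (cong length (expandAll-++ Sl st)) (length-++ (expand Sl)) ⟩
    length (expand Sl) + length (expandAll st)    ≤⟨ +-mono-≤ (length-expand≤3 Sl) (length-expandAll st) ⟩
    3 + 3 * length st                             ≡⟨ *-suc 3 (length st) ⟨
    3 * suc (length st)                           ∎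
    where open ≤-Reasoning

  ∈-expandAll⁺ : ∀ {st Sl X} → Sl ∈ˡ st → X ∈ˡ expand Sl → X ∈ˡ expandAll st
  ∈-expandAll⁺ {Sl′ ∷ st} {X = X} (here refl) X∈ = subst (X ∈ˡ_) (sym (expandAll-++ Sl′ st)) (Anyₚ.++⁺ˡ X∈)
  ∈-expandAll⁺ {Sl′ ∷ st} {X = X} (there Sl∈) X∈ = subst (X ∈ˡ_) (sym (expandAll-++ Sl′ st)) (Anyₚ.++⁺ʳ (expand Sl′) (∈-expandAll⁺ Sl∈ X∈))

  ∈-expandAll⁻ : ∀ st {X} → X ∈ˡ expandAll st → ∃[ Sl ] (Sl ∈ˡ st × X ∈ˡ expand Sl)
  ∈-expandAll⁻ [] {X} X∈ = contradiction (subst (X ∈ˡ_) expandAll-[] X∈) λ ()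
  ∈-expandAll⁻ (Sl ∷ st) {X} X∈ with Anyₚ.++⁻ (expand Sl) (subst (X ∈ˡ_) (expandAll-++ Sl st) X∈)
  ... | inj₁ p = Sl , here refl , p
  ... | inj₂ p = let Sl′ , Sl∈ , q = ∈-expandAll⁻ st p in Sl′ , there Sl∈ , q

  Solved : List (List (Fin n)) → Set
  Solved st = ∃[ X ] (X ∈ˡ st × P₃-Free X)

  solved-spec : ∀ st → Reflects (Solved st) (foldr (λ X r → if ⟦ isClusterE ⟧ (tt , X , tt) then true else r) false st)
  solved-spec st = R-any st isCluster-spec

  step : List (List (Fin n)) → List (List (Fin n))
  step st = ⟦ stepE ⟧ (tt , st , tt)

  opaque
    unfolding stepE

    step-cases : ∀ st → (Solved st × step st ≡ st) ⊎ (¬ Solved st × step st ≡ expandAll st)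
    step-cases st = go _ (solved-spec st)
      where
      go : ∀ b → Reflects (Solved st) b → let r = if b then st else expandAll st in (Solved st × r ≡ st) ⊎ (¬ Solved st × r ≡ expandAll st)
      go true  (ofʸ p)  = inj₁ (p , refl)
      go false (ofⁿ ¬p) = inj₂ (¬p , refl)

  pick : List (List (Fin n)) → List (Fin n)
  pick st = ⟦ pickE ⟧ (tt , st , tt)

  opaque
    unfolding pickE

    pick-solved : ∀ st → Solved st → pick st ∈ˡ st × P₃-Free (pick st)
    pick-solved (X ∷ st) (Y , Y∈ , free) with ⟦ isClusterE ⟧ (tt , X , tt) | isCluster-spec X
    ... | true | ofʸ p = here refl , p
    pick-solved (X ∷ st) (Y , here refl , free) | false | ofⁿ ¬p = contradiction free ¬p
    pick-solved (X ∷ st) (Y , there Y∈ , free)  | false | ofⁿ ¬p =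
      let a , b = pick-solved st (Y , Y∈ , free) in there a , b

  states : List (Fin n) → List (List (Fin n))
  states = foldr (λ _ → step) ([] ∷ [])

  opaque
    unfolding searchE

    search-states : ⟦ searchE ⟧ (tt , tt) ≡ states (allFin n)
    search-states = refl

  P₃-Free⇒cluster : ∀ {Sl} → P₃-Free Sl → ∀ {a b c} → a ∉ fromList Sl → b ∉ fromList Sl → c ∉ fromList Sl →
                    Edge G a b → Edge G b c → a ≢ c → Edge G a c
  P₃-Free⇒cluster free {a} {b} {c} a∉ b∉ c∉ d e a≢c with T? (adjacent G a c)
  ... | yes p = p
  ... | no ¬p = contradiction (a∉ , b∉ , c∉ , d , e , [ a≢c , ¬p ]′) (free a b c)

  P₃-Free⇒deletion : ∀ {Sl} → P₃-Free Sl → IsClusterDeletionSet G (fromList Sl)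
  P₃-Free⇒deletion {Sl} free i i∈ u v iu iv u≢v = edge (≈-trans (proj₁ (reach iu)) i∉ (proj₁ (reach iv)) (≈-sym (proj₂ (reach iu))) (proj₂ (reach iv)))
    where
    open Cluster G (fromList Sl) (lookup Sl) (lookup-onto Sl) (P₃-Free⇒cluster {Sl} free)
    i∉ = x∈∁p⇒x∉p i∈
    path : ∀ {i j} → i ∉ fromList Sl → Star (InducedEdge G (∁ (fromList Sl))) i j → j ∉ fromList Sl × i ≈ j
    path i∉ done = i∉ , inj₁ refl
    path i∉ ((_ , k∈ , e) ◅ p) = let j∉ , e′ = path (x∈∁p⇒x∉p k∈) p in j∉ , ≈-trans i∉ (x∈∁p⇒x∉p k∈) j∉ (inj₂ e) e′
    reach : ∀ {j} → component G (∁ (fromList Sl)) i j → j ∉ fromList Sl × i ≈ j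
    reach = path i∉
    edge : u ≈ v → Edge G u v
    edge (inj₁ eq) = contradiction eq u≢v
    edge (inj₂ e)  = e

  ∣fromList∣≤length : ∀ (Sl : List (Fin n)) → ∣ fromList Sl ∣ ≤ length Sl
  ∣fromList∣≤length Sl = ≡-≤-trans (card (fromList Sl)) (sum-onto (_∈? fromList Sl) (lookup Sl) (lookup-onto Sl))

  module _ {k : ℕ} {D : Subset n} (deletion : IsClusterDeletionSet G D) (∣D∣ : ∣ D ∣ ≡ k) where

    D-cluster : ∀ {a b c} → a ∉ D → b ∉ D → c ∉ D → Edge G a b → Edge G b c → a ≢ c → Edge G a c
    D-cluster {a} {b} {c} a∉ b∉ c∉ d e a≢c =
      deletion a (x∉p⇒x∈∁p a∉) a c done ((x∉p⇒x∈∁p a∉ , x∉p⇒x∈∁p b∉ , d) ◅ (x∉p⇒x∈∁p b∉ , x∉p⇒x∈∁p c∉ , e) ◅ done) a≢c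

    -- The potential of the search: how much of `D` a candidate still lacks.
    missing : List (Fin n) → ℕ
    missing X = sum (λ v → 𝟙 ((v ∈? D) ×-dec ¬? (v ∈ˡ? X)))

    missing-∷ : ∀ {X v} → v ∈ D → ¬ v ∈ˡ X → suc (missing (v ∷ X)) ≤ missing X
    missing-∷ {X} {v} v∈ v∉ = begin
      suc (missing (v ∷ X))
        ≡⟨ cong (_+ missing (v ∷ X)) (sum-unique (v Finₚ.≟_) (yes (v , refl)) (λ i j p q → trans (sym p) q)) ⟨
      sum (λ u → 𝟙 (v Finₚ.≟ u)) + missing (v ∷ X)
        ≡⟨ ∑-distrib-+ (λ u → 𝟙 (v Finₚ.≟ u)) (λ u → 𝟙 ((u ∈? D) ×-dec ¬? (u ∈ˡ? (v ∷ X)))) ⟨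
      sum (λ u → 𝟙 (v Finₚ.≟ u) + 𝟙 ((u ∈? D) ×-dec ¬? (u ∈ˡ? (v ∷ X))))
        ≤⟨ sum-mono term ⟩
      missing X ∎
      where
      open ≤-Reasoning
      term : ∀ u → 𝟙 (v Finₚ.≟ u) + 𝟙 ((u ∈? D) ×-dec ¬? (u ∈ˡ? (v ∷ X))) ≤ 𝟙 ((u ∈? D) ×-dec ¬? (u ∈ˡ? X))
      term u with v Finₚ.≟ u
      ... | yes refl = ≤-reflexive (trans (cong suc (𝟙-no ((v ∈? D) ×-dec ¬? (v ∈ˡ? (v ∷ X))) (λ (_ , f) → f (here refl))))
                                          (sym (𝟙-yes ((v ∈? D) ×-dec ¬? (v ∈ˡ? X)) (v∈ , v∉))))
      ... | no _ = 𝟙-mono ((u ∈? D) ×-dec ¬? (u ∈ˡ? (v ∷ X))) ((u ∈? D) ×-dec ¬? (u ∈ˡ? X)) (λ (a , f) → a , f ∘ there)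

    -- A deletion set meets every induced path with three vertices, so one of the three branches
    -- adds a vertex of `D`.
    progress : ∀ X → ¬ P₃-Free X → ∃[ Y ] (Y ∈ˡ expand X × suc (missing Y) ≤ missing X)
    progress X ¬free with expand-Expansion X
    ... | inj₁ eq = contradiction (λ a b c p → expand-P₃ X p eq) ¬free
    ... | inj₂ (a , b , c , (a∉ , b∉ , c∉ , d , e , ne) , eq) = hit (a ∈? D) (b ∈? D) (c ∈? D)
      where
      via : ∀ {v} → v ∈ D → v ∉ fromList X → (v ∷ X) ∈ˡ ((a ∷ X) ∷ (b ∷ X) ∷ (c ∷ X) ∷ []) → ∃[ Y ] (Y ∈ˡ expand X × suc (missing Y) ≤ missing X)
      via {v} v∈ v∉ p = v ∷ X , subst (v ∷ X ∈ˡ_) (sym eq) p , missing-∷ v∈ (v∉ ∘ ∈-fromList⁺ X)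
      hit : Dec (a ∈ D) → Dec (b ∈ D) → Dec (c ∈ D) → ∃[ Y ] (Y ∈ˡ expand X × suc (missing Y) ≤ missing X)
      hit (yes a∈) _ _ = via a∈ a∉ (here refl)
      hit (no _) (yes b∈) _ = via b∈ b∉ (there (here refl))
      hit (no _) (no _) (yes c∈) = via c∈ c∉ (there (there (here refl)))
      hit (no a∉D) (no b∉D) (no c∉D) = contradiction (inj₂ (D-cluster a∉D b∉D c∉D d e (ne ∘ inj₁))) ne

    -- Here `i` counts all iterations and `depth` those that expanded. A candidate that gains a
    -- vertex of `D` at each expansion keeps `on-track` true; this bounds `depth` by k and makes
    -- `width` a bound in terms of k.
    record SearchLevel (i : ℕ) (st : List (List (Fin n))) : Set where
      constructor level
      field
        depth     : ℕ
        width     : length st ≤ 3 ^ depth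
        small     : ∀ {X} → X ∈ˡ st → length X ≤ depth
        on-track  : ∃[ X ] (X ∈ˡ st × depth + missing X ≤ k)
        active    : Solved st ⊎ depth ≡ i

    depth≤k : ∀ {i st} (l : SearchLevel i st) → SearchLevel.depth l ≤ k
    depth≤k l = ≤-trans (m≤m+n _ _) (proj₂ (proj₂ (SearchLevel.on-track l)))

    step-level : ∀ {i st} → SearchLevel i st → SearchLevel (suc i) (step st)
    step-level {i} {st} l@(level j w s (X , X∈ , le) active) = cases (step-cases st)
      where
      expanded : ¬ Solved st → Solved st ⊎ j ≡ i → SearchLevel (suc i) (expandAll st)
      expanded ¬solved (inj₁ p) = contradiction p ¬solved
      expanded ¬solved (inj₂ eq) = level (suc j)
        (≤-trans (length-expandAll st) (*-monoʳ-≤ 3 w))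
        (λ {Y} Y∈ → let Z , Z∈ , Y∈Z = ∈-expandAll⁻ st Y∈ in ≡-≤-trans (∈-expand Y∈Z) (s≤s (s Z∈)))
        (let Y , Y∈ , prog = progress X (λ free → ¬solved (X , X∈ , free)) in
         Y , ∈-expandAll⁺ X∈ Y∈ , ≡-≤-trans (sym (+-suc j (missing Y))) (≤-trans (+-monoʳ-≤ j prog) le))
        (inj₂ (cong suc eq))
      cases : (Solved st × step st ≡ st) ⊎ (¬ Solved st × step st ≡ expandAll st) → SearchLevel (suc i) (step st)
      cases (inj₁ (p , eq))  = subst (SearchLevel (suc i)) (sym eq) (level j w s (X , X∈ , le) (inj₁ p))
      cases (inj₂ (¬p , eq)) = subst (SearchLevel (suc i)) (sym eq) (expanded ¬p active)

    states-level : ∀ t → SearchLevel (length t) (states t)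
    states-level [] = level 0 ≤-refl (λ { (here refl) → z≤n }) ([] , here refl ,
      ≤-trans (sum-mono (λ v → 𝟙-mono ((v ∈? D) ×-dec ¬? (v ∈ˡ? [])) (v ∈? D) proj₁)) (≤-reflexive (trans (sym (card D)) ∣D∣))) (inj₂ refl)
    states-level (_ ∷ t) = step-level (states-level t)

    -- Without success after n iterations the depth would be n, and the candidate on track would
    -- still lack a vertex of `D`. Then n + 1 would be at most k, whereas `D` has at most n
    -- vertices.
    states-solved : Solved (states (allFin n))
    states-solved = by (states-level (allFin n)) (solved-spec (states (allFin n)))
      where
      by : ∀ {b} → SearchLevel (length (allFin n)) (states (allFin n)) → Reflects (Solved (states (allFin n))) b → Solved (states (allFin n))
      by l (ofʸ p) = p
      by (level j w s _ (inj₁ p)) (ofⁿ _) = p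
      by (level j w s (X , X∈ , le) (inj₂ eq)) (ofⁿ ¬p) =
        let _ , _ , prog = progress X (λ free → ¬p (X , X∈ , free)) in
        contradiction
          (≡-≤-trans (cong suc (trans (sym (length-tabulate {n = n} id)) (sym eq)))
            (≤-trans (≡-≤-trans (+-comm 1 j) (+-monoʳ-≤ j (≤-trans (s≤s z≤n) prog))) (≤-trans le (≡-≤-trans (sym ∣D∣) (∣p∣≤n D)))))
          (n≮n n)

    found : List (Fin n)
    found = pick (states (allFin n))

    found-P₃-Free : P₃-Free found
    found-P₃-Free = proj₂ (pick-solved _ states-solved)

    -- The depth bounds the length by k from above. From below, the list is itself a deletion set,
    -- and a set has at most as many elements as a list of it has entries.
    length-found : (∀ S → IsClusterDeletionSet G S → k ≤ ∣ S ∣) → length found ≡ k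
    length-found minimal = ≤-antisym
      (≤-trans (SearchLevel.small (states-level (allFin n)) (proj₁ (pick-solved _ states-solved))) (depth≤k (states-level (allFin n))))
      (≤-trans (minimal (fromList found) (P₃-Free⇒deletion {found} found-P₃-Free)) (∣fromList∣≤length found))

-- The running time of the program

m≤2^m : ∀ m → m ≤ 2 ^ m
m≤2^m zero    = z≤n
m≤2^m (suc m) = +-mono-≤ (m^n>0 2 m) (≤-trans (m≤2^m m) (≤-reflexive (sym (+-identityʳ (2 ^ m)))))

module Bounds {n : ℕ} (G : Graph n) (M : ℕ) (n≤M : n ≤ M) where

  open Semantics G
  open Bounded M n≤M
  open Specifications G

  -- A wrapper of `Bnd`, which reduces along the term; through it the term can be recovered from the
  -- type of a proof.
  record Ok (e : Tm Γ A) (ρ : Env Γ) : Set where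
    constructor ok
    field
      bnd : Bnd e ρ
  open Ok public

  ok-if : {c : Tm Γ bool} {a b : Tm Γ A} {ρ : Env Γ} → Ok c ρ → (⟦ c ⟧ ρ ≡ true → Ok a ρ) → (⟦ c ⟧ ρ ≡ false → Ok b ρ) → Ok (if c a b) ρ
  ok-if (ok x) f g = ok (x , bnd ∘ f , bnd ∘ g)

  ok-not : {c : Tm Γ bool} {ρ : Env Γ} → Ok c ρ → Ok (notE c) ρ
  ok-not x = ok-if x (λ _ → ok _) (λ _ → ok _)

  ok-and : {a b : Tm Γ bool} {ρ : Env Γ} → Ok a ρ → Ok b ρ → Ok (andE a b) ρ
  ok-and x y = ok-if x (λ _ → y) (λ _ → ok _)

  ok-or : {a b : Tm Γ bool} {ρ : Env Γ} → Ok a ρ → Ok b ρ → Ok (orE a b) ρ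
  ok-or x y = ok-if x (λ _ → ok _) (λ _ → y)

  ok-cons : {a : Tm Γ A} {l : Tm Γ (list A)} {ρ : Env Γ} → Ok a ρ → Ok l ρ → Ok (cons a l) ρ
  ok-cons (ok x) (ok y) = ok (x , y)

  ok-uncons : {l : Tm Γ (list A)} {z : Tm Γ B} {s : Tm (A ∷ list A ∷ Γ) B} {ρ : Env Γ} →
              Ok l ρ → Ok z ρ → (∀ h t → Ok s (h , t , ρ)) → Ok (uncons l z s) ρ
  ok-uncons (ok x) (ok y) g = ok (x , y , λ h t _ → bnd (g h t))

  ok-fold : {l : Tm Γ (list A)} {z : Tm Γ B} {s : Tm (A ∷ B ∷ Γ) B} {ρ : Env Γ} →
            Ok l ρ → length (⟦ l ⟧ ρ) ≤ M → Ok z ρ →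
            (∀ h t → h ∈ˡ ⟦ l ⟧ ρ → length t ≤ length (⟦ l ⟧ ρ) →
              Ok s (h , foldr (λ h r → ⟦ s ⟧ (h , r , ρ)) (⟦ z ⟧ ρ) t , ρ)) →
            Ok (fold l z s) ρ
  ok-fold {l = l} {ρ = ρ} (ok x) len (ok y) g = ok (x , len , y , λ pre h t eq →
    bnd (g h t (subst (h ∈ˡ_) (sym eq) (∈-insert pre))
      (≤-trans (≤-trans (n≤1+n (length t)) (m≤n+m _ (length pre))) (≤-reflexive (sym (trans (cong length eq) (length-++ pre)))))))

  ok-any : {l : Tm Γ (list A)} {p : Tm (A ∷ bool ∷ Γ) bool} {ρ : Env Γ} → Ok l ρ → length (⟦ l ⟧ ρ) ≤ M →
           (∀ h r → h ∈ˡ ⟦ l ⟧ ρ → Ok p (h , r , ρ)) → Ok (anyE l p) ρ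
  ok-any x len g = ok-fold x len (ok _) (λ h t h∈ _ → ok-if (g h _ h∈) (λ _ → ok _) (λ _ → ok _))

  ok-all : {l : Tm Γ (list A)} {p : Tm (A ∷ bool ∷ Γ) bool} {ρ : Env Γ} → Ok l ρ → length (⟦ l ⟧ ρ) ≤ M →
           (∀ h r → h ∈ˡ ⟦ l ⟧ ρ → Ok p (h , r , ρ)) → Ok (allE l p) ρ
  ok-all x len g = ok-fold x len (ok _) (λ h t h∈ _ → ok-if (g h _ h∈) (λ _ → ok _) (λ _ → ok _))

  ok-filter : {l : Tm Γ (list A)} {p : Tm (A ∷ list A ∷ Γ) bool} {ρ : Env Γ} → Ok l ρ → length (⟦ l ⟧ ρ) ≤ M →
              (∀ h r → h ∈ˡ ⟦ l ⟧ ρ → Ok p (h , r , ρ)) → Ok (filterE l p) ρ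
  ok-filter x len g = ok-fold x len (ok _) (λ h t h∈ _ → ok-if (g h _ h∈) (λ _ → ok _) (λ _ → ok _))

  record Oks (es : Args Γ Δ) (ρ : Env Γ) : Set where
    constructor oks
    field
      bnds : Bnds es ρ

  infixr 5 _▸_
  _▸_ : {e : Tm Γ A} {es : Args Γ Δ} {ρ : Env Γ} → Ok e ρ → Oks es ρ → Oks (e ∷ es) ρ
  ok x ▸ oks y = oks (x , y)

  ok-app : {f : Tm Δ A} {es : Args Γ Δ} {ρ : Env Γ} → Oks es ρ → Ok f (⟦ es ⟧ₐ ρ) → Ok (app f es) ρ
  ok-app (oks x) (ok y) = ok (x , y)

  V≤M : length (allFin n) ≤ M
  V≤M = ≡-≤-trans (length-tabulate {n = n} id) n≤M

  opaque
    unfolding appendE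

    append-ok : ∀ (xs ys : List ⟦ A ⟧ₜ) → length xs ≤ M → Ok (appendE {A}) (xs , ys , tt)
    append-ok xs ys le = ok-fold (ok _) le (ok _) (λ _ _ _ _ → ok _)

  opaque
    unfolding unitsE

    units-ok : ∀ (xs : List ⟦ A ⟧ₜ) → length xs ≤ M → Ok (unitsE {A}) (xs , tt)
    units-ok xs le = ok-fold (ok _) le (ok _) (λ _ _ _ _ → ok _)

  opaque
    unfolding dropE

    drop-ok : ∀ (xs : List ⟦ A ⟧ₜ) (ys : List ⟦ B ⟧ₜ) → length xs ≤ M → Ok (dropE {A} {B}) (xs , ys , tt)
    drop-ok xs ys le = ok-fold (ok _) le (ok _) (λ _ _ _ _ → ok-uncons (ok _) (ok _) (λ _ _ → ok _))

  opaque
    unfolding shorterE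

    shorter-ok : ∀ (xs : List ⟦ A ⟧ₜ) (ys : List ⟦ B ⟧ₜ) → length xs ≤ M → Ok (shorterE {A} {B}) (xs , ys , tt)
    shorter-ok {A} {B} xs ys le = ok-uncons (ok-app _ (drop-ok {A} {B} xs ys le)) (ok _) (λ _ _ → ok _)

  opaque
    unfolding sameLengthE

    sameLength-ok : ∀ (xs : List ⟦ A ⟧ₜ) (ys : List ⟦ B ⟧ₜ) → length xs ≤ M → length ys ≤ M → Ok (sameLengthE {A} {B}) (xs , ys , tt)
    sameLength-ok {A} {B} xs ys le le′ = ok-and (ok-not (ok-app _ (shorter-ok {A} {B} xs ys le))) (ok-not (ok-app _ (shorter-ok {B} {A} ys xs le′)))

  opaque
    unfolding timesE

    times-ok : ∀ xs ys → length xs ≤ M → length ys ≤ M → Ok timesE (xs , ys , tt)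
    times-ok xs ys le le′ = ok-fold (ok _) le (ok _) (λ _ _ _ _ → ok-app _ (append-ok {unit} ys _ le′))

  opaque
    unfolding pow2E

    pow2-ok : ∀ xs → 2 ^ length xs ≤ M → Ok pow2E (xs , tt)
    pow2-ok xs le = ok-fold (ok _) (≤-trans (m≤2^m (length xs)) le) (ok _)
      (λ _ t _ t≤ → ok-app _ (append-ok {unit} (pow2 t) (pow2 t) (≡-≤-trans (length-pow2 t) (≤-trans (^-monoʳ-≤ 2 t≤) le))))

  pow3 : List Unit → List Unit
  pow3 xs = ⟦ pow3E ⟧ (xs , tt)

  opaque
    unfolding pow3E

    length-pow3 : ∀ xs → length (pow3 xs) ≡ 3 ^ length xs
    length-pow3 []       = refl
    length-pow3 (x ∷ xs) = trans (length-append {unit} (pow3 xs) (append {unit} (pow3 xs) (pow3 xs)))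
      (cong₂ _+_ (length-pow3 xs) (trans (length-append {unit} (pow3 xs) (pow3 xs))
        (cong₂ _+_ (length-pow3 xs) (trans (length-pow3 xs) (sym (+-identityʳ (3 ^ length xs)))))))

    pow3-ok : ∀ xs → 3 ^ length xs ≤ M → length xs ≤ M → Ok pow3E (xs , tt)
    pow3-ok xs le le′ = ok-fold (ok _) le′ (ok _)
      (λ _ t _ t≤ → let r≤ = ≡-≤-trans (length-pow3 t) (≤-trans (^-monoʳ-≤ 3 t≤) le) in
        ok-app (ok _ ▸ ok-app _ (append-ok {unit} (pow3 t) (pow3 t) r≤) ▸ _) (append-ok {unit} (pow3 t) (append {unit} (pow3 t) (pow3 t)) r≤))

  module _ (xs : List Unit) (codes≤ : 2 ^ codes (length xs) ≤ M) (cutoff≤ : cutoff (length xs) ≤ M) where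

    private
      k = length xs

      codes≤M : codes k ≤ M
      codes≤M = ≤-trans (m≤2^m (codes k)) codes≤

      k≤codes : k ≤ codes k
      k≤codes = m≤m+n k _

      q≤codes : 2 ^ k ≤ codes k
      q≤codes = ≤-trans (m≤m*n (2 ^ k) (2 ^ (2 ^ k) * suc (cutoff k)) {{m*n≢0 (2 ^ (2 ^ k)) (suc (cutoff k)) {{m^n≢0 2 (2 ^ k)}}}}) (m≤n+m _ k)

      rest≤codes : 2 ^ (2 ^ k) * suc (cutoff k) ≤ codes k
      rest≤codes = ≤-trans (m≤n*m _ (2 ^ k) {{m^n≢0 2 k}}) (m≤n+m _ k)

      k≤M : k ≤ M
      k≤M = ≤-trans k≤codes codes≤M

      q≤M : 2 ^ k ≤ M
      q≤M = ≤-trans q≤codes codes≤M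

      o≤M : 2 ^ (2 ^ k) ≤ M
      o≤M = ≤-trans (^-monoʳ-≤ 2 q≤codes) codes≤

      pow2-pow2-ok : Ok pow2E (pow2 xs , tt)
      pow2-pow2-ok = pow2-ok (pow2 xs) (≡-≤-trans (cong (2 ^_) (length-pow2 xs)) o≤M)

      summand : List Unit
      summand = append {unit} (append {unit} xs (pow2 xs)) (xs ⊗ xs)

      summand≤M : suc (length summand) ≤ M
      summand≤M = ≡-≤-trans (cong suc (trans (length-append {unit} (append {unit} xs (pow2 xs)) (xs ⊗ xs))
          (cong₂ _+_ (trans (length-append {unit} xs (pow2 xs)) (cong (k +_) (length-pow2 xs))) (length-times xs xs))))
        (≤-trans (m≤m*n (suc (k + 2 ^ k) + k * k) (2 ^ (2 ^ k)) {{m^n≢0 2 (2 ^ k)}}) cutoff≤)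

      k+q≤M : length (append {unit} xs (pow2 xs)) ≤ M
      k+q≤M = ≤-trans (≤-trans (≤-trans (m≤m+n _ (length (xs ⊗ xs))) (≤-reflexive (sym (length-append {unit} (append {unit} xs (pow2 xs)) (xs ⊗ xs)))))
        (n≤1+n (length summand))) summand≤M

    opaque
      unfolding cutoffE

      cutoff-ok : Ok cutoffE (xs , tt)
      cutoff-ok = ok-app
        ( ok-cons (ok _) (ok-app (ok-app (ok _ ▸ ok-app _ (pow2-ok xs q≤M) ▸ _) (append-ok {unit} xs (pow2 xs) k≤M)
                                  ▸ ok-app _ (times-ok xs xs k≤M k≤M) ▸ _)
                    (append-ok {unit} (append {unit} xs (pow2 xs)) (xs ⊗ xs) k+q≤M))
        ▸ ok-app (ok-app _ (pow2-ok xs q≤M) ▸ _) pow2-pow2-ok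
        ▸ _)
        (times-ok (tt ∷ summand) (pow2 (pow2 xs)) summand≤M (≡-≤-trans (length-pow2-pow2 xs) o≤M))

    private
      cutoffs levels : List Unit
      cutoffs = ⟦ cutoffE ⟧ (xs , tt)
      levels = pow2 (pow2 xs) ⊗ (tt ∷ cutoffs)

      length-levels : length levels ≡ 2 ^ (2 ^ k) * suc (cutoff k)
      length-levels = trans (length-times (pow2 (pow2 xs)) (tt ∷ cutoffs)) (cong₂ _*_ (length-pow2-pow2 xs) (cong suc (length-cutoff xs)))

      suc-cutoff≤M : suc (length cutoffs) ≤ M
      suc-cutoff≤M = ≡-≤-trans (cong suc (length-cutoff xs))
        (≤-trans (m≤n*m _ (2 ^ (2 ^ k)) {{m^n≢0 2 (2 ^ k)}}) (≤-trans rest≤codes codes≤M))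

    opaque
      unfolding codesE

      codes-ok : Ok codesE (xs , tt)
      codes-ok = ok-app
        ( ok _
        ▸ ok-app ( ok-app _ (pow2-ok xs q≤M)
                 ▸ ok-app ( ok-app (ok-app _ (pow2-ok xs q≤M) ▸ _) pow2-pow2-ok
                          ▸ ok-cons (ok _) (ok-app _ cutoff-ok)
                          ▸ _)
                     (times-ok (pow2 (pow2 xs)) (tt ∷ cutoffs) (≡-≤-trans (length-pow2-pow2 xs) o≤M) suc-cutoff≤M)
                 ▸ _)
            (times-ok (pow2 xs) levels (≡-≤-trans (length-pow2 xs) q≤M)
              (≡-≤-trans length-levels (≤-trans rest≤codes codes≤M)))
        ▸ _)
        (append-ok {unit} xs (pow2 xs ⊗ levels) k≤M)

  opaque
    unfolding eqE

    eq-ok : ∀ u v → Ok eqE (u , v , tt)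
    eq-ok u v = ok-and (ok-not (ok _)) (ok-not (ok _))

  opaque
    unfolding memberE

    member-ok : ∀ v l → length l ≤ M → Ok memberE (v , l , tt)
    member-ok v l le = ok-any (ok _) le (λ u _ _ → ok-app _ (eq-ok v u))

  opaque
    unfolding nearE

    near-ok : ∀ u v → Ok nearE (tt , u , v , tt)
    near-ok u v = ok-or (ok-app _ (eq-ok u v)) (ok _)

  opaque
    unfolding neighboursE

    neighbours-ok : ∀ l v → length l ≤ M → Ok neighboursE (tt , l , v , tt)
    neighbours-ok l v le = ok-filter (ok _) le (λ _ _ _ → ok _)

    length-neighbours : ∀ l v → length (⟦ neighboursE ⟧ (tt , l , v , tt)) ≤ length l
    length-neighbours l v = length-filterᵇ≤ (adjacent G v) l

  opaque
    unfolding irregularE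

    irregular-ok : ∀ l → length l ≤ M → Ok irregularE (tt , l , tt)
    irregular-ok l le = ok-not (ok-any (ok _) le (λ i _ _ → ok-any (ok _) le (λ j _ _ → ok-and (ok _)
      (ok-app (ok-app _ (neighbours-ok l i le) ▸ ok-app _ (neighbours-ok l j le) ▸ _)
        (sameLength-ok {vtx} {vtx} (⟦ neighboursE ⟧ (tt , l , i , tt)) (⟦ neighboursE ⟧ (tt , l , j , tt))
          (≤-trans (length-neighbours l i) le) (≤-trans (length-neighbours l j) le))))))

  opaque
    unfolding removedE

    removed-ok : ∀ l → length l ≤ M → Ok removedE (tt , l , tt)
    removed-ok l le = ok-filter (ok _) V≤M (λ v _ _ → ok-not (ok-app _ (member-ok v l le)))

    length-removed≤ : ∀ l → length (⟦ removedE ⟧ (tt , l , tt)) ≤ length (allFin n)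
    length-removed≤ l = length-filterᵇ≤ _ (allFin n)

  opaque
    unfolding improveE

    improve-ok : ∀ (l r : List (Fin n)) → length l ≤ M → Ok improveE (l , r , tt)
    improve-ok l r le = ok-if (ok-app _ (shorter-ok {vtx} {vtx} l r le)) (λ _ → ok _) (λ _ → ok _)

  opaque
    unfolding candidateE

    candidate-ok : ∀ l r → length l ≤ M → Ok candidateE (tt , l , r , tt)
    candidate-ok l r le = ok-if (ok-app _ (irregular-ok l le))
      (λ _ → ok-app (ok-app _ (removed-ok l le) ▸ ok _ ▸ _) (improve-ok (⟦ removedE ⟧ (tt , l , tt)) r (≤-trans (length-removed≤ l) V≤M)))
      (λ _ → ok _)

  opaque
    unfolding consAllE

    consAll-ok : ∀ x xss → length xss ≤ M → Ok (consAllE {A}) (x , xss , tt)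
    consAll-ok x xss le = ok-fold (ok _) le (ok _) (λ _ _ _ _ → ok _)

  opaque
    unfolding powersetE

    powerset-ok : ∀ (xs : List ⟦ A ⟧ₜ) → 2 ^ length xs ≤ M → Ok (powersetE {A}) (xs , tt)
    powerset-ok {A} xs le = ok-fold (ok _) (≤-trans (m≤2^m (length xs)) le) (ok _)
      (λ x t _ t≤ → let r≤ = ≡-≤-trans (length-powerset {A} t) (≤-trans (^-monoʳ-≤ 2 t≤) le) in
        ok-app (ok-app _ (consAll-ok {A} x (powerset {A} t) r≤) ▸ ok _ ▸ _)
          (append-ok {list A} (⟦ consAllE {A} ⟧ (x , powerset {A} t , tt)) (powerset {A} t)
            (≡-≤-trans (length-consAll {A} x (powerset {A} t)) r≤)))

  module _ (Sl : List (Fin n)) (S≤M : length Sl ≤ M) where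

    opaque
      unfolding outsideNearE

      outsideNear-ok : ∀ u v → Ok outsideNearE (tt , Sl , u , v , tt)
      outsideNear-ok u v = ok-and (ok-not (ok-app _ (member-ok u Sl S≤M))) (ok-app _ (near-ok u v))

    opaque
      unfolding sameMaskE

      sameMask-ok : ∀ u v → Ok sameMaskE (tt , Sl , u , v , tt)
      sameMask-ok u v = ok-all (ok _) S≤M (λ _ _ _ → ok-if (ok _) (λ _ → ok _) (λ _ → ok-not (ok _)))

    opaque
      unfolding firstE

      first-ok : ∀ v → Ok firstE (tt , Sl , v , tt)
      first-ok v = ok-and (ok-not (ok-app _ (member-ok v Sl S≤M)))
        (ok-not (ok-any (ok _) V≤M (λ u _ _ → ok-and (ok-app _ (outsideNear-ok u v)) (ok-and (ok-app _ (sameMask-ok u v)) (ok _)))))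

    opaque
      unfolding repE

      rep-ok : ∀ v → Ok repE (tt , Sl , v , tt)
      rep-ok v = ok-and (ok-not (ok-app _ (member-ok v Sl S≤M)))
        (ok-not (ok-any (ok _) V≤M (λ u _ _ → ok-and (ok-app _ (outsideNear-ok u v)) (ok _))))

    opaque
      unfolding hasClassE

      hasClass-ok : ∀ v w → Ok hasClassE (tt , Sl , v , w , tt)
      hasClass-ok v w = ok-any (ok _) V≤M (λ u _ _ → ok-and (ok-app _ (outsideNear-ok u v)) (ok-app _ (sameMask-ok u w)))

    opaque
      unfolding coversE

      covers-ok : ∀ u v → Ok coversE (tt , Sl , u , v , tt)
      covers-ok u v = ok-not (ok-any (ok _) V≤M (λ w _ _ → ok-and (ok-app _ (outsideNear-ok w u)) (ok-not (ok-app _ (hasClass-ok v w)))))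

    opaque
      unfolding sameTypeE

      sameType-ok : ∀ u v → Ok sameTypeE (tt , Sl , u , v , tt)
      sameType-ok u v = ok-and (ok-app _ (covers-ok u v)) (ok-app _ (covers-ok v u))

    opaque
      unfolding earlierE

      earlier-ok : ∀ v r → Ok earlierE (tt , Sl , v , r , tt)
      earlier-ok v r = ok-and (ok-app _ (rep-ok r)) (ok-and (ok-app _ (sameType-ok v r))
        (ok-not (ok-any (ok _) V≤M (λ w _ _ → ok-and (ok-app _ (outsideNear-ok w v)) (ok-not (ok _))))))

    opaque
      unfolding beforeE

      before-ok : ∀ v → Ok beforeE (tt , Sl , v , tt)
      before-ok v = ok-filter (ok _) V≤M (λ r _ _ → ok-app _ (earlier-ok v r))

      before≤M : ∀ v → length (⟦ beforeE ⟧ (tt , Sl , v , tt)) ≤ M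
      before≤M v = ≤-trans (length-filterᵇ≤ _ (allFin n)) V≤M

    module _ (gl : List Unit) where

      opaque
        unfolding sameLevelE

        sameLevel-ok : ∀ (xs ys : List (Fin n)) → length xs ≤ M → length ys ≤ M → Ok sameLevelE (gl , xs , ys , tt)
        sameLevel-ok xs ys le le′ = ok-if (ok-app _ (shorter-ok {vtx} {unit} xs gl le))
          (λ _ → ok-app _ (sameLength-ok {vtx} {vtx} xs ys le le′)) (λ _ → ok-not (ok-app _ (shorter-ok {vtx} {unit} ys gl le′)))

      opaque
        unfolding matchE

        match-ok : ∀ x v → Ok matchE (tt , Sl , gl , x , v , tt)
        match-ok x v = ok-if (ok-app _ (member-ok x Sl S≤M)) (λ _ → ok-app _ (eq-ok x v))
          (λ _ → ok-and (ok-not (ok-app _ (member-ok v Sl S≤M))) (ok-and (ok-app _ (sameMask-ok x v)) (ok-and (ok-app _ (sameType-ok x v))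
            (ok-app (ok _ ▸ ok-app _ (before-ok x) ▸ ok-app _ (before-ok v) ▸ _)
              (sameLevel-ok (⟦ beforeE ⟧ (tt , Sl , x , tt)) (⟦ beforeE ⟧ (tt , Sl , v , tt)) (before≤M x) (before≤M v))))))

      opaque
        unfolding inKernelE

        inKernel-ok : ∀ v → Ok inKernelE (tt , Sl , gl , v , tt)
        inKernel-ok v = ok-not (ok-any (ok _) V≤M (λ u _ _ → ok-and (ok-app _ (match-ok u v)) (ok _)))

      opaque
        unfolding kernelE

        kernel-ok : Ok kernelE (tt , Sl , gl , tt)
        kernel-ok = ok-filter (ok _) V≤M (λ v _ _ → ok-app _ (inKernel-ok v))

      opaque
        unfolding retainedE

        retained-ok : ∀ X v → length X ≤ M → Ok retainedE (tt , Sl , gl , X , v , tt)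
        retained-ok X v le = ok-and (ok-or (ok-app _ (member-ok v Sl S≤M)) (ok-app _ (first-ok v)))
          (ok-any (ok _) le (λ x _ _ → ok-app _ (match-ok x v)))

      opaque
        unfolding survivorsE

        survivors-ok : ∀ X → length X ≤ M → Ok survivorsE (tt , Sl , gl , X , tt)
        survivors-ok X le = ok-filter (ok _) V≤M (λ v _ _ → ok-app _ (retained-ok X v le))

        survivors≤M : ∀ X → length (⟦ survivorsE ⟧ (tt , Sl , gl , X , tt)) ≤ M
        survivors≤M X = ≤-trans (length-filterᵇ≤ _ (allFin n)) V≤M

      opaque
        unfolding bestE

        best-ok : ∀ Xs → length Xs ≤ M → (∀ {X} → X ∈ˡ Xs → length X ≤ M) → Ok bestE (tt , Sl , gl , Xs , tt)
        best-ok Xs le small = ok-fold (ok _) le (ok _) (λ X t X∈ _ →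
          ok-app (ok _ ▸ ok-app _ (survivors-ok X (small X∈)) ▸ ok _ ▸ _) (candidate-ok (⟦ survivorsE ⟧ (tt , Sl , gl , X , tt)) _ (survivors≤M X)))

    opaque
      unfolding P₃E

      P₃-ok : ∀ a b c → Ok P₃E (tt , Sl , a , b , c , tt)
      P₃-ok a b c = ok-and (ok-not (ok-app _ (member-ok a Sl S≤M))) (ok-and (ok-not (ok-app _ (member-ok b Sl S≤M)))
        (ok-and (ok-not (ok-app _ (member-ok c Sl S≤M))) (ok-and (ok _) (ok-and (ok _) (ok-not (ok-app _ (near-ok a c)))))))

    opaque
      unfolding expandE

      expand-ok : Ok expandE (tt , Sl , tt)
      expand-ok = ok-fold (ok _) V≤M (ok _) (λ a _ _ _ → ok-fold (ok _) V≤M (ok _) (λ b _ _ _ → ok-fold (ok _) V≤M (ok _) (λ c _ _ _ →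
        ok-if (ok-app _ (P₃-ok a b c)) (λ _ → ok _) (λ _ → ok _))))

    opaque
      unfolding isClusterE

      isCluster-ok : Ok isClusterE (tt , Sl , tt)
      isCluster-ok = ok-uncons (ok-app _ expand-ok) (ok _) (λ _ _ → ok _)

  open Search G

  module _ (3≤M : 3 ≤ M) (st : List (List (Fin n))) (st≤M : length st ≤ M) (small : ∀ {X} → X ∈ˡ st → length X ≤ M) where

    opaque
      unfolding expandAllE

      expandAll-ok : Ok expandAllE (tt , st , tt)
      expandAll-ok = ok-fold (ok _) st≤M (ok _) (λ X t X∈ _ →
        ok-app (ok-app _ (expand-ok X (small X∈)) ▸ ok _ ▸ _) (append-ok {Vertices} (expand X) _ (≤-trans (length-expand≤3 X) 3≤M)))

    opaque
      unfolding stepE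

      step-ok : Ok stepE (tt , st , tt)
      step-ok = ok-if (ok-any (ok _) st≤M (λ X _ X∈ → ok-app _ (isCluster-ok X (small X∈)))) (λ _ → ok _) (λ _ → ok-app _ expandAll-ok)

    opaque
      unfolding pickE

      pick-ok : Ok pickE (tt , st , tt)
      pick-ok = ok-fold (ok _) st≤M (ok _) (λ X _ X∈ _ → ok-if (ok-app _ (isCluster-ok X (small X∈))) (λ _ → ok _) (λ _ → ok _))

  opaque
    unfolding searchE

    search-ok : 3 ≤ M → (∀ t → length (states t) ≤ M) → (∀ t {X} → X ∈ˡ states t → length X ≤ M) → Ok searchE (tt , tt)
    search-ok 3≤M wide small = ok-fold (ok _) V≤M (ok _) (λ _ t _ _ → ok-app _ (step-ok 3≤M (states t) (wide t) (small t)))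

-- The part of the length bound that depends on k: the number of subsets of the kernel, the cut-off,
-- the width of the search and the three branches of an expansion.
size : ℕ → ℕ
size k = 2 ^ codes k + (cutoff k + (3 ^ k + 3))

codes≤size : ∀ k → 2 ^ codes k ≤ size k
codes≤size k = m≤m+n _ _

cutoff≤size : ∀ k → cutoff k ≤ size k
cutoff≤size k = ≤-trans (m≤m+n _ _) (m≤n+m _ (2 ^ codes k))

3^≤size : ∀ k → 3 ^ k ≤ size k
3^≤size k = ≤-trans (m≤m+n _ 3) (≤-trans (m≤n+m _ (cutoff k)) (m≤n+m _ (2 ^ codes k)))

3≤size : ∀ k → 3 ≤ size k
3≤size k = ≤-trans (m≤n+m 3 (3 ^ k)) (≤-trans (m≤n+m _ (cutoff k)) (m≤n+m _ (2 ^ codes k)))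

k≤size : ∀ k → k ≤ size k
k≤size k = ≤-trans (≤-trans (m≤m+n k _) (m≤2^m (codes k))) (codes≤size k)

-- Computability of the bound and the final estimate

module _ {n : ℕ} (G : Graph n) where

  open Semantics G
  open Specifications G

  enc-number : ∀ (xs : List Unit) → enc Number xs ≡ encodeℕ (length xs)
  enc-number []       = refl
  enc-number (x ∷ xs) = cong (cons nil) (enc-number xs)

  opaque
    unfolding sizeE

    length-sizeE : ∀ xs → length (⟦ sizeE ⟧ (xs , tt)) ≡ size (length xs)
    length-sizeE xs = trans (length-append {unit} (pow2 cs) rest) (cong₂ _+_ (trans (length-pow2 cs) (cong (2 ^_) (length-codes xs)))
      (trans (length-append {unit} (⟦ cutoffE ⟧ (xs , tt)) (append {unit} (⟦ pow3E ⟧ (xs , tt)) three)) (cong₂ _+_ (length-cutoff xs)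
        (trans (length-append {unit} (⟦ pow3E ⟧ (xs , tt)) three) (cong (_+ 3) (Bounds.length-pow3 G n ≤-refl xs))))))
      where
      cs three rest : List Unit
      cs = ⟦ codesE ⟧ (xs , tt)
      three = tt ∷ tt ∷ tt ∷ []
      rest = append {unit} (⟦ cutoffE ⟧ (xs , tt)) (append {unit} (⟦ pow3E ⟧ (xs , tt)) three)

  length-power : ∀ d xs → length (⟦ powerE d ⟧ (xs , tt)) ≡ length xs ^ d
  length-power zero    xs = refl
  length-power (suc d) xs = trans (length-times xs (⟦ powerE d ⟧ (xs , tt))) (cong (length xs *_) (length-power d xs))

  length-literal : ∀ {Γ} c (ρ : Env Γ) → length (⟦ literalE c ⟧ ρ) ≡ c
  length-literal zero    ρ = refl
  length-literal (suc c) ρ = cong suc (length-literal c ρ)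

  length-bound : ∀ c d xs → length (⟦ boundE c d ⟧ (xs , tt)) ≡ c * (2 + size (length xs)) ^ d
  length-bound c d xs = trans (length-times (⟦ literalE c ⟧ (xs , tt)) (⟦ powerE d ⟧ (base , tt)))
    (cong₂ _*_ (length-literal c (xs , tt)) (trans (length-power d base) (cong (λ m → (2 + m) ^ d) (length-sizeE xs))))
    where
    base : List Unit
    base = tt ∷ tt ∷ ⟦ sizeE ⟧ (xs , tt)

  module _ (M : ℕ) (n≤M : n ≤ M) where

    open Bounded M n≤M
    open Bounds G M n≤M

    opaque
      unfolding sizeE

      size-ok : ∀ xs → size (length xs) ≤ M → Ok sizeE (xs , tt)
      size-ok xs size≤M = ok-app
        ( ok-app (ok-app _ (codes-ok xs c≤ g≤) ▸ _) (pow2-ok cs (≡-≤-trans (cong (2 ^_) (length-codes xs)) c≤))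
        ▸ ok-app ( ok-app _ (cutoff-ok xs c≤ g≤)
                 ▸ ok-app (ok-app _ (pow3-ok xs (≤-trans (3^≤size (length xs)) size≤M) (≤-trans (k≤size (length xs)) size≤M)) ▸ ok _ ▸ _)
                     (append-ok {unit} (⟦ pow3E ⟧ (xs , tt)) three (≡-≤-trans (length-pow3 xs) (≤-trans (3^≤size (length xs)) size≤M)))
                 ▸ _)
            (append-ok {unit} (⟦ cutoffE ⟧ (xs , tt)) (append {unit} (⟦ pow3E ⟧ (xs , tt)) three)
              (≡-≤-trans (length-cutoff xs) g≤))
        ▸ _)
        (append-ok {unit} (pow2 cs) _ (≡-≤-trans (trans (length-pow2 cs) (cong (2 ^_) (length-codes xs))) c≤))
        where
        c≤ : 2 ^ codes (length xs) ≤ M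
        c≤ = ≤-trans (codes≤size (length xs)) size≤M
        g≤ : cutoff (length xs) ≤ M
        g≤ = ≤-trans (cutoff≤size (length xs)) size≤M
        cs three : List Unit
        cs = ⟦ codesE ⟧ (xs , tt)
        three = tt ∷ tt ∷ tt ∷ []

    power-ok : ∀ d xs → length xs ≤ M → (∀ j → j ≤ d → length xs ^ j ≤ M) → Ok (powerE d) (xs , tt)
    power-ok zero    xs le pow = ok _
    power-ok (suc d) xs le pow = ok-app (ok _ ▸ ok-app _ (power-ok d xs le (λ j j≤d → pow j (m≤n⇒m≤1+n j≤d))) ▸ _)
      (times-ok xs (⟦ powerE d ⟧ (xs , tt)) le (≡-≤-trans (length-power d xs) (pow d (n≤1+n d))))

    literal-ok : ∀ {Γ} c (ρ : Env Γ) → Ok (literalE c) ρ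
    literal-ok zero    ρ = ok _
    literal-ok (suc c) ρ = ok-cons (ok _) (literal-ok c ρ)

    -- The exponent `suc d` makes the hypothesis cover the base itself, its first power, also when
    -- `d` is zero.
    bound-ok : ∀ c d xs → c ≤ M → (2 + size (length xs)) ^ suc d ≤ M → Ok (boundE c d) (xs , tt)
    bound-ok c d xs c≤M p≤M = ok-app
      ( literal-ok c (xs , tt)
      ▸ ok-app (ok-cons (ok _) (ok-cons (ok _) (ok-app _ (size-ok xs (≤-trans (m≤n+m _ 2) b≤M)))) ▸ _)
          (power-ok d base base≤M (λ j j≤d → ≡-≤-trans (cong (λ m → (2 + m) ^ j) (length-sizeE xs)) (pow j (m≤n⇒m≤1+n j≤d))))
      ▸ _)
      (times-ok (⟦ literalE c ⟧ (xs , tt)) (⟦ powerE d ⟧ (base , tt)) (≡-≤-trans (length-literal c (xs , tt)) c≤M)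
        (≡-≤-trans (trans (length-power d base) (cong (λ m → (2 + m) ^ d) (length-sizeE xs))) (pow d (n≤1+n d))))
      where
      base : List Unit
      base = tt ∷ tt ∷ ⟦ sizeE ⟧ (xs , tt)
      pow : ∀ j → j ≤ suc d → (2 + size (length xs)) ^ j ≤ M
      pow j j≤ = ≤-trans (^-monoʳ-≤ (2 + size (length xs)) j≤) p≤M
      b≤M : 2 + size (length xs) ≤ M
      b≤M = ≡-≤-trans (sym (^-identityʳ _)) (pow 1 (s≤s z≤n))
      base≤M : length base ≤ M
      base≤M = ≡-≤-trans (cong (2 +_) (length-sizeE xs)) b≤M

-- Terms on numbers do not consult the graph, so their semantics over the empty graph provides the
-- run.
computable-bound : ∀ c d → Computable (λ k → c * (2 + size k) ^ d)
computable-bound c d = function (boundE c d) , runs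
  where
  empty : Graph 0
  empty = record { adjacent = λ () ; symmetric = λ () ; loopless = λ () }
  open Semantics empty
  runs : ∀ k → ∃[ t ] (function (boundE c d) · encodeℕ k ∷ [] ⇓ encodeℕ (c * (2 + size k) ^ d) ⟨ t ⟩)
  runs k = convert (evaluate-function (boundE c d) (xs , tt) (Ok.bnd (bound-ok empty M z≤n c d xs
      (m≤m+n c _) (≡-≤-trans (cong (λ m → (2 + size m) ^ suc d) (length-replicate k)) (m≤n+m _ c)))))
    where
    xs : List Unit
    xs = replicate k tt
    M : ℕ
    M = c + (2 + size k) ^ suc d
    open Bounded M z≤n
    open Bounds empty M z≤n using (module Ok)
    result : List Unit
    result = ⟦ boundE c d ⟧ (xs , tt)
    convert : Within (function (boundE c d)) (enc Number xs ∷ []) (enc Number result) (time (boundE c d) M) →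
              ∃[ t ] (function (boundE c d) · encodeℕ k ∷ [] ⇓ encodeℕ (c * (2 + size k) ^ d) ⟨ t ⟩)
    convert (t , run , _) = t , subst₂ (λ x y → function (boundE c d) · x ∷ [] ⇓ y ⟨ t ⟩)
      (trans (enc-number empty xs) (cong encodeℕ (length-replicate k)))
      (trans (enc-number empty result) (cong encodeℕ (trans (length-bound empty c d xs) (cong (λ m → c * (2 + size m) ^ d) (length-replicate k)))))
      run

module Main {n : ℕ} (G : Graph n) {k : ℕ} (number : IsClusterDeletionNumber G k) where

  open Semantics G
  open Specifications G
  open Search G

  M : ℕ
  M = n + size k

  n≤M : n ≤ M
  n≤M = m≤m+n n (size k)

  size≤M : size k ≤ M
  size≤M = m≤n+m (size k) n

  open Bounded M n≤M
  open Bounds G M n≤M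

  private
    deletion = proj₁ (proj₂ (proj₁ number))
    ∣D∣      = proj₂ (proj₂ (proj₁ number))
    searched = ⟦ searchE ⟧ (tt , tt)

    Sl : List (Fin n)
    Sl = pick searched

    Sl≡ : Sl ≡ found deletion ∣D∣
    Sl≡ = cong pick search-states

    length-Sl : length Sl ≡ k
    length-Sl = trans (cong length Sl≡) (length-found deletion ∣D∣ (proj₂ number))

    free : P₃-Free Sl
    free = subst P₃-Free (sym Sl≡) (found-P₃-Free deletion ∣D∣)

    xs gl : List Unit
    xs = ⟦ unitsE {vtx} ⟧ (Sl , tt)
    gl = ⟦ cutoffE ⟧ (xs , tt)

    length-xs : length xs ≡ k
    length-xs = trans (length-units {vtx} Sl) length-Sl

    length-gl : length gl ≡ cutoff (length Sl)
    length-gl = trans (length-cutoff xs) (cong cutoff (length-units {vtx} Sl))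

    Kl : List (Fin n)
    Kl = ⟦ kernelE ⟧ (tt , Sl , gl , tt)

    length-Kl : length Kl ≤ codes k
    length-Kl = ≤-trans (length-kernel G Sl (P₃-Free⇒cluster {Sl} free) gl length-gl) (≤-reflexive (cong codes length-Sl))

    answer : List (Fin n)
    answer = ⟦ bestE ⟧ (tt , Sl , gl , powerset {vtx} Kl , tt)

    answer-correct : IsIᵥ G (length answer)
    answer-correct = solve-correct G Sl (P₃-Free⇒cluster {Sl} free) gl length-gl

    answer≤M : length answer ≤ M
    answer≤M = let I , _ , eq = proj₁ answer-correct in ≡-≤-trans (sym eq) (≤-trans (∣p∣≤n I) n≤M)

    2^K≤M : 2 ^ length Kl ≤ M
    2^K≤M = ≤-trans (^-monoʳ-≤ 2 length-Kl) (≤-trans (codes≤size k) size≤M)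

    k≤M : k ≤ M
    k≤M = ≤-trans (k≤size k) size≤M

    S≤M : length Sl ≤ M
    S≤M = ≡-≤-trans length-Sl k≤M

    wide : ∀ t → length (states t) ≤ M
    wide t = let l = states-level deletion ∣D∣ t in
      ≤-trans (SearchLevel.width l) (≤-trans (^-monoʳ-≤ 3 (depth≤k deletion ∣D∣ l)) (≤-trans (3^≤size k) size≤M))

    small : ∀ t {X} → X ∈ˡ states t → length X ≤ M
    small t X∈ = let l = states-level deletion ∣D∣ t in
      ≤-trans (SearchLevel.small l X∈) (≤-trans (depth≤k deletion ∣D∣ l) k≤M)

    3≤M : 3 ≤ M
    3≤M = ≤-trans (3≤size k) size≤M

  opaque
    unfolding solveE

    solve≡ : ⟦ solveE ⟧ (tt , Sl , gl , tt) ≡ ⟦ unitsE {vtx} ⟧ (answer , tt)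
    solve≡ = refl

    solve-ok : Ok solveE (tt , Sl , gl , tt)
    solve-ok = ok-app
      ( ok-app
          ( ok _ ▸ ok _ ▸ ok _
          ▸ ok-app (ok-app _ (kernel-ok Sl S≤M gl) ▸ _) (powerset-ok {vtx} Kl 2^K≤M)
          ▸ _)
          (best-ok Sl S≤M gl (powerset {vtx} Kl) (≡-≤-trans (length-powerset {vtx} Kl) 2^K≤M)
            (λ X∈ → ≤-trans (∈-powerset⇒length≤ {vtx} Kl X∈) (≤-trans (m≤2^m (length Kl)) 2^K≤M)))
      ▸ _)
      (units-ok {vtx} answer answer≤M)

  opaque
    unfolding solveWithE

    solveWith≡ : ⟦ solveWithE ⟧ (tt , Sl , tt) ≡ ⟦ solveE ⟧ (tt , Sl , gl , tt)
    solveWith≡ = refl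

    solveWith-ok : Ok solveWithE (tt , Sl , tt)
    solveWith-ok = ok-app
      (ok _ ▸ ok _ ▸ ok-app (ok-app _ (units-ok {vtx} Sl S≤M) ▸ _)
         (cutoff-ok xs (≡-≤-trans (cong (λ m → 2 ^ codes m) length-xs) (≤-trans (codes≤size k) size≤M))
                       (≡-≤-trans (cong cutoff length-xs) (≤-trans (cutoff≤size k) size≤M)))
       ▸ _)
      solve-ok

  opaque
    unfolding mainE

    main≡ : ⟦ mainE ⟧ (tt , tt) ≡ ⟦ solveWithE ⟧ (tt , Sl , tt)
    main≡ = refl

    main-ok : Ok mainE (tt , tt)
    main-ok = ok-app
      (ok _ ▸ ok-app (ok _ ▸ ok-app _ (search-ok 3≤M wide small) ▸ _)
         (pick-ok 3≤M searched (subst (λ st → length st ≤ M) (sym search-states) (wide (allFin n)))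
            (λ {X} X∈ → small (allFin n) (subst (X ∈ˡ_) search-states X∈)))
       ▸ _)
      solveWith-ok

  m : ℕ
  m = length answer

  output : enc Number (⟦ mainE ⟧ (tt , tt)) ≡ encodeℕ m
  output = trans (cong (enc Number) (trans main≡ (trans solveWith≡ solve≡)))
    (trans (enc-number G (⟦ unitsE {vtx} ⟧ (answer , tt))) (cong encodeℕ (length-units {vtx} answer)))

  run : ∀ c d → (∀ m → time mainE m ≤ c * suc m ^ d) →
        IsIᵥ G m × ComputesWithin (function mainE) (encodeGraph G) (encodeℕ m) (c * (2 + size k) ^ d * (n ⊔ 1) ^ d)
  run c d poly = answer-correct , within (evaluate-function mainE (tt , tt) (Ok.bnd main-ok))
    where
    -- Turns the sum of n and a function of k into a product, so that its power separates into a
    -- factor in k and a power of n. With `n ⊔ 1` this holds for the empty graph too.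
    sizes : suc M ≤ (2 + size k) * (n ⊔ 1)
    sizes = begin
      suc (n + size k)                       ≡⟨ +-suc n (size k) ⟨
      n + suc (size k)                       ≤⟨ +-mono-≤ (m≤m⊔n n 1) (≡-≤-trans (sym (*-identityʳ (suc (size k)))) (*-monoʳ-≤ (suc (size k)) (m≤n⊔m n 1))) ⟩
      (2 + size k) * (n ⊔ 1)                 ∎
      where open ≤-Reasoning
    within : Within (function mainE) (encodeGraph G ∷ []) (enc Number (⟦ mainE ⟧ (tt , tt))) (time mainE M) →
             ComputesWithin (function mainE) (encodeGraph G) (encodeℕ m) (c * (2 + size k) ^ d * (n ⊔ 1) ^ d)
    within (t , r , le) = t , subst (λ y → function mainE · encodeGraph G ∷ [] ⇓ y ⟨ t ⟩) output r , (begin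
      t                                         ≤⟨ le ⟩
      time mainE M                              ≤⟨ poly M ⟩
      c * suc M ^ d                             ≤⟨ *-monoʳ-≤ c (^-monoˡ-≤ d sizes) ⟩
      c * ((2 + size k) * (n ⊔ 1)) ^ d             ≡⟨ cong (c *_) (^-distribʳ-* d (2 + size k) (n ⊔ 1)) ⟩
      c * ((2 + size k) ^ d * (n ⊔ 1) ^ d)         ≡⟨ *-assoc c _ _ ⟨
      c * (2 + size k) ^ d * (n ⊔ 1) ^ d           ∎)
      where
      open ≤-Reasoning
      ^-distribʳ-* : ∀ d a b → (a * b) ^ d ≡ a ^ d * b ^ d
      ^-distribʳ-* zero    a b = refl
      ^-distribʳ-* (suc d) a b = trans (cong (a * b *_) (^-distribʳ-* d a b)) ([m*n]*[o*p]≡[m*o]*[n*p] a b (a ^ d) (b ^ d))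

theorem3 : Σ[ p ∈ Program ] Σ[ f ∈ (ℕ → ℕ) ] Σ[ c ∈ ℕ ]
    (Computable f ×
    (∀ (n : ℕ) (G : Graph n) (k : ℕ) → IsClusterDeletionNumber G k →
    ∃[ m ] (IsIᵥ G m ×
    ComputesWithin p (encodeGraph G) (encodeℕ m) (f k * (n ⊔ 1) ^ c))))
theorem3 = assemble (time-poly mainE)
  where
  assemble : Poly (time mainE) → _
  assemble (c , d , poly) =
    function mainE , (λ k → c * (2 + size k) ^ d) , d , computable-bound c d ,
    λ n G k number → Main.m G number , Main.run G number c d poly
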